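{- There is an algorithm that, given an instance $(D,\ell,k)$ of Directed Component Order Connectivity in which $D$ is a semicomplete digraph on $n$ vertices, solves it in time $\mathcal{O}^*(2^{16(n-\ell)})$. In particular, Directed Component Order Connectivity parameterized by $n-\ell$ is fixed-parameter tractable on semicomplete digraphs.
   Context: All digraphs are finite, without loops or parallel arcs. A digraph $D$ is semicomplete if for every pair $x,y$ of distinct vertices there is at least one arc between $x$ and $y$ (possibly both $xy$ and $yx$). For a digraph $H$, $\mathrm{mco}(H)$ denotes the number of vertices in a largest strongly connected component of $H$. Directed Component Order Connectivity (DCOC) is the following decision problem. Input: a digraph $D=(V,A)$ with $n=|V|$ and integers $\ell\ge 1$, $k\ge 0$. Question: is there a set $X\subseteq V$ of size $k$ such that $\mathrm{mco}(D-X)\le \ell$? Standing convention: $k+\ell<n$. The notation $\mathcal{O}^*(f)$ suppresses factors polynomial in the input size. The problem parameterized by $n-\ell$ is fixed-parameter tractable if it can be solved in time $g(n-\ell)\cdot n^{\mathcal{O}(1)}$ for some computable function $g$. -}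

module Defs where

open import Data.Bool using (Bool; true; false; T)
open import Data.Fin using (Fin)
open import Data.Fin.Subset using (Subset; _∈_; _⊆_; ∁; ∣_∣; Nonempty)
open import Data.List using (List; []; _∷_; tabulate)
open import Data.Nat using (ℕ; zero; suc; _+_; _*_; _^_; _≤_; _<_)
open import Data.Product using (∃-syntax; _×_)
open import Data.Sum using (_⊎_)
open import Data.Vec using (Vec; []; _∷_; lookup)
open import Function.Bundles using (_⇔_)
open import Relation.Binary.Construct.Closure.ReflexiveTransitive using (Star)
open import Relation.Binary.PropositionalEquality using (_≡_; _≢_)

------------------------------------------------------------------------
-- Digraphs

record Digraph (n : ℕ) : Set where
  field
    arc      : Fin n → Fin n → Bool
    loopless : ∀ v → arc v v ≡ false

open Digraph public

Semicomplete : ∀ {n} → Digraph n → Set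
Semicomplete D = ∀ u v → u ≢ v → T (arc D u v) ⊎ T (arc D v u)

-- Induced subdigraphs D[W] are represented by D together with the
-- vertex set W.

InducedArc : ∀ {n} → Digraph n → Subset n → Fin n → Fin n → Set
InducedArc D W u v = u ∈ W × v ∈ W × T (arc D u v)

Strong : ∀ {n} → Digraph n → Subset n → Set
Strong D W = ∀ u v → u ∈ W → v ∈ W → Star (InducedArc D W) u v

record StrongComponent {n : ℕ} (D : Digraph n) (W C : Subset n) : Set where
  field
    nonempty : Nonempty C
    within   : C ⊆ W
    strong   : Strong D C
    maximal  : ∀ C′ → C ⊆ C′ → C′ ⊆ W → Strong D C′ → C′ ⊆ C

-- mco(D[W]) = m.  No m qualifies if W is empty, which cannot occur below
-- because fewer than n vertices are deleted.
IsMco : ∀ {n} → Digraph n → Subset n → ℕ → Set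
IsMco D W m =
  (∃[ C ] StrongComponent D W C × ∣ C ∣ ≡ m) ×
  (∀ C → StrongComponent D W C → ∣ C ∣ ≤ m)

------------------------------------------------------------------------
-- Directed Component Order Connectivity

record Instance : Set where
  field
    n   : ℕ
    D   : Digraph n
    ℓ k : ℕ
    1≤ℓ   : 1 ≤ ℓ
    k+ℓ<n : k + ℓ < n

open Instance public

DCOC : Instance → Set
DCOC I = ∃[ X ] ∣ X ∣ ≡ k I × (∃[ m ] IsMco (D I) (∁ X) m × m ≤ ℓ I)

------------------------------------------------------------------------
-- Model of computation
--
-- First-order, call-by-value recursive programs over binary trees (the
-- language F of Jones, "Computability and Complexity from a Programming
-- Perspective").  The primitives are constant-time pointer operations, as
-- trees are shared and only the root constructor is ever tested, so running
-- times agree with those of Turing machines up to a polynomial.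

data Tree : Set where
  nil : Tree
  _∙_ : Tree → Tree → Tree

infixr 5 _∙_

-- Expressions over function symbols Fin m of the given arities, with γ free
-- variables (de Bruijn indices).
data Exp {m : ℕ} (arity : Fin m → ℕ) (γ : ℕ) : Set
data Exps {m : ℕ} (arity : Fin m → ℕ) (γ : ℕ) : ℕ → Set

data Exp {m} arity γ where
  var  : Fin γ → Exp arity γ
  nil  : Exp arity γ
  cons : Exp arity γ → Exp arity γ → Exp arity γ
  -- The second branch binds the left subtree as variable 0 and the right
  -- subtree as variable 1.
  case : Exp arity γ → Exp arity γ → Exp arity (suc (suc γ)) → Exp arity γ
  call : (f : Fin m) → Exps arity γ (arity f) → Exp arity γ

data Exps {m} arity γ where
  []  : Exps arity γ 0
  _∷_ : ∀ {a} → Exp arity γ → Exps arity γ a → Exps arity γ (suc a)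

record Program : Set where
  field
    {m}   : ℕ
    arity : Fin m → ℕ
    body  : (f : Fin m) → Exp arity (arity f)
    main  : Exp arity 1

module Semantics (P : Program) where
  open Program P

  -- ρ ⊢ e ⇓ v [ t ]: in environment ρ, e evaluates to v in t steps.
  data _⊢_⇓_[_] {γ} (ρ : Vec Tree γ) : Exp arity γ → Tree → ℕ → Set
  data _⊢_⇓*_[_] {γ} (ρ : Vec Tree γ) : ∀ {a} → Exps arity γ a → Vec Tree a → ℕ → Set

  data _⊢_⇓_[_] {γ} ρ where
    ⇓var  : ∀ {x} → ρ ⊢ var x ⇓ lookup ρ x [ 1 ]
    ⇓nil  : ρ ⊢ nil ⇓ nil [ 1 ]
    ⇓cons : ∀ {e₁ e₂ v₁ v₂ t₁ t₂} →
            ρ ⊢ e₁ ⇓ v₁ [ t₁ ] → ρ ⊢ e₂ ⇓ v₂ [ t₂ ] →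
            ρ ⊢ cons e₁ e₂ ⇓ v₁ ∙ v₂ [ suc (t₁ + t₂) ]
    ⇓case-nil  : ∀ {e e₁ e₂ v t t₁} →
                 ρ ⊢ e ⇓ nil [ t ] → ρ ⊢ e₁ ⇓ v [ t₁ ] →
                 ρ ⊢ case e e₁ e₂ ⇓ v [ suc (t + t₁) ]
    ⇓case-cons : ∀ {e e₁ e₂ a b v t t₂} →
                 ρ ⊢ e ⇓ a ∙ b [ t ] → (a ∷ b ∷ ρ) ⊢ e₂ ⇓ v [ t₂ ] →
                 ρ ⊢ case e e₁ e₂ ⇓ v [ suc (t + t₂) ]
    ⇓call : ∀ {f es vs v t t′} →
            ρ ⊢ es ⇓* vs [ t ] → vs ⊢ body f ⇓ v [ t′ ] →
            ρ ⊢ call f es ⇓ v [ suc (t + t′) ]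

  data _⊢_⇓*_[_] {γ} ρ where
    ⇓[] : ρ ⊢ [] ⇓* [] [ 0 ]
    ⇓∷  : ∀ {a} {e : Exp arity γ} {es : Exps arity γ a} {v vs t t′} →
          ρ ⊢ e ⇓ v [ t ] → ρ ⊢ es ⇓* vs [ t′ ] →
          ρ ⊢ (e ∷ es) ⇓* (v ∷ vs) [ t + t′ ]

-- On the given input, P halts after t steps with the given output.
Runs : (P : Program) (input output : Tree) (t : ℕ) → Set
Runs P input output t = (input ∷ []) ⊢ Program.main P ⇓ output [ t ]
  where open Semantics P

------------------------------------------------------------------------
-- Encodings

size : Tree → ℕ
size nil     = 1
size (a ∙ b) = suc (size a + size b)

encBool : Bool → Tree
encBool false = nil
encBool true  = nil ∙ nil

encNat : ℕ → Tree
encNat zero    = nil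
encNat (suc i) = nil ∙ encNat i

encList : List Tree → Tree
encList []       = nil
encList (x ∷ xs) = x ∙ encList xs

encDigraph : ∀ {n} → Digraph n → Tree
encDigraph D =
  encList (tabulate λ u → encList (tabulate λ v → encBool (arc D u v)))

-- Writing ℓ and k in unary affects the input size only polynomially, since
-- ℓ, k < n and the adjacency matrix already has size at least n.
encInstance : Instance → Tree
encInstance I = encNat (ℓ I) ∙ encNat (k I) ∙ encDigraph (D I)

------------------------------------------------------------------------
-- Time complexity on semicomplete digraphs

-- P solves DCOC on semicomplete digraphs in time at most τ.
SolvesInTime : Program → (Instance → ℕ) → Set
SolvesInTime P τ =
  ∀ I → Semicomplete (D I) →
  ∃[ b ] ∃[ t ] Runs P (encInstance I) (encBool b) t × t ≤ τ I × (b ≡ true ⇔ DCOC I)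

-- DCOC on semicomplete digraphs is solvable in time O*(f).
SolvableInO* : (Instance → ℕ) → Set
SolvableInO* f =
  ∃[ P ] ∃[ c ] ∃[ d ] SolvesInTime P (λ I → f I * (c * size (encInstance I) ^ d))

Computable : (ℕ → ℕ) → Set
Computable g = ∃[ P ] (∀ i → ∃[ t ] Runs P (encNat i) (encNat (g i)) t)

-- DCOC on semicomplete digraphs is fixed-parameter tractable with respect to
-- the parameter κ.
FixedParameterTractable : (Instance → ℕ) → Set
FixedParameterTractable κ =
  ∃[ g ] Computable g × (∃[ P ] ∃[ c ] SolvesInTime P (λ I → g (κ I) * n I ^ c))

{-# OPTIONS --safe #-}

-- Put p = n - ℓ, so that k < p.
--
-- If n ≥ 2ℓ then n ≤ 2p, and one can afford to try all sets X of at most k vertices, all sets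
-- W of more than ℓ vertices disjoint from X, and all ways of splitting W into two nonempty
-- parts without an arc from the second to the first (which exist exactly if W is not strong).
--
-- If n < 2ℓ, then a solution X is the same as a partition of the remaining vertices into three
-- parts, each of size at most ℓ and possibly empty, such that no arc leads back to an earlier
-- part: starting with everything in the middle, as long as the middle part is not strong an
-- initial or a final piece of it can be moved to the first or the last part.  Given the sizes
-- a and b of the first and the last part, the part of a vertex can nearly be read off from its
-- degrees.  A vertex of the first part has indegree less than a + k, one of the last part has
-- outdegree less than b + k, and one of the middle part has outdegree less than n - a and
-- indegree less than n - b.  Since D is semicomplete, at most 2k vertices of one part have so
-- small a degree towards their own part that they could also belong to another given part, so
-- that 14k binary choices suffice to place all vertices.  The deleted vertices then have to
-- cover the arcs leading back, which is decided by branching at most k times.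
module Submission where

open import Defs
open import Data.Bool using (Bool; true; false; T; if_then_else_; not; _∧_; _∨_)
open import Data.Bool.Properties using (T-∧; T-∨; T-≡; T?)
open import Data.Empty using (⊥-elim)
open import Data.Fin using (Fin; zero; suc; toℕ; fromℕ<)
open import Data.Fin.Properties using (toℕ<n; toℕ-fromℕ<; toℕ-injective; all?; any?) renaming (_≟_ to _≟ᶠ_)
open import Data.Fin.Subset using (Subset; _∈_; _∉_; _⊆_; ⁅_⁆; ∁; _∪_; _∩_; ∣_∣; Nonempty)
open import Data.Fin.Subset.Properties
open import Data.List using (List; []; _∷_; length; map; drop; tabulate)
open import Data.List.Membership.Propositional using () renaming (_∈_ to _∈ₗ_)
open import Data.List.Relation.Unary.Any using (here; there)
open import Data.Nat using (ℕ; zero; suc; _+_; _*_; _^_; _∸_; _⊔_; _≤_; _<_; z≤n; s≤s; _<ᵇ_; _≤ᵇ_; _≡ᵇ_; _≤?_; _<?_; NonZero; >-nonZero)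
open import Data.Nat.Properties hiding (_≟_)
open import Data.Nat.Solver using (module +-*-Solver)
open import Data.Product using (∃-syntax; _×_; _,_; proj₁; proj₂)
open import Data.Sum using (_⊎_; inj₁; inj₂; [_,_])
open import Data.Unit using (tt)
open import Data.Vec using (Vec; []; _∷_; lookup)
open import Data.Vec.Functional using (updateAt)
open import Data.Vec.Functional.Properties using (updateAt-updates; updateAt-minimal)
open import Data.Vec.Properties using ([]=⇒lookup; lookup⇒[]=; lookup∘tabulate)
open import Function using (_∘_; const)
open import Function.Bundles using (Equivalence; _⇔_; mk⇔)
open import Relation.Binary.Construct.Closure.ReflexiveTransitive using (Star; ε; _◅_; _◅◅_)
open import Relation.Binary.PropositionalEquality hiding ([_])
open import Relation.Nullary using (¬_; Dec; yes; no; contradiction)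
open import Relation.Nullary.Decidable using (_×-dec_; _→-dec_; ¬?; map′; from-yes)
open import Algebra.Properties.CommutativeMonoid.Sum +-0-commutativeMonoid using (sum; sum-cong-≗; ∑-distrib-+; ∑-comm)

-- The algorithm

-- The bound 14k on the choices holds for a guess of a and b that comes from a solution, but the
-- running time has to be bounded for every guess. The searches therefore carry explicit budgets
-- that cut them off, and a positive answer is justified by the final parting alone, however it was
-- found. Degrees and semicompleteness enter where it is shown that no solution is missed. The
-- search does not try to recover X. A vertex of X may be put into any part that its degrees allow
-- and may survive there, so a part can grow from ℓ to ℓ + k vertices. This is repaired by spending
-- the remaining deletions on the one part that is too large. Hence n < 2ℓ is used twice: at most
-- one part exceeds ℓ, and whenever the middle part splits, one of the two pieces can be moved
-- without making an outer part too large.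

indicator : Bool → ℕ
indicator b = if b then 1 else 0

count : ∀ {n} → (Fin n → Bool) → ℕ
count p = sum (indicator ∘ p)

any : ∀ {n} → (Fin n → Bool) → Bool
any {zero}  p = false
any {suc n} p = p zero ∨ any (p ∘ suc)

-- deleted stands for the vertices in X, and rank orders the three remaining parts.
data Part : Set where
  deleted first middle last : Part

rank : Part → ℕ
rank deleted = 0
rank first   = 1
rank middle  = 2
rank last    = 3

-- Rank 0 is reserved for `deleted`: the head must have positive rank and the tail a still larger
-- one, so an arc with a deleted end never counts.
backward : Bool → Part → Part → Bool
backward e p q = e ∧ ((0 <ᵇ rank q) ∧ (rank q <ᵇ rank p))

-- The deleted vertices are counted along with part j because |part j| + |deleted| ≤ ℓ + k says that
-- the k - |deleted| deletions left over can reduce part j to ℓ vertices.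
deletedOr : Part → Part → Bool
deletedOr j p = (0 ≡ᵇ rank p) ∨ (rank p ≡ᵇ rank j)

isNonempty : {A : Set} → List A → Bool
isNonempty []      = false
isNonempty (_ ∷ _) = true

prependIf : {A : Set} → Bool → A → List A → List A
prependIf b x xs = if b then x ∷ xs else xs

module Search {n : ℕ} (E : Fin n → Fin n → Bool) where

  Parting : Set
  Parting = Fin n → Part

  assign : {A : Set} → (Fin n → A) → Fin n → A → (Fin n → A)
  assign f u x = updateAt f u (const x)

  clash : Fin n → Parting → Bool
  clash u L = any λ v → backward (E u v) (L u) (L v)

  kill : Fin n → Parting → Parting
  kill u L v = if backward (E u v) (L u) (L v) then deleted else L v

  balanced : ℕ → ℕ → Parting → Bool
  balanced M K L =
    (count (deletedOr deleted ∘ L) <ᵇ K) ∧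
    (count (deletedOr first ∘ L) <ᵇ M) ∧
    (count (deletedOr middle ∘ L) <ᵇ M) ∧
    (count (deletedOr last ∘ L) <ᵇ M)

  module _ (M K : ℕ) where

    -- If an arc leads back from u, then u or the heads of all such arcs must be deleted.  The
    -- budget f bounds the depth of the branching only; balanced checks how much is deleted.
    cover : ∀ i → i ≤ n → ℕ → Parting → Bool
    cover zero    _   f L = balanced M K L
    cover (suc i) i<n zero L =
      if clash (fromℕ< i<n) L then false else cover i (<⇒≤ i<n) zero L
    cover (suc i) i<n (suc f) L =
      if clash u L
      then cover i (<⇒≤ i<n) f (assign L u deleted) ∨ cover i (<⇒≤ i<n) f (kill u L)
      else cover i (<⇒≤ i<n) (suc f) L
      where u = fromℕ< i<n

    module _ (f : ℕ) (O : Fin n → List Part) where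

      -- The budget g limits the number of leaves to 2 ^ g, whatever the options are.  A vertex
      -- without options stays deleted.
      choose : ∀ i → i ≤ n → ℕ → Parting → Bool
      pick   : List Part → ∀ i → i < n → ℕ → Parting → Bool
      choose zero    _   g L = cover n ≤-refl f L
      choose (suc i) i<n g L = pick (O (fromℕ< i<n)) i i<n g L
      pick []           i i<n g       L = choose i (<⇒≤ i<n) g L
      pick (x ∷ [])     i i<n g       L = choose i (<⇒≤ i<n) g (assign L (fromℕ< i<n) x)
      pick (x ∷ y ∷ ys) i i<n zero    L = false
      pick (x ∷ y ∷ ys) i i<n (suc g) L =
        choose i (<⇒≤ i<n) g (assign L (fromℕ< i<n) x) ∨ pick (y ∷ ys) i i<n g L

  undecided : Parting
  undecided _ = deleted

  module _ (ℓ : ℕ) where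

    -- A set W is stored as the options it leaves for a splitting: first or middle on W and none
    -- elsewhere.  Without a budget for deletions, the bound n in balanced says that neither part
    -- is all of W.
    allSets : (X : Fin n → Bool) → ∀ i → i ≤ n → (Fin n → List Part) → Bool
    allSets X zero    _   O =
      (count (isNonempty ∘ O) <ᵇ suc ℓ) ∨ choose n (suc n) 0 O n ≤-refl n undecided
    allSets X (suc i) i<n O =
      if X u then allSets X i (<⇒≤ i<n) O
      else allSets X i (<⇒≤ i<n) O ∧ allSets X i (<⇒≤ i<n) (assign O u (first ∷ middle ∷ []))
      where u = fromℕ< i<n

    someSet : ℕ → ∀ i → i ≤ n → (Fin n → Bool) → Bool
    someSet k zero    _   X = (count X <ᵇ suc k) ∧ allSets X n ≤-refl (λ _ → [])
    someSet k (suc i) i<n X =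
      someSet k i (<⇒≤ i<n) X ∨ someSet k i (<⇒≤ i<n) (assign X (fromℕ< i<n) true)

  outdegree indegree : Fin n → ℕ
  outdegree v = count λ w → E v w
  indegree  v = count λ w → E w v

  -- With a and b the sizes of the first and the last part, ak = a + k, na = n - a, bk = b + k
  -- and nb = n - b.
  options : (ak na bk nb : ℕ) → Fin n → List Part
  options ak na bk nb v =
    prependIf (indegree v <ᵇ ak) first
      (prependIf ((outdegree v <ᵇ na) ∧ (indegree v <ᵇ nb)) middle
        (prependIf (outdegree v <ᵇ bk) last []))

  module _ (ℓ k : ℕ) where

    -- As n < 2ℓ, at most one part can be larger than ℓ, so it is enough that each part can be
    -- brought down to ℓ vertices by deletions that are still available.
    probe : (ak na bk nb : ℕ) → Bool
    probe ak na bk nb = choose (suc (ℓ + k)) (suc k) k (options ak na bk nb)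
      n ≤-refl (k * 14) undecided

    -- Passing from b to b + 1 is a successor on `bk` and a predecessor on `nb`, so the thresholds b
    -- + k and n - b are kept up to date without arithmetic.
    probeLast : (ak na bk nb : ℕ) → Bool
    -- The disjunct `false` is the answer of `code #probeLast` when the guesses run out, so that
    -- both clauses fit `↓or`.
    probeLast ak na bk zero     = probe ak na bk zero ∨ false
    probeLast ak na bk (suc nb) = probe ak na bk (suc nb) ∨ probeLast ak na (suc bk) nb

    probeFirst : (ak na : ℕ) → Bool
    probeFirst ak zero     = probeLast ak zero k n ∨ false
    probeFirst ak (suc na) = probeLast ak (suc na) k n ∨ probeFirst (suc ak) na

    decide : Bool
    decide = if n <ᵇ ℓ + ℓ then probeFirst k n else someSet ℓ k n ≤-refl (λ _ → false)

-- Counting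

T-∧⁻ : ∀ {a b} → T (a ∧ b) → T a × T b
T-∧⁻ = Equivalence.to T-∧

T-∧⁺ : ∀ {a b} → T a → T b → T (a ∧ b)
T-∧⁺ a b = Equivalence.from T-∧ (a , b)

sum-mono : ∀ {n} {f g : Fin n → ℕ} → (∀ v → f v ≤ g v) → sum f ≤ sum g
sum-mono {zero}  f≤g = z≤n
sum-mono {suc n} f≤g = +-mono-≤ (f≤g zero) (sum-mono (f≤g ∘ suc))

sum-*ʳ : ∀ {n} (f : Fin n → ℕ) m → sum (λ v → f v * m) ≡ sum f * m
sum-*ʳ {zero}  f m = refl
sum-*ʳ {suc n} f m = trans (cong (f zero * m +_) (sum-*ʳ (f ∘ suc) m)) (sym (*-distribʳ-+ m (f zero) _))

indicator-mono : ∀ a b → (T a → T b) → indicator a ≤ indicator b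
indicator-mono false b     ab = z≤n
indicator-mono true  true  ab = s≤s z≤n
indicator-mono true  false ab = ⊥-elim (ab tt)

count-mono : ∀ {n} (p q : Fin n → Bool) → (∀ v → T (p v) → T (q v)) → count p ≤ count q
count-mono p q p⊆q = sum-mono λ v → indicator-mono (p v) (q v) (p⊆q v)

count-mono-< : ∀ {n} (p q : Fin n → Bool) → (∀ v → T (p v) → T (q v)) →
               ∀ u → T (q u) → ¬ T (p u) → count p < count q
count-mono-< p q p⊆q zero qu pu with p zero | q zero
... | false | true  = s≤s (count-mono (p ∘ suc) (q ∘ suc) (p⊆q ∘ suc))
... | true  | _     = ⊥-elim (pu tt)
count-mono-< p q p⊆q (suc u) qu pu =
  +-mono-≤-< (indicator-mono (p zero) (q zero) (p⊆q zero)) (count-mono-< (p ∘ suc) (q ∘ suc) (p⊆q ∘ suc) u qu pu)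

count-all : ∀ n → count {n} (const true) ≡ n
count-all zero    = refl
count-all (suc n) = cong suc (count-all n)

count≤n : ∀ {n} (p : Fin n → Bool) → count p ≤ n
count≤n {n} p = ≤-trans (count-mono p (const true) (λ _ _ → tt)) (≤-reflexive (count-all n))

count-disjoint : ∀ {n} (p q r : Fin n → Bool) → (∀ v → T (p v) → T (r v)) → (∀ v → T (q v) → T (r v)) →
                 (∀ v → T (p v) → ¬ T (q v)) → count p + count q ≤ count r
count-disjoint p q r p⊆r q⊆r disj =
  ≤-trans (≤-reflexive (sym (∑-distrib-+ (indicator ∘ p) (indicator ∘ q))))
    (sum-mono λ v → pointwise (p v) (q v) (r v) (p⊆r v) (q⊆r v) (disj v))
  where
  pointwise : ∀ a b c → (T a → T c) → (T b → T c) → (T a → ¬ T b) → indicator a + indicator b ≤ indicator c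
  pointwise false b     c ac bc ab = indicator-mono b c bc
  pointwise true  false c ac bc ab = indicator-mono true c ac
  pointwise true  true  c ac bc ab = ⊥-elim (ab tt tt)

count-covered : ∀ {n} (p q r : Fin n → Bool) → (∀ v → T (r v) → T (p v) ⊎ T (q v)) →
                count r ≤ count p + count q
count-covered p q r cov =
  ≤-trans (sum-mono λ v → pointwise (p v) (q v) (r v) (cov v))
    (≤-reflexive (∑-distrib-+ (indicator ∘ p) (indicator ∘ q)))
  where
  pointwise : ∀ a b c → (T c → T a ⊎ T b) → indicator c ≤ indicator a + indicator b
  pointwise a b     false cov = z≤n
  pointwise true  b true cov = s≤s z≤n
  pointwise false b true cov = [ ⊥-elim , indicator-mono true b ∘ const ] (cov tt)

∣∣≡count : ∀ {n} (S : Subset n) → ∣ S ∣ ≡ count (lookup S)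
∣∣≡count []          = refl
∣∣≡count (true ∷ S)  = cong suc (∣∣≡count S)
∣∣≡count (false ∷ S) = ∣∣≡count S

-- A solution must have exactly k vertices; this pads a smaller deletion set, if necessary within a
-- prescribed set.
count-between : ∀ {n} {p q : Fin n → Bool} → (∀ v → T (p v) → T (q v)) →
                ∀ m → count p ≤ m → m ≤ count q →
                ∃[ r ] (∀ v → T (p v) → T (r v)) × (∀ v → T (r v) → T (q v)) × count r ≡ m
count-between {zero} p⊆q m p≤m m≤q = (λ ()) , (λ ()) , (λ ()) , sym (n≤0⇒n≡0 m≤q)
count-between {suc n} {p} {q} p⊆q m p≤m m≤q with p zero in pz | q zero in qz | p⊆q zero
... | true | false | p⊆q₀ = ⊥-elim (p⊆q₀ tt)
... | false | false | _ with r , p⊆r , r⊆q , eq ← count-between (p⊆q ∘ suc) m p≤m m≤q =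
  (λ { zero → false ; (suc v) → r v }) ,
  (λ { zero t → subst T pz t ; (suc v) → p⊆r v }) , (λ { zero () ; (suc v) → r⊆q v }) , eq
count-between {suc n} {p} {q} p⊆q (suc m) (s≤s p≤m) (s≤s m≤q) | true | true | _
  with r , p⊆r , r⊆q , eq ← count-between (p⊆q ∘ suc) m p≤m m≤q =
  (λ { zero → true ; (suc v) → r v }) ,
  (λ { zero _ → tt ; (suc v) → p⊆r v }) , (λ { zero _ → subst T (sym qz) tt ; (suc v) → r⊆q v }) , cong suc eq
count-between {suc n} {p} {q} p⊆q m p≤m m≤q | false | true | _ with m ≤? count (q ∘ suc)
... | yes m≤q′ with r , p⊆r , r⊆q , eq ← count-between (p⊆q ∘ suc) m p≤m m≤q′ =
  (λ { zero → false ; (suc v) → r v }) ,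
  (λ { zero t → subst T pz t ; (suc v) → p⊆r v }) , (λ { zero () ; (suc v) → r⊆q v }) , eq
-- Too few vertices remain without this one, so m is all of `count q`.
... | no m≰q′ = q , p⊆q , (λ v t → t) ,
  trans (cong (λ b → indicator b + count (q ∘ suc)) qz) (≤-antisym (≰⇒> m≰q′) m≤q)

module _ {n : ℕ} {E : Fin n → Fin n → Bool} {y : Fin n → Bool} {k : ℕ}
         (semicomplete : ∀ u v → u ≢ v → T (y u) → T (y v) → T (E u v) ⊎ T (E v u)) where

  -- Double counting: the degree bound leaves room for fewer than count y * k arcs, but
  -- semicompleteness forces about half of count y * count y.
  few-small-degrees : (∀ u → T (y u) → count (λ v → y v ∧ E u v) < k) → count y ≤ k + k
  few-small-degrees small = cancel (count y) refl
    where
    open ≤-Reasoning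
    G : Fin n → Fin n → ℕ
    G u v = indicator (y u ∧ (y v ∧ E u v))

    out : ∀ u → sum (G u) ≤ indicator (y u) * k
    out u with y u | small u
    ... | false | _ = ≤-trans (sum-mono {n} {g = λ _ → 0} (λ _ → z≤n)) (≤-reflexive (zeros n))
      where
      zeros : ∀ n → sum {n} (λ _ → 0) ≡ 0
      zeros zero    = refl
      zeros (suc n) = zeros n
    ... | true | s = ≤-trans (<⇒≤ (s tt)) (≤-reflexive (sym (+-identityʳ k)))

    -- Every vertex of y is u itself, an out-neighbour or an in-neighbour of u; the strict degree
    -- bound pays for u.
    others : ∀ u → T (y u) → count y ≤ k + count (λ v → y v ∧ E v u)
    others u yu = begin
      count y
        ≤⟨ count-covered (λ v → lookup ⁅ u ⁆ v ∨ (y v ∧ E u v)) (λ v → y v ∧ E v u) y neighbour ⟩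
      count (λ v → lookup ⁅ u ⁆ v ∨ (y v ∧ E u v)) + count (λ v → y v ∧ E v u)
        ≤⟨ +-monoˡ-≤ _ (count-covered (lookup ⁅ u ⁆) (λ v → y v ∧ E u v) _ (λ v → Equivalence.to T-∨)) ⟩
      count (lookup ⁅ u ⁆) + count (λ v → y v ∧ E u v) + count (λ v → y v ∧ E v u)
        ≡⟨ cong (λ z → z + count (λ v → y v ∧ E u v) + count (λ v → y v ∧ E v u))
             (trans (sym (∣∣≡count ⁅ u ⁆)) (∣⁅x⁆∣≡1 u)) ⟩
      suc (count (λ v → y v ∧ E u v)) + count (λ v → y v ∧ E v u)
        ≤⟨ +-monoˡ-≤ _ (small u yu) ⟩
      k + count (λ v → y v ∧ E v u) ∎
      where
      neighbour : ∀ v → T (y v) → T (lookup ⁅ u ⁆ v ∨ (y v ∧ E u v)) ⊎ T (y v ∧ E v u)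
      neighbour v yv with u ≟ᶠ v
      ... | yes refl = inj₁ (Equivalence.from T-∨ (inj₁ (subst T (sym ([]=⇒lookup (x∈⁅x⁆ u))) tt)))
      ... | no  u≢v with semicomplete u v u≢v yu yv
      ...   | inj₁ e = inj₁ (Equivalence.from T-∨ (inj₂ (T-∧⁺ yv e)))
      ...   | inj₂ e = inj₂ (T-∧⁺ yv e)

    both : ∀ u → indicator (y u) * count y ≤ indicator (y u) * k + sum (λ v → G v u)
    both u with y u in yu
    ... | false = z≤n
    ... | true  = begin
      count y + 0
        ≡⟨ +-identityʳ _ ⟩
      count y
        ≤⟨ others u (subst T (sym yu) tt) ⟩
      k + count (λ v → y v ∧ E v u)
        ≡⟨ cong (_+ _) (+-identityʳ k) ⟨
      k + 0 + count (λ v → y v ∧ E v u)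
        ≤⟨ +-monoʳ-≤ (k + 0) (count-mono (λ v → y v ∧ E v u) (λ v → y v ∧ E v u) λ v t → t) ⟩
      k + 0 + sum (λ v → indicator (y v ∧ E v u)) ∎

    total : count y * count y ≤ (k + k) * count y
    total = begin
      count y * count y
        ≡⟨ sum-*ʳ (indicator ∘ y) (count y) ⟨
      sum (λ u → indicator (y u) * count y)
        ≤⟨ sum-mono both ⟩
      sum (λ u → indicator (y u) * k + sum (λ v → G v u))
        ≡⟨ ∑-distrib-+ (λ u → indicator (y u) * k) _ ⟩
      sum (λ u → indicator (y u) * k) + sum (λ u → sum (λ v → G v u))
        -- The indegrees inside y add up to the same number of arcs as the outdegrees.
        ≡⟨ cong (_ +_) (∑-comm G) ⟨
      sum (λ u → indicator (y u) * k) + sum (λ v → sum (G v))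
        ≤⟨ +-monoʳ-≤ _ (sum-mono out) ⟩
      sum (λ u → indicator (y u) * k) + sum (λ v → indicator (y v) * k)
        ≡⟨ cong₂ _+_ (sum-*ʳ (indicator ∘ y) k) (sum-*ʳ (indicator ∘ y) k) ⟩
      count y * k + count y * k
        ≡⟨ *-distribˡ-+ (count y) k k ⟨
      count y * (k + k)
        ≡⟨ *-comm (count y) (k + k) ⟩
      (k + k) * count y ∎

    cancel : ∀ m → count y ≡ m → count y ≤ k + k
    cancel zero    eq = ≤-trans (≤-reflexive eq) z≤n
    cancel (suc m) eq = *-cancelʳ-≤ (count y) (k + k) (suc m)
      (subst (λ z → count y * z ≤ (k + k) * z) eq total)

module _ {n : ℕ} {E : Fin n → Fin n → Bool} {y z : Fin n → Bool}
         (semicomplete : ∀ u v → u ≢ v → T (y u) → T (y v) → T (E u v) ⊎ T (E v u))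
         (disjoint : ∀ v → T (y v) → ¬ T (z v))
         (dominates : ∀ u v → T (y u) → T (z v) → T (E u v)) where

  -- A vertex of y already sends arcs to all of z, so an outdegree below |z| + k leaves fewer than k
  -- arcs into y, and `few-small-degrees` applies. With the arcs reversed this also serves for
  -- indegrees.
  few-barely-dominating : ∀ k → count (λ v → y v ∧ (count (E v) <ᵇ count z + k)) ≤ k + k
  few-barely-dominating k = few-small-degrees {E = E} {y = y′}
    (λ u v u≢v u∈ v∈ → semicomplete u v u≢v (proj₁ (T-∧⁻ u∈)) (proj₁ (T-∧⁻ v∈))) small
    where
    y′ : Fin n → Bool
    y′ v = y v ∧ (count (E v) <ᵇ count z + k)
    small : ∀ u → T (y′ u) → count (λ v → y′ v ∧ E u v) < k
    small u u∈ with yu , deg ← T-∧⁻ {y u} u∈ = +-cancelˡ-< (count z) _ _ (begin-strict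
      count z + count (λ v → y′ v ∧ E u v)
        ≤⟨ count-disjoint z (λ v → y′ v ∧ E u v) (E u) (λ v → dominates u v yu) (λ v t → proj₂ (T-∧⁻ {y′ v} t))
             (λ v zv t → disjoint v (proj₁ (T-∧⁻ (proj₁ (T-∧⁻ {y′ v} t)))) zv) ⟩
      count (E u) <⟨ <ᵇ⇒< _ _ deg ⟩
      count z + k ∎)
      where open ≤-Reasoning

-- Strong sets

⊆-card⇒⊇ : ∀ {n} {p q : Subset n} → p ⊆ q → ∣ q ∣ ≤ ∣ p ∣ → q ⊆ p
⊆-card⇒⊇ {p = p} p⊆q q≤p {x} x∈q with x ∈? p
... | yes x∈p = x∈p
... | no  x∉p = contradiction (p⊂q⇒∣p∣<∣q∣ (p⊆q , x , x∈q , x∉p)) (≤⇒≯ q≤p)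

module _ {n : ℕ} (D : Digraph n) where

  record Split (W S : Subset n) : Set where
    constructor split
    field
      initial    : S ⊆ W
      inhabited  : Nonempty S
      proper     : ∃[ v ] v ∈ W × v ∉ S
      noReturn   : ∀ u v → u ∈ W → u ∉ S → v ∈ S → ¬ T (arc D u v)

  split? : ∀ W S → Dec (Split W S)
  split? W S = map′
    (λ (a , b , c , d) → split a b c d)
    (λ s → let open Split s in (λ {x} → initial {x}) , inhabited , proper , noReturn)
    ((S ⊆? W) ×-dec nonempty? S ×-dec any? (λ v → (v ∈? W) ×-dec ¬? (v ∈? S)) ×-dec
      all? λ u → all? λ v → (u ∈? W) →-dec ¬? (u ∈? S) →-dec (v ∈? S) →-dec ¬? (T? (arc D u v)))

  split⇒¬strong : ∀ {W S} → Split W S → ¬ Strong D W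
  split⇒¬strong {W} {S} (split initial (x , x∈S) (y , y∈W , y∉S) noReturn) strong =
    stay y∉S (strong y x y∈W (initial x∈S)) x∈S
    where
    stay : ∀ {u v} → u ∉ S → Star (InducedArc D W) u v → v ∉ S
    stay u∉S ε = u∉S
    stay u∉S ((u∈W , v∈W , a) ◅ path) = stay (λ v∈S → noReturn _ _ u∈W u∉S v∈S a) path

  -- Grow the set R reachable from u. If it stops short of W, no arc leads from R to the rest of W,
  -- so this rest is the initial piece of a split.
  unsplit⇒strong : ∀ {W} → ¬ (∃[ S ] Split W S) → Strong D W
  unsplit⇒strong {W} unsplit u v u∈W v∈W =
    let R , reached , W⊆R = grow ∣ W ∣ ⁅ u ⁆ (x∈⁅x⁆ u)
          (λ x∈u → subst (_∈ W) (sym (x∈⁅y⁆⇒x≡y u x∈u)) u∈W)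
          (λ x∈u → subst (Star (InducedArc D W) u) (sym (x∈⁅y⁆⇒x≡y u x∈u)) ε) (m≤m+n _ _)
    in reached (W⊆R v∈W)
    where
    Reached : Subset n → Set
    Reached R = ∀ {x} → x ∈ R → Star (InducedArc D W) u x
    grow : ∀ m R → u ∈ R → R ⊆ W → Reached R → ∣ W ∣ ≤ m + ∣ R ∣ → ∃[ R′ ] Reached R′ × W ⊆ R′
    grow zero    R u∈R R⊆W reached W≤ = R , reached , ⊆-card⇒⊇ R⊆W W≤
    grow (suc m) R u∈R R⊆W reached W≤ with
      any? (λ x → any? λ y → (x ∈? R) ×-dec (y ∈? W) ×-dec ¬? (y ∈? R) ×-dec T? (arc D x y))
    ... | yes (x , y , x∈R , y∈W , y∉R , a) = grow m (R ∪ ⁅ y ⁆) (p⊆p∪q _ u∈R) R′⊆W reached′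
      (≤-trans W≤ (≤-trans (≤-reflexive (sym (+-suc m ∣ R ∣)))
        (+-monoʳ-≤ m (p⊂q⇒∣p∣<∣q∣ (p⊆p∪q _ , y , q⊆p∪q R _ (x∈⁅x⁆ y) , y∉R)))))
      where
      R′⊆W : R ∪ ⁅ y ⁆ ⊆ W
      R′⊆W z∈ with x∈p∪q⁻ R ⁅ y ⁆ z∈
      ... | inj₁ z∈R = R⊆W z∈R
      ... | inj₂ z∈y = subst (_∈ W) (sym (x∈⁅y⁆⇒x≡y y z∈y)) y∈W
      reached′ : Reached (R ∪ ⁅ y ⁆)
      reached′ z∈ with x∈p∪q⁻ R ⁅ y ⁆ z∈
      ... | inj₁ z∈R = reached z∈R
      ... | inj₂ z∈y = subst (Star _ u) (sym (x∈⁅y⁆⇒x≡y y z∈y)) (reached x∈R ◅◅ ((R⊆W x∈R , y∈W , a) ◅ ε))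
    ... | no stuck with any? (λ y → (y ∈? W) ×-dec ¬? (y ∈? R))
    ...   | no full = R , reached , λ {y} y∈W → ∈R y y∈W
      where
      ∈R : ∀ y → y ∈ W → y ∈ R
      ∈R y y∈W with y ∈? R
      ... | yes y∈R = y∈R
      ... | no  y∉R = ⊥-elim (full (y , y∈W , y∉R))
    ...   | yes (y , y∈W , y∉R) = ⊥-elim (unsplit (W ∩ ∁ R , split (p∩q⊆p W _)
        (y , x∈p∩q⁺ (y∈W , x∉p⇒x∈∁p y∉R))
        (u , u∈W , λ u∈ → x∈∁p⇒x∉p (p∩q⊆q W _ u∈) u∈R)
        λ a b a∈W a∉ b∈ arc → let b∈W , b∈∁R = x∈p∩q⁻ W _ b∈ in
          stuck (a , b , x∉∁p⇒x∈p (λ a∈∁R → a∉ (x∈p∩q⁺ (a∈W , a∈∁R))) , b∈W , x∈∁p⇒x∉p b∈∁R , arc)))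

  strong? : ∀ W → Dec (Strong D W)
  strong? W with anySubset? (split? W)
  ... | yes (S , s) = no (split⇒¬strong s)
  ... | no unsplit = yes (unsplit⇒strong unsplit)

largest : ∀ {n} {Q : Subset n → Set} → (∀ C → Dec (Q C)) → ∃[ C ] Q C →
          ∃[ C ] Q C × (∀ C′ → Q C′ → ∣ C′ ∣ ≤ ∣ C ∣)
largest {n} {Q} Q? (C , q) = climb n C q (m≤m+n n _)
  where
  climb : ∀ m C → Q C → n ≤ m + ∣ C ∣ → ∃[ C ] Q C × (∀ C′ → Q C′ → ∣ C′ ∣ ≤ ∣ C ∣)
  climb m C q n≤ with anySubset? (λ C′ → Q? C′ ×-dec (∣ C ∣ <? ∣ C′ ∣))
  climb m C q n≤ | no none = C , q , λ C′ q′ → ≮⇒≥ λ C<C′ → none (C′ , q′ , C<C′)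
  climb zero    C q n≤ | yes (C′ , _ , C<C′) =
    contradiction (≤-trans C<C′ (≤-trans (∣p∣≤n C′) n≤)) (<-irrefl refl)
  climb (suc m) C q n≤ | yes (C′ , q′ , C<C′) = climb m C′ q′
    (≤-trans n≤ (≤-trans (≤-reflexive (sym (+-suc m ∣ C ∣))) (+-monoʳ-≤ m C<C′)))

module _ {n : ℕ} (D : Digraph n) (W : Subset n) where

  private
    -- A strong set of maximum size with property Q is a component: Q passes to supersets, so a
    -- strong superset would compete and cannot be larger.
    largest-component : ∀ {Q : Subset n → Set} → (∀ C → Dec (Q C)) →
      (∀ {C C′} → Q C → C ⊆ C′ → Q C′) → (∀ {C} → Q C → Nonempty C) →
      ∀ C → C ⊆ W → Strong D C → Q C →
      ∃[ C′ ] StrongComponent D W C′ × Q C′ × (∀ C″ → C″ ⊆ W → Strong D C″ → Q C″ → ∣ C″ ∣ ≤ ∣ C′ ∣)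
    largest-component Q? up inh C C⊆W strong q
      with C′ , (C′⊆W , strong′ , q′) , max ←
        largest (λ C → (C ⊆? W) ×-dec strong? D C ×-dec Q? C) (C , (λ {x} → C⊆W {x}) , strong , q) =
      C′ , record
        { nonempty = inh q′
        ; within   = C′⊆W
        ; strong   = strong′
        ; maximal  = λ C″ C′⊆C″ C″⊆W strong″ →
            ⊆-card⇒⊇ C′⊆C″ (max C″ ((λ {x} → C″⊆W {x}) , strong″ , up q′ C′⊆C″))
        } , q′ , λ C″ C″⊆W s q″ → max C″ ((λ {x} → C″⊆W {x}) , s , q″)

  -- The largest strong set through a vertex of C is a component and at least as large as C.
  mco-bounds-strong : ∀ {m} → IsMco D W m → ∀ C → C ⊆ W → Strong D C → ∣ C ∣ ≤ m
  mco-bounds-strong (_ , bound) C C⊆W strong with nonempty? C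
  ... | no empty = ≤-trans (≤-reflexive (trans (cong ∣_∣ (Empty-unique empty)) (∣⊥∣≡0 n))) z≤n
  ... | yes (x , x∈C) with C′ , comp , _ , max ←
    largest-component (x ∈?_) (λ x∈ ⊆ → ⊆ x∈) (λ x∈ → x , x∈) C C⊆W strong x∈C =
    ≤-trans (max C C⊆W strong x∈C) (bound C′ comp)

  -- A single vertex is strong, so there are nonempty strong sets, and a largest one is a component.
  mco-exists : ∀ {ℓ} → Nonempty W → (∀ C → C ⊆ W → Strong D C → ∣ C ∣ ≤ ℓ) → ∃[ m ] IsMco D W m × m ≤ ℓ
  mco-exists (x , x∈W) small with C , comp , _ , max ←
    largest-component nonempty? (λ (x , x∈) ⊆ → x , ⊆ x∈) (λ q → q) ⁅ x ⁆
      (λ y∈ → subst (_∈ W) (sym (x∈⁅y⁆⇒x≡y x y∈)) x∈W)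
      (λ u v u∈ v∈ → subst (Star _ u) (trans (x∈⁅y⁆⇒x≡y x u∈) (sym (x∈⁅y⁆⇒x≡y x v∈))) ε)
      (x , x∈⁅x⁆ x) =
    let open StrongComponent in
    ∣ C ∣ , ((C , comp , refl) , λ C′ comp′ → max C′ (within comp′) (strong comp′) (nonempty comp′)) ,
    small C (within comp) (strong comp)

-- Correctness of the search

T-∨⁻ : ∀ {a b} → T (a ∨ b) → T a ⊎ T b
T-∨⁻ = Equivalence.to T-∨

T-∨⁺ : ∀ {a b} → T a ⊎ T b → T (a ∨ b)
T-∨⁺ = Equivalence.from T-∨

any⁻ : ∀ {n} (p : Fin n → Bool) → T (any p) → ∃[ v ] T (p v)
any⁻ {suc n} p t with T-∨⁻ {p zero} t
... | inj₁ t₀ = zero , t₀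
... | inj₂ t′ with v , tv ← any⁻ (p ∘ suc) t′ = suc v , tv

any⁺ : ∀ {n} (p : Fin n → Bool) v → T (p v) → T (any p)
any⁺ p zero    t = T-∨⁺ (inj₁ t)
any⁺ p (suc v) t = T-∨⁺ {p zero} (inj₂ (any⁺ (p ∘ suc) v t))

isDeleted : Part → Bool
isDeleted deleted = true
isDeleted _       = false

isDeleted⁻ : ∀ p → T (isDeleted p) → p ≡ deleted
isDeleted⁻ deleted _ = refl

backward-from : ∀ e p q → T (backward e p q) → ¬ p ≡ deleted
backward-from true deleted first  () refl
backward-from true deleted middle () refl
backward-from true deleted last   () refl

backward-to : ∀ e p q → T (backward e p q) → ¬ q ≡ deleted
backward-to true p deleted () refl

split-index : ∀ {n i} (i<n : i < n) (v : Fin n) → i ≤ toℕ v → v ≡ fromℕ< i<n ⊎ suc i ≤ toℕ v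
split-index i<n v i≤v with m≤n⇒m<n∨m≡n i≤v
... | inj₁ i<v = inj₂ i<v
... | inj₂ i≡v = inj₁ (toℕ-injective (trans (sym i≡v) (sym (toℕ-fromℕ< i<n))))

prefixSum : ∀ {n} → (Fin n → ℕ) → ℕ → ℕ
prefixSum f zero = 0
prefixSum {zero}  f (suc i) = 0
prefixSum {suc n} f (suc i) = f zero + prefixSum (f ∘ suc) i

-- The definition peels off the first entry, whereas a search at index i + 1 handles the last one,
-- `fromℕ< i<n`.
prefixSum-suc : ∀ {n} (f : Fin n → ℕ) {i} (i<n : i < n) → prefixSum f (suc i) ≡ f (fromℕ< i<n) + prefixSum f i
prefixSum-suc {suc n} f {zero}  i<n       = refl
prefixSum-suc {suc n} f {suc i} (s≤s i<n) = begin
  f zero + prefixSum (f ∘ suc) (suc i)             ≡⟨ cong (f zero +_) (prefixSum-suc (f ∘ suc) i<n) ⟩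
  f zero + (f (suc u) + prefixSum (f ∘ suc) i)     ≡⟨ +-assoc (f zero) _ _ ⟨
  f zero + f (suc u) + prefixSum (f ∘ suc) i       ≡⟨ cong (_+ prefixSum (f ∘ suc) i) (+-comm (f zero) _) ⟩
  f (suc u) + f zero + prefixSum (f ∘ suc) i       ≡⟨ +-assoc (f (suc u)) _ _ ⟩
  f (suc u) + (f zero + prefixSum (f ∘ suc) i)     ∎
  where
  open ≡-Reasoning
  u = fromℕ< i<n

module CoverCorrect {n : ℕ} (E : Fin n → Fin n → Bool) where

  open Search E

  Back : Parting → Fin n → Fin n → Set
  Back L u v = T (backward (E u v) (L u) (L v))

  Forward : Parting → Set
  Forward L = ∀ u v → ¬ Back L u v

  _⊑_ : Parting → Parting → Set
  L′ ⊑ L = ∀ v → L′ v ≡ L v ⊎ L′ v ≡ deleted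

  ⊑-trans : ∀ {L₁ L₂ L₃} → L₁ ⊑ L₂ → L₂ ⊑ L₃ → L₁ ⊑ L₃
  ⊑-trans p q v with p v
  ... | inj₂ d  = inj₂ d
  ... | inj₁ eq with q v
  ...   | inj₁ eq′ = inj₁ (trans eq eq′)
  ...   | inj₂ d   = inj₂ (trans eq d)

  clash⁻ : ∀ u L → T (clash u L) → ∃[ v ] Back L u v
  clash⁻ u L = any⁻ λ v → backward (E u v) (L u) (L v)

  clash⁺ : ∀ u L v → Back L u v → T (clash u L)
  clash⁺ u L = any⁺ λ v → backward (E u v) (L u) (L v)

  from-alive : ∀ L u v → Back L u v → ¬ L u ≡ deleted
  from-alive L u v = backward-from (E u v) (L u) (L v)

  to-alive : ∀ L u v → Back L u v → ¬ L v ≡ deleted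
  to-alive L u v = backward-to (E u v) (L u) (L v)

  back-⊑ : ∀ L′ L → L′ ⊑ L → ∀ u v → Back L′ u v → Back L u v
  back-⊑ L′ L sub u v t with sub u | sub v
  ... | inj₂ d  | _       = ⊥-elim (from-alive L′ u v t d)
  ... | inj₁ _  | inj₂ d  = ⊥-elim (to-alive L′ u v t d)
  ... | inj₁ eq | inj₁ eq′ = subst₂ (λ p q → T (backward (E u v) p q)) eq eq′ t

  assign-at : ∀ {A : Set} (f : Fin n → A) u x → assign f u x u ≡ x
  assign-at f u x = updateAt-updates u f

  assign-else : ∀ {A : Set} (f : Fin n → A) u x {v} → v ≢ u → assign f u x v ≡ f v
  assign-else f u x {v} v≢u = updateAt-minimal v u f v≢u

  delete-⊑ : ∀ L u → assign L u deleted ⊑ L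
  delete-⊑ L u v with v ≟ᶠ u
  ... | yes refl = inj₂ (assign-at L v deleted)
  ... | no  v≢u  = inj₁ (assign-else L u deleted v≢u)

  kill-⊑ : ∀ u L → kill u L ⊑ L
  kill-⊑ u L v with backward (E u v) (L u) (L v)
  ... | false = inj₁ refl
  ... | true  = inj₂ refl

  kill-hit : ∀ u L v → Back L u v → kill u L v ≡ deleted
  kill-hit u L v t with backward (E u v) (L u) (L v)
  ... | true = refl

  kill-deleted : ∀ u L v → kill u L v ≡ deleted → L v ≡ deleted ⊎ Back L u v
  kill-deleted u L v eq with backward (E u v) (L u) (L v)
  ... | false = inj₁ eq
  ... | true  = inj₂ tt

  module _ (M K : ℕ) where

    ForwardFrom : ℕ → Parting → Set
    ForwardFrom i L = ∀ u → i ≤ toℕ u → ∀ v → ¬ Back L u v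

    private
      extend : ∀ {i} (i<n : i < n) L′ L → L′ ⊑ L → ForwardFrom (suc i) L →
               (∀ v → ¬ Back L′ (fromℕ< i<n) v) → ForwardFrom i L′
      extend i<n L′ L sub fw first-ok u i≤u v with split-index i<n u i≤u
      ... | inj₁ refl = first-ok v
      ... | inj₂ i<u  = λ t → fw u i<u v (back-⊑ L′ L sub u v t)

    -- Deletions create no backward arcs, so a scanned vertex stays settled. The last conjunct is
    -- for the exhaustive search: without a budget, the parting tested is itself free of backward
    -- arcs.
    cover-sound : ∀ i i≤n f L → ForwardFrom i L → T (cover M K i i≤n f L) →
      ∃[ L′ ] L′ ⊑ L × Forward L′ × T (balanced M K L′) × (f ≡ 0 → L′ ≡ L)
    cover-sound zero i≤n f L fw t = L , (λ v → inj₁ refl) , (λ u → fw u z≤n) , t , λ _ → refl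
    cover-sound (suc i) i<n zero L fw t with clash (fromℕ< i<n) L in eq
    ... | false = cover-sound i _ zero L
      (extend i<n L L (λ v → inj₁ refl) fw λ v t′ → subst T eq (clash⁺ (fromℕ< i<n) L v t′)) t
    cover-sound (suc i) i<n (suc f) L fw t with clash (fromℕ< i<n) L in eq
    ... | false = cover-sound i _ (suc f) L
      (extend i<n L L (λ v → inj₁ refl) fw λ v t′ → subst T eq (clash⁺ (fromℕ< i<n) L v t′)) t
    ... | true with T-∨⁻ {cover M K i _ f (assign L (fromℕ< i<n) deleted)} t
    ...   | inj₁ t₁ =
      let u = fromℕ< i<n
          L′ , sub , fw′ , bal , _ = cover-sound i _ f (assign L u deleted)
            (extend i<n (assign L u deleted) L (delete-⊑ L u) fw λ v t′ →
              from-alive (assign L u deleted) u v t′ (assign-at L u deleted)) t₁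
      in L′ , ⊑-trans sub (delete-⊑ L u) , fw′ , bal , λ ()
    ...   | inj₂ t₂ =
      let u = fromℕ< i<n
          L′ , sub , fw′ , bal , _ = cover-sound i _ f (kill u L)
            (extend i<n (kill u L) L (kill-⊑ u L) fw λ v t′ →
              to-alive (kill u L) u v t′ (kill-hit u L v (back-⊑ (kill u L) L (kill-⊑ u L) u v t′))) t₂
      in L′ , ⊑-trans sub (kill-⊑ u L) , fw′ , bal , λ ()

    module _ (X : Fin n → Bool) where

      DeletedWithin : Parting → Set
      DeletedWithin L = ∀ v → L v ≡ deleted → T (X v)

      less-fuel : ∀ {f L L′} → L′ ⊑ L → ∀ w → ¬ L w ≡ deleted → L′ w ≡ deleted →
        count X ≤ suc f + count (isDeleted ∘ L) → count X ≤ f + count (isDeleted ∘ L′)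
      less-fuel {f} {L} {L′} sub w alive dead fuel =
        ≤-trans fuel (≤-trans (≤-reflexive (sym (+-suc f _)))
          (+-monoʳ-≤ f (count-mono-< (isDeleted ∘ L) (isDeleted ∘ L′)
            (λ z t → [ (λ e → subst (T ∘ isDeleted) (sym e) t) ,
                       (λ e → subst (T ∘ isDeleted) (sym e) tt) ] (sub z))
            w (subst (T ∘ isDeleted) (sym dead) tt) (alive ∘ isDeleted⁻ _))))

      delete-within : ∀ {L u} → DeletedWithin L → T (X u) → DeletedWithin (assign L u deleted)
      delete-within {L} {u} del u∈X w d with w ≟ᶠ u
      ... | yes refl = u∈X
      ... | no  w≢u  = del w (trans (sym (assign-else L u deleted w≢u)) d)

      -- X meets every backward arc. If arcs lead back from u, the right branch is to delete u when
      -- u lies in X, and otherwise all heads, which then lie in X. Either way a surviving vertex of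
      -- X is deleted, so the budget keeps up with the part of X that is left.
      cover-complete : ∀ i i≤n f L →
        (∀ u v → ¬ T (X u) → ¬ T (X v) → ¬ Back L u v) →
        DeletedWithin L →
        count X ≤ f + count (isDeleted ∘ L) →
        (∀ L′ → L′ ⊑ L → DeletedWithin L′ → T (balanced M K L′)) →
        T (cover M K i i≤n f L)
      cover-complete zero i≤n f L fw del fuel bal = bal L (λ v → inj₁ refl) del
      cover-complete (suc i) i<n zero L fw del fuel bal with clash (fromℕ< i<n) L in eq
      ... | false = cover-complete i _ zero L fw del fuel bal
      -- The budget is spent, so all of X is deleted already, and a backward arc between surviving
      -- vertices would avoid X.
      ... | true with v , back ← clash⁻ (fromℕ< i<n) L (subst T (sym eq) tt) | T? (X (fromℕ< i<n))
      ...   | yes u∈X = <⇒≱ (count-mono-< (isDeleted ∘ L) X (λ w t → del w (isDeleted⁻ (L w) t))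
                (fromℕ< i<n) u∈X (λ d → from-alive L _ v back (isDeleted⁻ (L _) d))) fuel
      ...   | no u∉X with T? (X v)
      ...     | yes v∈X = <⇒≱ (count-mono-< (isDeleted ∘ L) X (λ w t → del w (isDeleted⁻ (L w) t)) v v∈X
                (λ d → to-alive L _ v back (isDeleted⁻ (L _) d))) fuel
      ...     | no v∉X = fw (fromℕ< i<n) v u∉X v∉X back
      cover-complete (suc i) i<n (suc f) L fw del fuel bal with clash (fromℕ< i<n) L in eq
      ... | false = cover-complete i _ (suc f) L fw del fuel bal
      ... | true with v , back ← clash⁻ (fromℕ< i<n) L (subst T (sym eq) tt) | T? (X (fromℕ< i<n))
      ...   | yes u∈X = T-∨⁺ (inj₁ (cover-complete i _ f (assign L (fromℕ< i<n) deleted)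
                (λ a b a∉ b∉ t → fw a b a∉ b∉ (back-⊑ (assign L (fromℕ< i<n) deleted) L (delete-⊑ L _) a b t))
                (delete-within del u∈X)
                (less-fuel (delete-⊑ L _) (fromℕ< i<n) (from-alive L _ v back) (assign-at L _ deleted) fuel)
                (λ L″ sub′ → bal L″ (⊑-trans sub′ (delete-⊑ L _)))))
      ...   | no u∉X = T-∨⁺ {cover M K i _ f (assign L (fromℕ< i<n) deleted)}
              (inj₂ (cover-complete i _ f (kill (fromℕ< i<n) L)
                (λ a b a∉ b∉ t → fw a b a∉ b∉ (back-⊑ (kill (fromℕ< i<n) L) L (kill-⊑ _ L) a b t))
                (λ w d → [ del w , (λ t → hit w t) ] (kill-deleted _ L w d))
                (less-fuel (kill-⊑ (fromℕ< i<n) L) v (to-alive L _ v back) (kill-hit _ L v back) fuel)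
                (λ L″ sub′ → bal L″ (⊑-trans sub′ (kill-⊑ _ L)))))
        where
        hit : ∀ w → Back L (fromℕ< i<n) w → T (X w)
        hit w t with T? (X w)
        ... | yes w∈X = w∈X
        ... | no  w∉X = ⊥-elim (fw (fromℕ< i<n) w u∉X w∉X t)

Chosen : List Part → Part → Set
Chosen o p = (p ∈ₗ o) ⊎ (o ≡ [] × p ≡ deleted)

-- The budget that a vertex may use up: `pick` pays one unit whenever at least two options are left,
-- and nothing for the last one.
surplus : List Part → ℕ
surplus o = length o ∸ 1

module ChooseCorrect {n : ℕ} (E : Fin n → Fin n → Bool) where

  open Search E
  open CoverCorrect E

  -- The searches run through the vertices downwards, with the default x below the index i.
  record Filled {A : Set} (P : Fin n → A → Set) (x : A) (i : ℕ) (f : Fin n → A) : Set where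
    field
      done : ∀ v → i ≤ toℕ v → P v (f v)
      todo : ∀ v → toℕ v < i → f v ≡ x
  open Filled

  fill : ∀ {A : Set} {P : Fin n → A → Set} {x i f} (i<n : i < n) {y} → P (fromℕ< i<n) y →
         Filled P x (suc i) f → Filled P x i (assign f (fromℕ< i<n) y)
  fill {P = P} {f = f} i<n {y} py F .done v i≤v with split-index i<n v i≤v
  ... | inj₁ refl = subst (P v) (sym (assign-at f v y)) py
  ... | inj₂ i<v  = subst (P v) (sym (assign-else f (fromℕ< i<n) y v≢u)) (done F v i<v)
    where
    v≢u : v ≢ fromℕ< i<n
    v≢u refl = <-irrefl refl (subst (suc _ ≤_) (toℕ-fromℕ< i<n) i<v)
  fill {f = f} i<n {y} py F .todo v v<i = trans
    (assign-else f (fromℕ< i<n) y λ v≡u → <-irrefl (trans (cong toℕ v≡u) (toℕ-fromℕ< i<n)) v<i)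
    (todo F v (m≤n⇒m≤1+n v<i))

  skip : ∀ {A : Set} {P : Fin n → A → Set} {x i f} (i<n : i < n) → P (fromℕ< i<n) x →
         Filled P x (suc i) f → Filled P x i f
  skip {P = P} i<n px F .done v i≤v with split-index i<n v i≤v
  ... | inj₁ refl = subst (P v) (sym (todo F v (s≤s (≤-reflexive (toℕ-fromℕ< i<n))))) px
  ... | inj₂ i<v  = done F v i<v
  skip i<n px F .todo v v<i = todo F v (m≤n⇒m≤1+n v<i)

  unfilled : ∀ {A : Set} {P : Fin n → A → Set} {x : A} → Filled P x n (const x)
  unfilled .done v n≤v = ⊥-elim (<⇒≱ (toℕ<n v) n≤v)
  unfilled .todo v _ = refl

  module _ (M K f : ℕ) (O : Fin n → List Part) where

    private
      Ok : ℕ → Parting → Set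
      Ok = Filled (λ v → Chosen (O v)) deleted

    Result : Set
    Result = ∃[ L ] (∀ v → Chosen (O v) (L v)) × T (cover M K n ≤-refl f L)

    choose-sound : ∀ i i≤n g L → Ok i L → T (choose M K f O i i≤n g L) → Result
    -- The recursion shortens o but never empties it, so o = [] means that the vertex had no options
    -- from the start.
    pick-sound   : ∀ o i i<n g L → Ok (suc i) L → (∀ {p} → p ∈ₗ o → p ∈ₗ O (fromℕ< i<n)) →
                   (o ≡ [] → O (fromℕ< i<n) ≡ []) → T (pick M K f O o i i<n g L) → Result
    choose-sound zero    i≤n g L ok t = L , (λ v → done ok v z≤n) , t
    choose-sound (suc i) i<n g L ok t = pick-sound _ i i<n g L ok (λ p∈ → p∈) (λ e → e) t
    pick-sound []           i i<n g       L ok sub e t =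
      choose-sound i _ g L (skip i<n (inj₂ (e refl , refl)) ok) t
    pick-sound (x ∷ [])     i i<n g       L ok sub e t =
      choose-sound i _ g _ (fill i<n (inj₁ (sub (here refl))) ok) t
    pick-sound (x ∷ y ∷ ys) i i<n (suc g) L ok sub e t
      with T-∨⁻ {choose M K f O i _ g (assign L (fromℕ< i<n) x)} t
    ... | inj₁ t₁ = choose-sound i _ g _ (fill i<n (inj₁ (sub (here refl))) ok) t₁
    ... | inj₂ t₂ = pick-sound (y ∷ ys) i i<n g L ok (λ p∈ → sub (there p∈)) (λ ()) t₂

    -- The search reaches a parting that agrees with `L*` pointwise, hence the form of `covered`.
    module _ (L* : Parting) (allowed : ∀ v → Chosen (O v) (L* v))
             (covered : ∀ L → (∀ v → L v ≡ L* v) → T (cover M K n ≤-refl f L)) where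

      private
        Agrees : ℕ → Parting → Set
        Agrees = Filled (λ v p → p ≡ L* v) deleted
        need : ℕ → ℕ
        need = prefixSum (surplus ∘ O)

      -- The invariant `need i ≤ g` reserves the surplus of every vertex still to be placed. Passing
      -- over an option uses one unit of that vertex's share; an early choice leaves the rest
      -- unspent.
      choose-complete : ∀ i i≤n g L → Agrees i L → need i ≤ g → T (choose M K f O i i≤n g L)
      pick-complete   : ∀ o i i<n g L → Agrees (suc i) L → Chosen o (L* (fromℕ< i<n)) →
                        surplus o + need i ≤ g → T (pick M K f O o i i<n g L)
      choose-complete zero    i≤n g L ag fuel = covered L λ v → done ag v z≤n
      choose-complete (suc i) i<n g L ag fuel = pick-complete _ i i<n g L ag (allowed _)
        (≤-trans (≤-reflexive (sym (prefixSum-suc (surplus ∘ O) i<n))) fuel)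
      pick-complete []           i i<n g       L ag (inj₂ (_ , d)) fuel =
        choose-complete i _ g L (skip i<n (sym d) ag) fuel
      pick-complete (x ∷ [])     i i<n g       L ag (inj₁ (here e)) fuel =
        choose-complete i _ g _ (fill i<n (sym e) ag) fuel
      pick-complete (x ∷ y ∷ ys) i i<n (suc g) L ag (inj₁ (here e)) (s≤s fuel) =
        T-∨⁺ (inj₁ (choose-complete i _ g _ (fill i<n (sym e) ag) (≤-trans (m≤n+m _ (length ys)) fuel)))
      pick-complete (x ∷ y ∷ ys) i i<n (suc g) L ag (inj₁ (there p∈)) (s≤s fuel) =
        T-∨⁺ {choose M K f O i _ g (assign L (fromℕ< i<n) x)}
          (inj₂ (pick-complete (y ∷ ys) i i<n g L ag (inj₁ p∈) fuel))

  cell : Bool → List Part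
  cell w = if w then first ∷ middle ∷ [] else []

  module _ (ℓ : ℕ) where

    separates : (Fin n → List Part) → Bool
    separates O = (count (isNonempty ∘ O) <ᵇ suc ℓ) ∨ choose n (suc n) 0 O n ≤-refl n undecided

    module _ (X : Fin n → Bool) where

      module _ (W : Fin n → Bool) (disjoint : ∀ v → T (W v) → ¬ T (X v)) where

        allSets-sound : ∀ i i≤n O → Filled (λ v o → o ≡ cell (W v)) [] i O → T (allSets ℓ X i i≤n O) →
                        ∃[ O ] (∀ v → O v ≡ cell (W v)) × T (separates O)
        allSets-sound zero    i≤n O F t = O , (λ v → done F v z≤n) , t
        allSets-sound (suc i) i<n O F t with X (fromℕ< i<n) in x | W (fromℕ< i<n) in w
        ... | true | true  = ⊥-elim (disjoint _ (subst T (sym w) tt) (subst T (sym x) tt))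
        ... | true | false = allSets-sound i _ O (skip i<n (cong cell (sym w)) F) t
        ... | false | false = allSets-sound i _ O (skip i<n (cong cell (sym w)) F) (proj₁ (T-∧⁻ t))
        ... | false | true  = allSets-sound i _ _ (fill i<n (cong cell (sym w)) F)
                                    (proj₂ (T-∧⁻ {allSets ℓ X i (<⇒≤ i<n) O} t))

      private
        OutsideX : Fin n → List Part → Set
        OutsideX v o = ∃[ w ] o ≡ cell w × (T w → ¬ T (X v))

      allSets-complete : (∀ O → (∀ v → OutsideX v (O v)) → T (separates O)) →
                         ∀ i i≤n O → Filled OutsideX [] i O → T (allSets ℓ X i i≤n O)
      allSets-complete sep zero    i≤n O F = sep O λ v → done F v z≤n
      allSets-complete sep (suc i) i<n O F with X (fromℕ< i<n) in eq
      ... | true  = allSets-complete sep i _ O (skip i<n (false , refl , λ ()) F)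
      ... | false = T-∧⁺ (allSets-complete sep i _ O (skip i<n (false , refl , λ ()) F))
        (allSets-complete sep i _ _ (fill i<n (true , refl , λ _ x → subst T eq x) F))

    someSet-sound : ∀ k i i≤n X → T (someSet ℓ k i i≤n X) →
                    ∃[ X ] count X ≤ k × T (allSets ℓ X n ≤-refl (const []))
    someSet-sound k zero    i≤n X t with small , all ← T-∧⁻ {count X <ᵇ suc k} t =
      X , ≤-pred (<ᵇ⇒< _ _ small) , all
    someSet-sound k (suc i) i<n X t with T-∨⁻ {someSet ℓ k i _ X} t
    ... | inj₁ t₁ = someSet-sound k i _ X t₁
    ... | inj₂ t₂ = someSet-sound k i _ _ t₂

    module _ (k : ℕ) (X* : Fin n → Bool)
             (solves : ∀ X → (∀ v → X v ≡ X* v) → T ((count X <ᵇ suc k) ∧ allSets ℓ X n ≤-refl (const []))) where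

      someSet-complete : ∀ i i≤n X → Filled (λ v x → x ≡ X* v) false i X → T (someSet ℓ k i i≤n X)
      someSet-complete zero    i≤n X F = solves X λ v → done F v z≤n
      someSet-complete (suc i) i<n X F with X* (fromℕ< i<n) in eq
      ... | false = T-∨⁺ (inj₁ (someSet-complete i _ X (skip i<n (sym eq) F)))
      ... | true  = T-∨⁺ {someSet ℓ k i _ X} (inj₂ (someSet-complete i _ _ (fill i<n (sym eq) F)))

-- Deletion sets

∈⇒T : ∀ {n} {S : Subset n} {v} → v ∈ S → T (lookup S v)
∈⇒T v∈ = Equivalence.from T-≡ ([]=⇒lookup v∈)

T⇒∈ : ∀ {n} {S : Subset n} {v} → T (lookup S v) → v ∈ S
T⇒∈ t = lookup⇒[]= _ _ (Equivalence.to T-≡ t)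

setOf : ∀ {n} → (Fin n → Bool) → Subset n
setOf = Data.Vec.tabulate

∈setOf⁻ : ∀ {n} (p : Fin n → Bool) {v} → v ∈ setOf p → T (p v)
∈setOf⁻ p {v} v∈ = subst T (lookup∘tabulate p v) (∈⇒T v∈)

∈setOf⁺ : ∀ {n} (p : Fin n → Bool) {v} → T (p v) → v ∈ setOf p
∈setOf⁺ p {v} t = T⇒∈ (subst T (sym (lookup∘tabulate p v)) t)

∣setOf∣ : ∀ {n} (p : Fin n → Bool) → ∣ setOf p ∣ ≡ count p
∣setOf∣ p = trans (∣∣≡count (setOf p)) (sum-cong-≗ λ v → cong indicator (lookup∘tabulate p v))

count-full : ∀ {n} (p : Fin n → Bool) v → ¬ T (p v) → count p < n
count-full {n} p v v∉ = ≤-trans (count-mono-< p (const true) (λ _ _ → tt) v tt v∉) (≤-reflexive (count-all n))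

count-witness : ∀ {n} (p : Fin n → Bool) → count p < n → ∃[ v ] ¬ T (p v)
count-witness {suc n} p lt with p zero in eq
... | false = zero , λ t → subst T eq t
... | true with v , v∉ ← count-witness (p ∘ suc) (≤-pred lt) = suc v , v∉

module _ {n : ℕ} (D : Digraph n) (ℓ : ℕ) where

  -- Ranging over all strong sets instead of components avoids maximality and makes the notion
  -- monotone in X. Nothing changes, since a largest strong set is a component.
  Breaks : (Fin n → Bool) → Set
  Breaks X = ∀ C → Strong D C → (∀ v → v ∈ C → ¬ T (X v)) → ∣ C ∣ ≤ ℓ

  Solution : ℕ → Set
  Solution k = ∃[ X ] count X ≡ k × Breaks X

  Breaks-mono : ∀ {X Y} → (∀ v → T (X v) → T (Y v)) → Breaks X → Breaks Y
  Breaks-mono X⊆Y br C strong C∩Y = br C strong λ v v∈C v∈X → C∩Y v v∈C (X⊆Y v v∈X)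

DCOC⇔Solution : ∀ I → DCOC I ⇔ Solution (D I) (ℓ I) (k I)
DCOC⇔Solution I = mk⇔
  (λ (X , size , m , mco , m≤ℓ) → lookup X , trans (sym (∣∣≡count X)) size , λ C strong C∩X →
    ≤-trans (mco-bounds-strong (D I) (∁ X) mco C (λ v∈C → x∉p⇒x∈∁p (C∩X _ v∈C ∘ ∈⇒T)) strong) m≤ℓ)
  (λ (X , size , br) → setOf X , trans (∣setOf∣ X) size ,
    mco-exists (D I) (∁ (setOf X))
      -- By k < n some vertex survives, so that the remaining digraph has a component at all.
      (let v , v∉X = count-witness X (≤-trans (s≤s (≤-trans (≤-reflexive size) (m≤m+n _ _))) (k+ℓ<n I))
       in v , x∉p⇒x∈∁p (v∉X ∘ ∈setOf⁻ X))
      λ C C⊆ strong → br C strong λ v v∈C v∈X → x∈∁p⇒x∉p (C⊆ v∈C) (∈setOf⁺ X v∈X))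

-- Exhaustive search

deletedOr⁻ : ∀ j p → T (deletedOr j p) → p ≡ deleted ⊎ p ≡ j
deletedOr⁻ j      deleted _ = inj₁ refl
deletedOr⁻ first  first   _ = inj₂ refl
deletedOr⁻ middle middle  _ = inj₂ refl
deletedOr⁻ last   last    _ = inj₂ refl

deletedOr-deleted⁻ : ∀ p → T (deletedOr deleted p) → p ≡ deleted
deletedOr-deleted⁻ deleted _ = refl

deletedOr-self : ∀ j → T (deletedOr j j)
deletedOr-self deleted = tt
deletedOr-self first   = tt
deletedOr-self middle  = tt
deletedOr-self last    = tt

module _ {n : ℕ} (E : Fin n → Fin n → Bool) where
  open Search E

  balanced⁻ : ∀ M K L → T (balanced M K L) →
    count (deletedOr deleted ∘ L) < K × (∀ j → j ≢ deleted → count (deletedOr j ∘ L) < M)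
  balanced⁻ M K L t
    with a , t′ ← T-∧⁻ {count (deletedOr deleted ∘ L) <ᵇ K} t
    with b , t″ ← T-∧⁻ {count (deletedOr first ∘ L) <ᵇ M} t′
    with c , d  ← T-∧⁻ {count (deletedOr middle ∘ L) <ᵇ M} t″ =
    <ᵇ⇒< _ _ a , λ where
      deleted j≢ → ⊥-elim (j≢ refl)
      first   _  → <ᵇ⇒< _ _ b
      middle  _  → <ᵇ⇒< _ _ c
      last    _  → <ᵇ⇒< _ _ d

  balanced⁺ : ∀ M K L → count (deletedOr deleted ∘ L) < K →
    (∀ j → j ≢ deleted → count (deletedOr j ∘ L) < M) → T (balanced M K L)
  balanced⁺ M K L a b = T-∧⁺ (<⇒<ᵇ a) (T-∧⁺ (<⇒<ᵇ (b first λ ()))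
    (T-∧⁺ (<⇒<ᵇ (b middle λ ())) (<⇒<ᵇ (b last λ ()))))

Back⁻ : ∀ {e} p q → T (backward e p q) → T e × 0 < rank q × rank q < rank p
Back⁻ {e} p q t =
  let te , t′ = T-∧⁻ {e} t ; a , b = T-∧⁻ {0 <ᵇ rank q} t′
  in te , <ᵇ⇒< 0 (rank q) a , <ᵇ⇒< _ _ b

Back⁺ : ∀ {e} p q → T e → 0 < rank q → rank q < rank p → T (backward e p q)
Back⁺ {e} p q te a b = T-∧⁺ te (T-∧⁺ (<⇒<ᵇ {0} {rank q} a) (<⇒<ᵇ b))

first<middle : rank first < rank middle
first<middle = s≤s (s≤s z≤n)

first<last : rank first < rank last
first<last = s≤s (s≤s z≤n)

middle<last : rank middle < rank last
middle<last = s≤s (s≤s (s≤s z≤n))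

rank-positive : ∀ p → p ≢ deleted → 0 < rank p
rank-positive deleted p≢ = ⊥-elim (p≢ refl)
rank-positive first   _  = s≤s z≤n
rank-positive middle  _  = s≤s z≤n
rank-positive last    _  = s≤s z≤n

module _ {n : ℕ} (E : Fin n → Fin n → Bool) {L : Fin n → Part}
         (fw : CoverCorrect.Forward E L) where

  forward-arc : ∀ u v {p q} → L u ≡ p → L v ≡ q → 0 < rank q → rank q < rank p → ¬ T (E u v)
  forward-arc u v refl refl 0<q q<p e = fw u v (Back⁺ (L u) (L v) e 0<q q<p)

module Exhaustive {n : ℕ} (D : Digraph n) (ℓ k : ℕ) where
  open Search (arc D)
  open CoverCorrect (arc D)
  open ChooseCorrect (arc D)

  cell-nonempty : ∀ w → isNonempty (cell w) ≡ w
  cell-nonempty false = refl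
  cell-nonempty true  = refl

  cell-chosen : ∀ w p → Chosen (cell w) p → (p ≡ deleted × ¬ T w) ⊎ ((p ≡ first ⊎ p ≡ middle) × T w)
  cell-chosen false p (inj₂ (_ , d))               = inj₁ (d , λ ())
  cell-chosen true  p (inj₁ (here e))              = inj₂ (inj₁ e , tt)
  cell-chosen true  p (inj₁ (there (here e)))      = inj₂ (inj₂ e , tt)

  -- For a strong set C avoiding X, consider the branch with W = C: a splitting found there would
  -- contradict strength, so the test |C| ≤ ℓ must have succeeded.
  exhaustive-sound : k ≤ n → T (someSet ℓ k n ≤-refl (const false)) → Solution D ℓ k
  exhaustive-sound k≤n t
    with X , X≤k , all ← someSet-sound ℓ k n ≤-refl (const false) t
    with Y , X⊆Y , _ , Y≡k ← count-between {p = X} {q = const true} (λ _ _ → tt) k X≤k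
           (≤-trans k≤n (≤-reflexive (sym (count-all n)))) =
    Y , Y≡k , Breaks-mono D ℓ X⊆Y breaks
    where
    breaks : Breaks D ℓ X
    breaks C strong C∩X
      with O , O≡ , sep ← allSets-sound ℓ X (lookup C) (λ v → C∩X v ∘ T⇒∈) n ≤-refl (const []) unfilled all
      with T-∨⁻ {count (isNonempty ∘ O) <ᵇ suc ℓ} sep
    ... | inj₁ small = ≤-trans (≤-reflexive (trans (∣∣≡count C)
            (sum-cong-≗ λ v → cong indicator (sym (trans (cong isNonempty (O≡ v)) (cell-nonempty (lookup C v)))))))
            (≤-pred (<ᵇ⇒< _ _ small))
    ... | inj₂ found
      with L , chosen , covered ← choose-sound n (suc n) 0 O n ≤-refl n undecided unfilled found
      with L′ , _ , fw , bal , same ← cover-sound n (suc n) n ≤-refl 0 L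
             (λ u n≤u → ⊥-elim (<⇒≱ (toℕ<n u) n≤u)) covered
      -- The budget was 0, so no vertex of C has been deleted, and `L` itself divides C into first
      -- and middle.
      with refl ← same refl = ⊥-elim (split⇒¬strong D {S = S} (split
        (λ {v} v∈S → [ (λ (d , _) → case-first v v∈S d) , (λ (_ , w) → T⇒∈ w) ] (parts v))
        (let v , v∉ = count-witness (deletedOr middle ∘ L) (not-full middle (λ ()))
         in v , ∈setOf⁺ isFirst (must-first v v∉))
        (let v , v∉ = count-witness (deletedOr first ∘ L) (not-full first (λ ()))
             v∈C , v≡middle = must-middle v v∉
         in v , T⇒∈ v∈C , λ v∈S → not-both v v≡middle (∈setOf⁻ isFirst v∈S))
        λ u v u∈C u∉S v∈S a → fw u v
          (back u v (∈⇒T u∈C) (u∉S ∘ ∈setOf⁺ isFirst) (∈setOf⁻ isFirst v∈S) a)) strong)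
      where
      isFirst : Fin n → Bool
      isFirst v = rank (L v) ≡ᵇ 1
      S = setOf isFirst
      not-full : ∀ j → j ≢ deleted → count (deletedOr j ∘ L) < n
      not-full = proj₂ (balanced⁻ (arc D) n (suc n) L bal)
      parts : ∀ v → (L v ≡ deleted × ¬ T (lookup C v)) ⊎ ((L v ≡ first ⊎ L v ≡ middle) × T (lookup C v))
      parts v = cell-chosen _ _ (subst (λ o → Chosen o (L v)) (O≡ v) (chosen v))
      case-first : ∀ v → v ∈ S → ∀ {A : Set} → L v ≡ deleted → A
      case-first v v∈S d = ⊥-elim (subst (λ p → T (rank p ≡ᵇ 1)) d (∈setOf⁻ isFirst v∈S))
      not-both : ∀ v → L v ≡ middle → ¬ T (isFirst v)
      not-both v m f = subst (λ p → T (rank p ≡ᵇ 1)) m f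
      must-first : ∀ v → ¬ T (deletedOr middle (L v)) → T (isFirst v)
      must-first v v∉ with parts v
      ... | inj₁ (d , _)      = ⊥-elim (v∉ (subst (T ∘ deletedOr middle) (sym d) tt))
      ... | inj₂ (inj₁ f , _) = subst (λ p → T (rank p ≡ᵇ 1)) (sym f) tt
      ... | inj₂ (inj₂ m , _) = ⊥-elim (v∉ (subst (T ∘ deletedOr middle) (sym m) tt))
      must-middle : ∀ v → ¬ T (deletedOr first (L v)) → T (lookup C v) × L v ≡ middle
      must-middle v v∉ with parts v
      ... | inj₁ (d , _)      = ⊥-elim (v∉ (subst (T ∘ deletedOr first) (sym d) tt))
      ... | inj₂ (inj₁ f , _) = ⊥-elim (v∉ (subst (T ∘ deletedOr first) (sym f) tt))
      ... | inj₂ (inj₂ m , w) = w , m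
      back : ∀ u v → T (lookup C u) → ¬ T (isFirst u) → T (isFirst v) → T (arc D u v) → Back L u v
      back u v u∈C u∉S v∈S a with parts u | parts v
      ... | inj₁ (_ , u∉C) | _ = ⊥-elim (u∉C u∈C)
      ... | inj₂ (inj₁ f , _) | _ = ⊥-elim (u∉S (subst (λ p → T (rank p ≡ᵇ 1)) (sym f) tt))
      ... | inj₂ (inj₂ m , _) | inj₁ (d , _) = ⊥-elim (subst (λ p → T (rank p ≡ᵇ 1)) d v∈S)
      ... | inj₂ (inj₂ m , _) | inj₂ (inj₂ m′ , _) = ⊥-elim (not-both v m′ v∈S)
      ... | inj₂ (inj₂ m , _) | inj₂ (inj₁ f , _) =
        subst₂ (λ p q → T (backward (arc D u v) p q)) (sym m) (sym f)
          (Back⁺ middle first a (s≤s z≤n) first<middle)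

prefixSum-≤ : ∀ {n} (f : Fin n → ℕ) → (∀ v → f v ≤ 1) → ∀ i → prefixSum f i ≤ i
prefixSum-≤ f f≤1 zero = z≤n
prefixSum-≤ {zero}  f f≤1 (suc i) = z≤n
prefixSum-≤ {suc n} f f≤1 (suc i) = +-mono-≤ (f≤1 zero) (prefixSum-≤ (f ∘ suc) (f≤1 ∘ suc) i)

module ExhaustiveComplete {n : ℕ} (D : Digraph n) (ℓ k : ℕ) where
  open Search (arc D)
  open CoverCorrect (arc D)
  open ChooseCorrect (arc D)
  open Exhaustive D ℓ k

  part-of : Bool → Bool → Part
  part-of w s = if w then (if s then first else middle) else deleted

  part-chosen : ∀ w s → Chosen (cell w) (part-of w s)
  part-chosen false s     = inj₂ (refl , refl)
  part-chosen true  true  = inj₁ (here refl)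
  part-chosen true  false = inj₁ (there (here refl))

  -- A set W of more than ℓ vertices avoiding X is not strong, because X breaks all large strong
  -- sets. Its split labels S as first and the rest as middle, without a backward arc, so that
  -- budget 0 suffices.
  separates-complete : ∀ {X O} → Breaks D ℓ X →
    (∀ v → ∃[ w ] O v ≡ cell w × (T w → ¬ T (X v))) → T (separates ℓ O)
  separates-complete {X} {O} br outside with count (isNonempty ∘ O) <ᵇ suc ℓ in small
  ... | true  = tt
  ... | false with anySubset? (split? D (setOf (isNonempty ∘ O)))
  ...   | no unsplit = ⊥-elim (subst T small (<⇒<ᵇ (s≤s (≤-trans (≤-reflexive (sym (∣setOf∣ (isNonempty ∘ O))))
          (br _ (unsplit⇒strong D unsplit) λ v v∈ v∈X →
            let w , O≡ , w∉X = outside v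
            in w∉X (subst T (trans (cong isNonempty O≡) (cell-nonempty w))
                 (∈setOf⁻ (isNonempty ∘ O) v∈)) v∈X)))))
  ...   | yes (S , split initial (x , x∈S) (y , y∈W , y∉S) noReturn) =
    choose-complete n (suc n) 0 O L
      (λ v → subst (λ o → Chosen o (L v)) (sym (O≡cell v)) (part-chosen (W v) (lookup S v)))
      (λ L′ L′≡L → cover-complete n (suc n) (not ∘ W) n ≤-refl 0 L′
        (λ u v u∈ v∈ → forward u v u∈ v∈ ∘ subst₂ (λ p q → T (backward (arc D u v) p q)) (L′≡L u) (L′≡L v))
        (λ v d → deleted-not-W v (trans (sym (L′≡L v)) d))
        (count-mono (not ∘ W) (isDeleted ∘ L′) λ v t →
          subst (T ∘ isDeleted) (sym (trans (L′≡L v) (not-W-deleted v t))) tt)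
        λ L″ sub del → balanced⁺ (arc D) n (suc n) L″ (s≤s (count≤n _)) (λ where
          deleted j≢ → ⊥-elim (j≢ refl)
          first   _  → full L′ L′≡L L″ sub del first  y y∈W (L-middle y y∈W y∉S) [ (λ ()) , (λ ()) ]
          middle  _  → full L′ L′≡L L″ sub del middle x (initial x∈S) (L-first x x∈S) [ (λ ()) , (λ ()) ]
          -- No vertex is labelled last, so this only asks for a vertex that is not deleted.
          last    _  → full L′ L′≡L L″ sub del last x (initial x∈S) (L-first x x∈S) [ (λ ()) , (λ ()) ]))
      n ≤-refl n undecided unfilled
      (prefixSum-≤ (surplus ∘ O) (λ v → subst (λ o → surplus o ≤ 1) (sym (O≡cell v)) (cell-surplus (W v))) n)
    where
    W : Fin n → Bool
    W = isNonempty ∘ O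
    L : Parting
    L v = part-of (W v) (lookup S v)
    cell-surplus : ∀ w → surplus (cell w) ≤ 1
    cell-surplus false = z≤n
    cell-surplus true  = s≤s z≤n
    O≡cell : ∀ v → O v ≡ cell (W v)
    O≡cell v = let w , O≡ , _ = outside v in trans O≡ (cong cell (sym (trans (cong isNonempty O≡) (cell-nonempty w))))
    deleted-not-W : ∀ v → L v ≡ deleted → T (not (W v))
    deleted-not-W v d with W v | lookup S v
    deleted-not-W v d  | false | _     = tt
    deleted-not-W v () | true  | false
    deleted-not-W v () | true  | true
    not-W-deleted : ∀ v → T (not (W v)) → L v ≡ deleted
    not-W-deleted v t with W v
    ... | false = refl
    L-first : ∀ v → v ∈ S → L v ≡ first
    L-first v v∈S = cong₂ part-of (Equivalence.to T-≡ (∈setOf⁻ W (initial v∈S))) (Equivalence.to T-≡ (∈⇒T v∈S))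
    L-middle : ∀ v → v ∈ setOf W → v ∉ S → L v ≡ middle
    L-middle v v∈W v∉S with lookup S v in eq
    ... | true  = ⊥-elim (v∉S (T⇒∈ (Equivalence.from T-≡ eq)))
    ... | false = cong (λ w → part-of w false) (Equivalence.to T-≡ (∈setOf⁻ W v∈W))
    forward : ∀ u v → ¬ T (not (W u)) → ¬ T (not (W v)) → ¬ Back L u v
    forward u v u∈ v∈ t with W u in wu | W v | lookup S u in su | lookup S v in sv
    ... | false | _ | _ | _ = u∈ tt
    ... | true | false | _ | _ = v∈ tt
    ... | true | true | true | true = proj₂ (T-∧⁻ {arc D u v} t)
    ... | true | true | true | false = proj₂ (T-∧⁻ {arc D u v} t)
    ... | true | true | false | false = proj₂ (T-∧⁻ {arc D u v} t)
    ... | true | true | false | true = noReturn u v (∈setOf⁺ W (Equivalence.from T-≡ wu))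
      (λ u∈S → subst T su (∈⇒T u∈S)) (T⇒∈ (Equivalence.from T-≡ sv)) (proj₁ (T-∧⁻ {arc D u v} t))
    full : ∀ L′ → (∀ v → L′ v ≡ L v) → ∀ L″ → L″ ⊑ L′ → (∀ v → L″ v ≡ deleted → T (not (W v))) →
           ∀ j v → v ∈ setOf W → ∀ {p} → L v ≡ p → ¬ (p ≡ deleted ⊎ p ≡ j) → count (deletedOr j ∘ L″) < n
    full L′ L′≡L L″ sub del j v v∈W refl p≢ = count-full (deletedOr j ∘ L″) v λ t →
      [ alive , (λ L″≡j → [ (λ e → p≢ (inj₂ (trans (sym (trans e (L′≡L v))) L″≡j))) , alive ] (sub v)) ]
        (deletedOr⁻ j (L″ v) t)
      where
      alive : ¬ L″ v ≡ deleted
      alive d with W v | ∈setOf⁻ W v∈W | del v d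
      ... | true | _ | ()

  exhaustive-complete : Solution D ℓ k → T (someSet ℓ k n ≤-refl (const false))
  exhaustive-complete (X , X≡k , br) = someSet-complete ℓ k X
    (λ Y Y≡X → T-∧⁺
      (<⇒<ᵇ (s≤s (≤-trans (≤-reflexive (sum-cong-≗ λ v → cong indicator (Y≡X v))) (≤-reflexive X≡k))))
      (allSets-complete ℓ Y
        (λ O → separates-complete (Breaks-mono D ℓ (λ v → subst T (sym (Y≡X v))) br))
        n ≤-refl (const []) unfilled))
    n ≤-refl (const false) unfilled

-- From partitions without backward arcs to solutions

inPart : Part → Part → Bool
inPart j p = rank p ≡ᵇ rank j

inPart⁻ : ∀ j p → T (inPart j p) → p ≡ j
inPart⁻ deleted deleted _ = refl
inPart⁻ first   first   _ = refl
inPart⁻ middle  middle  _ = refl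
inPart⁻ last    last    _ = refl

inPart-self : ∀ j → T (inPart j j)
inPart-self j = ≡⇒≡ᵇ (rank j) (rank j) refl

module _ {n : ℕ} (D : Digraph n) where
  open Search (arc D)
  open CoverCorrect (arc D)

  -- Along an arc between surviving vertices the rank cannot drop, so it is constant on a strong
  -- set.
  strong-in-one-part : ∀ {L C} → Forward L → Strong D C → (∀ v → v ∈ C → L v ≢ deleted) →
                       ∀ {u v} → u ∈ C → v ∈ C → L u ≡ L v
  strong-in-one-part {L} {C} fw strong alive {u} {v} u∈ v∈ =
    rank-injective (≤-antisym (ascend (strong u v u∈ v∈)) (ascend (strong v u v∈ u∈)))
    where
    rank-injective : ∀ {p q} → rank p ≡ rank q → p ≡ q
    rank-injective {p} {q} eq = inPart⁻ q p (≡⇒≡ᵇ (rank p) (rank q) eq)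
    ascend : ∀ {u v} → Star (InducedArc D C) u v → rank (L u) ≤ rank (L v)
    ascend ε = ≤-refl
    ascend {u} (_◅_ {j = w} (u∈ , w∈ , a) path) =
      ≤-trans (≮⇒≥ λ w<u → forward-arc (arc D) {L} fw u w refl refl (rank-positive (L w) (alive w w∈)) w<u a)
        (ascend path)

  module _ {ℓ k : ℕ} (k+ℓ<n : k + ℓ < n) (n<2ℓ : n < ℓ + ℓ) {L : Parting} (fw : Forward L)
           (bal : T (balanced (suc (ℓ + k)) (suc k) L)) where

    private
      few-deleted : count (deletedOr deleted ∘ L) ≤ k
      few-deleted = ≤-pred (proj₁ (balanced⁻ (arc D) (suc (ℓ + k)) (suc k) L bal))

      small-part : ∀ j → j ≢ deleted → count (deletedOr j ∘ L) ≤ ℓ + k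
      small-part j j≢ = ≤-pred (proj₂ (balanced⁻ (arc D) (suc (ℓ + k)) (suc k) L bal) j j≢)

      deleted-to : ∀ j v → T (deletedOr deleted (L v)) → T (deletedOr j (L v))
      deleted-to j v t = subst (T ∘ deletedOr j) (sym (deletedOr-deleted⁻ (L v) t)) tt

      part-deletedOr : ∀ j v → L v ≡ j → T (deletedOr j (L v))
      part-deletedOr j v e = subst (T ∘ deletedOr j) (sym e) (deletedOr-self j)

      k<ℓ : k < ℓ
      k<ℓ = +-cancelʳ-< ℓ k ℓ (<-trans k+ℓ<n n<2ℓ)

      empty-small : ∀ (C : Subset n) → ¬ Nonempty C → ∣ C ∣ ≤ ℓ
      empty-small C empty = ≤-trans (≤-reflexive (trans (cong ∣_∣ (Empty-unique empty)) (∣⊥∣≡0 n))) z≤n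

      module _ {r : Fin n → Bool} (del⊆r : ∀ v → T (deletedOr deleted (L v)) → T (r v))
               {C : Subset n} (strong : Strong D C) (C∩r : ∀ v → v ∈ C → ¬ T (r v)) where

        same-part : ∀ {u v} → u ∈ C → v ∈ C → L v ≡ L u
        same-part u∈ v∈ = sym (strong-in-one-part fw strong
          (λ v v∈ d → C∩r v v∈ (del⊆r v (subst (T ∘ deletedOr deleted) (sym d) tt))) u∈ v∈)

        within-part : ∀ {u} → u ∈ C → ∣ C ∣ ≤ count (inPart (L u) ∘ L)
        within-part {u} u∈ = ≤-trans (≤-reflexive (∣∣≡count C)) (count-mono (lookup C) (inPart (L u) ∘ L)
          λ v v∈ → subst (λ p → T (inPart (L u) p)) (sym (same-part u∈ (T⇒∈ v∈))) (inPart-self (L u)))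

        alive : ∀ {u} → u ∈ C → L u ≢ deleted
        alive {u} u∈ d = C∩r u u∈ (del⊆r u (subst (T ∘ deletedOr deleted) (sym d) tt))

      -- Here k < ℓ < |part j|, so the deletions can be filled up to k inside part j, which leaves
      -- at most ℓ + k - k of its vertices. Any other part has fewer than ℓ vertices, as two parts
      -- together have at most n < 2ℓ.
      one-big : ∀ j → j ≢ deleted → ℓ < count (inPart j ∘ L) → Solution D ℓ k
      one-big j j≢ big with r , del⊆r , r⊆q , r≡k ← count-between {p = deletedOr deleted ∘ L} {q = deletedOr j ∘ L}
        (deleted-to j) k few-deleted (≤-trans (<⇒≤ (<-trans k<ℓ big))
          (count-mono (inPart j ∘ L) (deletedOr j ∘ L) λ v t → part-deletedOr j v (inPart⁻ j (L v) t))) =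
        r , r≡k , λ C strong C∩r → breaks C strong C∩r
        where
        breaks : Breaks D ℓ r
        breaks C strong C∩r with nonempty? C
        ... | no empty = empty-small C empty
        ... | yes (u , u∈) with T? (inPart j (L u))
        ...   | yes same = +-cancelʳ-≤ k ∣ C ∣ ℓ (begin
          ∣ C ∣ + k                        ≡⟨ cong₂ _+_ (∣∣≡count C) (sym r≡k) ⟩
          count (lookup C) + count r       ≤⟨ count-disjoint (lookup C) r (deletedOr j ∘ L)
            (λ v v∈ → part-deletedOr j v (trans (same-part del⊆r strong C∩r u∈ (T⇒∈ v∈)) (inPart⁻ j (L u) same)))
            r⊆q (λ v v∈ → C∩r v (T⇒∈ v∈)) ⟩
          count (deletedOr j ∘ L)          ≤⟨ small-part j j≢ ⟩
          ℓ + k                            ∎)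
          where open ≤-Reasoning
        ...   | no other = <⇒≤ (+-cancelʳ-< ℓ ∣ C ∣ ℓ (begin-strict
          ∣ C ∣ + ℓ
            ≤⟨ +-mono-≤ (within-part del⊆r strong C∩r u∈) (<⇒≤ big) ⟩
          count (inPart (L u) ∘ L) + count (inPart j ∘ L)
            ≤⟨ count-disjoint (inPart (L u) ∘ L) (inPart j ∘ L) (const true) (λ _ _ → tt) (λ _ _ → tt)
                 (λ v a b → other (subst (T ∘ inPart j)
                   (trans (sym (inPart⁻ j (L v) b)) (inPart⁻ (L u) (L v) a)) (inPart-self j))) ⟩
          count {n} (const true)
            ≡⟨ count-all n ⟩
          n
            <⟨ n<2ℓ ⟩
          ℓ + ℓ ∎))
          where open ≤-Reasoning

      none-big : (∀ j → j ≢ deleted → count (inPart j ∘ L) ≤ ℓ) → Solution D ℓ k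
      none-big small with r , del⊆r , _ , r≡k ←
        count-between {p = deletedOr deleted ∘ L} {q = const true} (λ _ _ → tt) k few-deleted
        (≤-trans (<⇒≤ (≤-trans (s≤s (m≤m+n k ℓ)) k+ℓ<n)) (≤-reflexive (sym (count-all n)))) =
        r , r≡k , breaks
        where
        breaks : Breaks D ℓ r
        breaks C strong C∩r with nonempty? C
        ... | no empty = empty-small C empty
        ... | yes (u , u∈) = ≤-trans (within-part del⊆r strong C∩r u∈) (small (L u) (alive del⊆r strong C∩r u∈))

    parting⇒solution : Solution D ℓ k
    parting⇒solution
      with ℓ <? count (inPart first ∘ L) | ℓ <? count (inPart middle ∘ L) | ℓ <? count (inPart last ∘ L)
    ... | yes big | _ | _ = one-big first (λ ()) big
    ... | no _ | yes big | _ = one-big middle (λ ()) big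
    ... | no _ | no _ | yes big = one-big last (λ ()) big
    ... | no a | no b | no c = none-big λ where
      deleted j≢ → ⊥-elim (j≢ refl)
      first   _  → ≮⇒≥ a
      middle  _  → ≮⇒≥ b
      last    _  → ≮⇒≥ c

-- Bounding the number of binary choices

prefixSum-all : ∀ {n} (f : Fin n → ℕ) → prefixSum f n ≡ sum f
prefixSum-all {zero}  f = refl
prefixSum-all {suc n} f = cong (f zero +_) (prefixSum-all (f ∘ suc))

optionList : Bool → Bool → Bool → List Part
optionList a b c = prependIf a first (prependIf b middle (prependIf c last []))

optionList-first : ∀ {a b c} → T a → first ∈ₗ optionList a b c
optionList-first {true} _ = here refl

optionList-middle : ∀ {a b c} → T b → middle ∈ₗ optionList a b c
optionList-middle {false} {true} _ = here refl
optionList-middle {true}  {true} _ = there (here refl)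

optionList-last : ∀ {a b c} → T c → last ∈ₗ optionList a b c
optionList-last {false} {false} {true} _ = here refl
optionList-last {false} {true}  {true} _ = there (here refl)
optionList-last {true}  {false} {true} _ = there (here refl)
optionList-last {true}  {true}  {true} _ = there (there (here refl))

surplus-optionList : ∀ a b c → surplus (optionList a b c) ≡ indicator a + (indicator b + indicator c) ∸ 1
surplus-optionList false false false = refl
surplus-optionList false false true  = refl
surplus-optionList false true  false = refl
surplus-optionList false true  true  = refl
surplus-optionList true  false false = refl
surplus-optionList true  false true  = refl
surplus-optionList true  true  false = refl
surplus-optionList true  true  true  = refl

-- The vertex's own part is one of its options, so only the foreign ones cost anything.
surplus-first : ∀ a b c → T a → surplus (optionList a b c) ≤ indicator b + indicator c
surplus-first true b c _ = ≤-reflexive (surplus-optionList true b c)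

surplus-middle : ∀ a b c → T b → surplus (optionList a b c) ≤ indicator a + indicator c
surplus-middle false true c _ = ≤-reflexive (surplus-optionList false true c)
surplus-middle true  true c _ = ≤-reflexive (surplus-optionList true true c)

surplus-last : ∀ a b c → T c → surplus (optionList a b c) ≤ indicator a + indicator b
surplus-last false false true _ = z≤n
surplus-last false true  true _ = ≤-refl
surplus-last true  false true _ = ≤-refl
surplus-last true  true  true _ = ≤-refl

surplus-any : ∀ a b c → surplus (optionList a b c) ≤ 2
surplus-any a b c = ≤-trans (≤-reflexive (surplus-optionList a b c))
  (∸-monoˡ-≤ 1 (+-mono-≤ (indicator-mono a true _) (+-mono-≤ (indicator-mono b true _) (indicator-mono c true _))))

-- The place given to a vertex that `pos` deletes: it takes any option, and `cover` removes it later
-- if it causes backward arcs.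
default : List Part → Part
default []      = deleted
default (p ∷ _) = p

default-chosen : ∀ o → Chosen o (default o)
default-chosen []      = inj₂ (refl , refl)
default-chosen (p ∷ _) = inj₁ (here refl)

isDeleted-eq : ∀ {p} → p ≡ deleted → T (isDeleted p)
isDeleted-eq refl = tt

module Probing {n : ℕ} (D : Digraph n) (ℓ k : ℕ) where
  open Search (arc D)
  open CoverCorrect (arc D)
  open ChooseCorrect (arc D)

  module _ (k+ℓ<n : k + ℓ < n) (n<2ℓ : n < ℓ + ℓ) where

    probe-sound : ∀ ak na bk nb → T (probe ℓ k ak na bk nb) → Solution D ℓ k
    probe-sound ak na bk nb t
      with L , _ , covered ← choose-sound (suc (ℓ + k)) (suc k) k (options ak na bk nb)
             n ≤-refl (k * 14) undecided unfilled t
      with L′ , _ , fw , bal , _ ← cover-sound (suc (ℓ + k)) (suc k) n ≤-refl k L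
             (λ u n≤u → ⊥-elim (<⇒≱ (toℕ<n u) n≤u)) covered =
      parting⇒solution D k+ℓ<n n<2ℓ {L = L′} fw bal

    probeLast-sound : ∀ ak na bk nb → T (probeLast ℓ k ak na bk nb) → Solution D ℓ k
    probeLast-sound ak na bk zero t with T-∨⁻ {probe ℓ k ak na bk zero} t
    ... | inj₁ t′ = probe-sound ak na bk zero t′
    probeLast-sound ak na bk (suc nb) t with T-∨⁻ {probe ℓ k ak na bk (suc nb)} t
    ... | inj₁ t′ = probe-sound ak na bk (suc nb) t′
    ... | inj₂ t′ = probeLast-sound ak na (suc bk) nb t′

    probeFirst-sound : ∀ ak na → T (probeFirst ℓ k ak na) → Solution D ℓ k
    probeFirst-sound ak zero t with T-∨⁻ {probeLast ℓ k ak zero k n} t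
    ... | inj₁ t′ = probeLast-sound ak zero k n t′
    probeFirst-sound ak (suc na) t with T-∨⁻ {probeLast ℓ k ak (suc na) k n} t
    ... | inj₁ t′ = probeLast-sound ak (suc na) k n t′
    ... | inj₂ t′ = probeFirst-sound (suc ak) na t′

  probeLast-complete : ∀ ak na b bk nb → T (probe ℓ k ak na (b + bk) nb) → T (probeLast ℓ k ak na bk (b + nb))
  probeLast-complete ak na zero bk zero t = T-∨⁺ (inj₁ t)
  probeLast-complete ak na zero bk (suc nb) t = T-∨⁺ (inj₁ t)
  probeLast-complete ak na (suc b) bk nb t = T-∨⁺ {probe ℓ k ak na bk (suc b + nb)}
    (inj₂ (probeLast-complete ak na b (suc bk) nb (subst (λ z → T (probe ℓ k ak na z nb)) (sym (+-suc b bk)) t)))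

  probeFirst-complete : ∀ a ak na → T (probeLast ℓ k (a + ak) na k n) → T (probeFirst ℓ k ak (a + na))
  probeFirst-complete zero ak zero t = T-∨⁺ (inj₁ t)
  probeFirst-complete zero ak (suc na) t = T-∨⁺ (inj₁ t)
  probeFirst-complete (suc a) ak na t = T-∨⁺ {probeLast ℓ k ak (suc a + na) k n}
    (inj₂ (probeFirst-complete a (suc ak) na (subst (λ z → T (probeLast ℓ k z na k n)) (sym (+-suc a ak)) t)))

  module _ (semicomplete : Semicomplete D) (X : Fin n → Bool) (X≡k : count X ≡ k)
           (pos : Parting) (deleted⇒X : ∀ v → pos v ≡ deleted → T (X v))
           (fw : Forward pos) (small : ∀ j → j ≢ deleted → count (inPart j ∘ pos) ≤ ℓ) where

    private
      partSize : Part → ℕ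
      partSize j = count (inPart j ∘ pos)

      a b : ℕ
      a = partSize first
      b = partSize last

      O : Fin n → List Part
      O = options (a + k) (n ∸ a) (b + k) (n ∸ b)

      inPart-eq : ∀ j {v} → pos v ≡ j → T (inPart j (pos v))
      inPart-eq j e = subst (T ∘ inPart j) (sym e) (inPart-self j)

      no-loop : ∀ v → ¬ T (arc D v v)
      no-loop v t = subst T (loopless D v) t

      -- Meant for the in-neighbours of a vertex v of the first part and the out-neighbours of one
      -- of the last part. The inequality is strict because v lies in the union but has no loop.
      union-bound : ∀ j (p : Fin n → Bool) v → pos v ≡ j → ¬ T (p v) →
        (∀ w → T (p w) → pos w ≡ deleted ⊎ pos w ≡ j) → count p < partSize j + k
      union-bound j p v v≡j v∉p sub = begin-strict
        count p
          <⟨ count-mono-< p (λ w → inPart j (pos w) ∨ X w)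
               (λ w w∈ → T-∨⁺ {inPart j (pos w)}
                 ([ (λ d → inj₂ (deleted⇒X w d)) , (λ e → inj₁ (inPart-eq j e)) ] (sub w w∈)))
               v (T-∨⁺ (inj₁ (inPart-eq j v≡j))) v∉p ⟩
        count (λ w → inPart j (pos w) ∨ X w)
          ≤⟨ count-covered (inPart j ∘ pos) X _ (λ w → T-∨⁻ {inPart j (pos w)}) ⟩
        partSize j + count X
          ≡⟨ cong (partSize j +_) X≡k ⟩
        partSize j + k ∎
        where open ≤-Reasoning

      complement-bound : ∀ j (p : Fin n → Bool) v → pos v ≢ j → ¬ T (p v) →
        (∀ w → T (p w) → pos w ≢ j) → count p < n ∸ partSize j
      complement-bound j p v v≢j v∉p sub = m+n≤o⇒m≤o∸n (suc (count p)) (begin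
        suc (count p) + partSize j
          ≤⟨ +-monoˡ-≤ (partSize j) (count-mono-< p (not ∘ inPart j ∘ pos)
               (λ w w∈ → T-not (sub w w∈ ∘ inPart⁻ j (pos w))) v (T-not (v≢j ∘ inPart⁻ j (pos v))) v∉p) ⟩
        count (not ∘ inPart j ∘ pos) + partSize j
          ≤⟨ count-disjoint (not ∘ inPart j ∘ pos) (inPart j ∘ pos) (const true)
               (λ _ _ → tt) (λ _ _ → tt) (λ v → not-T (inPart j (pos v))) ⟩
        count {n} (const true)
          ≡⟨ count-all n ⟩
        n ∎)
        where
        open ≤-Reasoning
        T-not : ∀ {x} → ¬ T x → T (not x)
        T-not {false} _ = tt
        T-not {true}  f = f tt
        not-T : ∀ x → T (not x) → ¬ T x
        not-T false _ ()

      okFirst okMiddle okLast : Fin n → Bool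
      okFirst  v = indegree v <ᵇ a + k
      okMiddle v = (outdegree v <ᵇ n ∸ a) ∧ (indegree v <ᵇ n ∸ b)
      okLast   v = outdegree v <ᵇ b + k

      first-ok : ∀ v → pos v ≡ first → T (okFirst v)
      first-ok v e = <⇒<ᵇ (union-bound first (λ w → arc D w v) v e (no-loop v) before)
        where
        before : ∀ w → T (arc D w v) → pos w ≡ deleted ⊎ pos w ≡ first
        before w t with pos w in ew
        ... | deleted = inj₁ refl
        ... | first   = inj₂ refl
        ... | middle  = ⊥-elim (forward-arc (arc D) {pos} fw w v ew e (s≤s z≤n) first<middle t)
        ... | last    = ⊥-elim (forward-arc (arc D) {pos} fw w v ew e (s≤s z≤n) first<last t)

      last-ok : ∀ v → pos v ≡ last → T (okLast v)
      last-ok v e = <⇒<ᵇ (union-bound last (arc D v) v e (no-loop v) after)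
        where
        after : ∀ w → T (arc D v w) → pos w ≡ deleted ⊎ pos w ≡ last
        after w t with pos w in ew
        ... | deleted = inj₁ refl
        ... | last    = inj₂ refl
        ... | first   = ⊥-elim (forward-arc (arc D) {pos} fw v w e ew (s≤s z≤n) first<last t)
        ... | middle  = ⊥-elim (forward-arc (arc D) {pos} fw v w e ew (s≤s z≤n) middle<last t)

      middle-ok : ∀ v → pos v ≡ middle → T (okMiddle v)
      middle-ok v e = T-∧⁺
        (<⇒<ᵇ (complement-bound first (arc D v) v (subst (_≢ first) (sym e) (λ ())) (no-loop v)
          λ w t ew → forward-arc (arc D) {pos} fw v w e ew (s≤s z≤n) first<middle t))
        (<⇒<ᵇ (complement-bound last (λ w → arc D w v) v (subst (_≢ last) (sym e) (λ ())) (no-loop v)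
          λ w t ew → forward-arc (arc D) {pos} fw w v ew e (s≤s z≤n) middle<last t))

      target : Parting
      target v = if isDeleted (pos v) then default (O v) else pos v

      target-alive : ∀ v → ¬ T (X v) → target v ≡ pos v
      target-alive v v∉X with pos v in e
      ... | deleted = ⊥-elim (v∉X (deleted⇒X v e))
      ... | first   = refl
      ... | middle  = refl
      ... | last    = refl

      target-chosen : ∀ v → Chosen (O v) (target v)
      target-chosen v with pos v in e
      ... | deleted = default-chosen (O v)
      ... | first   = inj₁ (optionList-first {okFirst v} {okMiddle v} {okLast v} (first-ok v e))
      ... | middle  = inj₁ (optionList-middle {okFirst v} {okMiddle v} {okLast v} (middle-ok v e))
      ... | last    = inj₁ (optionList-last {okFirst v} {okMiddle v} {okLast v} (last-ok v e))

      afterFirst beforeLast : Fin n → Bool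
      afterFirst v = inPart middle (pos v) ∨ inPart last (pos v)
      beforeLast v = inPart first (pos v) ∨ inPart middle (pos v)

      -- Vertices that their degrees alone do not exclude from some other part.
      vagueFirst vagueLast vagueMiddle₁ vagueMiddle₂ : Fin n → Bool
      vagueFirst   v = inPart first (pos v)  ∧ (outdegree v <ᵇ count afterFirst + k)
      vagueLast    v = inPart last (pos v)   ∧ (indegree v  <ᵇ count beforeLast + k)
      vagueMiddle₁ v = inPart middle (pos v) ∧ (indegree v  <ᵇ a + k)
      vagueMiddle₂ v = inPart middle (pos v) ∧ (outdegree v <ᵇ b + k)

      semi : ∀ {y : Fin n → Bool} u v → u ≢ v → T (y u) → T (y v) → T (arc D u v) ⊎ T (arc D v u)
      semi u v u≢v _ _ = semicomplete u v u≢v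

      semi′ : ∀ {y : Fin n → Bool} u v → u ≢ v → T (y u) → T (y v) → T (arc D v u) ⊎ T (arc D u v)
      semi′ u v u≢v _ _ = semicomplete v u (u≢v ∘ sym)

      -- Semicompleteness gives an arc in some direction, and the backward direction is excluded.
      ordered : ∀ i j → 0 < rank i → rank i < rank j → ∀ u v →
                T (inPart i (pos u)) → T (inPart j (pos v)) → T (arc D u v)
      ordered i j 0<i i<j u v u∈ v∈ with semicomplete u v u≢v
        where
        u≢v : u ≢ v
        u≢v refl = <-irrefl (cong rank (trans (sym (inPart⁻ i (pos u) u∈)) (inPart⁻ j (pos u) v∈))) i<j
      ... | inj₁ t = t
      ... | inj₂ t = ⊥-elim (forward-arc (arc D) {pos} fw v u (inPart⁻ j (pos v) v∈) (inPart⁻ i (pos u) u∈) 0<i i<j t)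

      first→middle : ∀ u v → T (inPart first (pos u)) → T (inPart middle (pos v)) → T (arc D u v)
      first→middle = ordered first middle (s≤s z≤n) first<middle

      first→last : ∀ u v → T (inPart first (pos u)) → T (inPart last (pos v)) → T (arc D u v)
      first→last = ordered first last (s≤s z≤n) first<last

      middle→last : ∀ u v → T (inPart middle (pos u)) → T (inPart last (pos v)) → T (arc D u v)
      middle→last = ordered middle last (s≤s z≤n) middle<last

      different : ∀ i j → i ≢ j → ∀ v → T (inPart i (pos v)) → ¬ T (inPart j (pos v))
      different i j i≢j v x y = i≢j (trans (sym (inPart⁻ i (pos v) x)) (inPart⁻ j (pos v) y))

      few-vagueFirst : count vagueFirst ≤ k + k
      few-vagueFirst = few-barely-dominating {E = arc D} {y = inPart first ∘ pos} {z = afterFirst} semi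
        (λ v x → [ different first middle (λ ()) v x , different first last (λ ()) v x ]
          ∘ T-∨⁻ {inPart middle (pos v)})
        (λ u v x → [ first→middle u v x , first→last u v x ] ∘ T-∨⁻ {inPart middle (pos v)})
        k

      few-vagueLast : count vagueLast ≤ k + k
      few-vagueLast = few-barely-dominating
        {E = λ u v → arc D v u} {y = inPart last ∘ pos} {z = beforeLast} semi′
        (λ v x → [ different last first (λ ()) v x , different last middle (λ ()) v x ]
          ∘ T-∨⁻ {inPart first (pos v)})
        (λ u v x → [ (λ y → first→last v u y x) , (λ y → middle→last v u y x) ]
          ∘ T-∨⁻ {inPart first (pos v)})
        k

      few-vagueMiddle₁ : count vagueMiddle₁ ≤ k + k
      few-vagueMiddle₁ = few-barely-dominating
        {E = λ u v → arc D v u} {y = inPart middle ∘ pos} {z = inPart first ∘ pos} semi′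
        (different middle first (λ ())) (λ u v x y → first→middle v u y x) k

      few-vagueMiddle₂ : count vagueMiddle₂ ≤ k + k
      few-vagueMiddle₂ = few-barely-dominating
        {E = arc D} {y = inPart middle ∘ pos} {z = inPart last ∘ pos} semi
        (different middle last (λ ())) middle→last k

      -- Brings the threshold n - |part j| into the form |z| + k required by
      -- `few-barely-dominating`: a vertex outside part j lies in z or is one of the k vertices of
      -- X.
      complement-covered : ∀ j (z : Fin n → Bool) →
        (∀ v → pos v ≢ deleted → pos v ≢ j → T (z v)) → n ∸ partSize j ≤ count z + k
      complement-covered j z cov = m≤n+o⇒m∸n≤o n (partSize j) (begin
        n
          ≡⟨ count-all n ⟨
        count {n} (const true)
          ≤⟨ count-covered (inPart j ∘ pos) (λ v → z v ∨ X v) (const true) side ⟩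
        partSize j + count (λ v → z v ∨ X v)
          ≤⟨ +-monoʳ-≤ (partSize j) (count-covered z X _ (λ v → T-∨⁻ {z v})) ⟩
        partSize j + (count z + count X)
          ≡⟨ cong (λ c → partSize j + (count z + c)) X≡k ⟩
        partSize j + (count z + k) ∎)
        where
        open ≤-Reasoning
        side : ∀ v → T true → T (inPart j (pos v)) ⊎ T (z v ∨ X v)
        side v _ with T? (inPart j (pos v)) | T? (isDeleted (pos v))
        ... | yes t | _ = inj₁ t
        ... | no _  | yes d = inj₂ (T-∨⁺ {z v} (inj₂ (deleted⇒X v (isDeleted⁻ (pos v) d))))
        ... | no ≢j | no ≢d = inj₂ (T-∨⁺ (inj₁ (cov v (≢d ∘ isDeleted-eq) (≢j ∘ inPart-eq j))))

      weaken-<ᵇ : ∀ x {y z} → y ≤ z → T (x <ᵇ y) → T (x <ᵇ z)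
      weaken-<ᵇ x y≤z t = <⇒<ᵇ (≤-trans (<ᵇ⇒< x _ t) y≤z)

      n∸a≤ : n ∸ a ≤ count afterFirst + k
      n∸a≤ = complement-covered first afterFirst cov
        where
        cov : ∀ v → pos v ≢ deleted → pos v ≢ first → T (afterFirst v)
        cov v ≢d ≢f with pos v
        ... | deleted = ⊥-elim (≢d refl)
        ... | first   = ⊥-elim (≢f refl)
        ... | middle  = tt
        ... | last    = tt

      n∸b≤ : n ∸ b ≤ count beforeLast + k
      n∸b≤ = complement-covered last beforeLast cov
        where
        cov : ∀ v → pos v ≢ deleted → pos v ≢ last → T (beforeLast v)
        cov v ≢d ≢l with pos v
        ... | deleted = ⊥-elim (≢d refl)
        ... | last    = ⊥-elim (≢l refl)
        ... | middle  = tt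
        ... | first   = tt

      b≤afterFirst : b ≤ count afterFirst
      b≤afterFirst = count-mono (inPart last ∘ pos) afterFirst λ v t → T-∨⁺ {inPart middle (pos v)} (inj₂ t)

      a≤beforeLast : a ≤ count beforeLast
      a≤beforeLast = count-mono (inPart first ∘ pos) beforeLast λ v t → T-∨⁺ (inj₁ t)

      χ : (Fin n → Bool) → Fin n → ℕ
      χ p = indicator ∘ p

      -- For a vertex of the first part, middle and last both require the same low outdegree, so one
      -- vague degree may cost two choices; likewise for the last part. A middle vertex has a
      -- separate degree test for each foreign part. A vertex of X can have three options, hence
      -- surplus 2. The total is 4k + 4k + (2k + 2k) + 2k = 14k.
      vagueness : Fin n → ℕ
      vagueness v = (χ vagueFirst v + χ vagueFirst v) + ((χ vagueLast v + χ vagueLast v)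
        + ((χ vagueMiddle₁ v + χ vagueMiddle₂ v) + (χ X v + χ X v)))

      surplus≤ : ∀ v → surplus (O v) ≤ vagueness v
      surplus≤ v with pos v in e
      -- Once the part is known, the summands of `vagueness v` belonging to other parts reduce to 0.
      ... | first = ≤-trans (≤-trans (surplus-first (okFirst v) (okMiddle v) (okLast v) (first-ok v e))
          (+-mono-≤ (indicator-mono (okMiddle v) q λ t →
                      weaken-<ᵇ (outdegree v) n∸a≤ (proj₁ (T-∧⁻ {outdegree v <ᵇ n ∸ a} t)))
                    (indicator-mono (okLast v) q (weaken-<ᵇ (outdegree v) (+-monoˡ-≤ k b≤afterFirst)))))
          (m≤m+n _ _)
        where q = outdegree v <ᵇ count afterFirst + k
      ... | last = ≤-trans (surplus-last (okFirst v) (okMiddle v) (okLast v) (last-ok v e)) (≤-trans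
          (+-mono-≤ (indicator-mono (okFirst v) q (weaken-<ᵇ (indegree v) (+-monoˡ-≤ k a≤beforeLast)))
                    (indicator-mono (okMiddle v) q λ t →
                      weaken-<ᵇ (indegree v) n∸b≤ (proj₂ (T-∧⁻ {outdegree v <ᵇ n ∸ a} t))))
          (m≤m+n _ _))
        where q = indegree v <ᵇ count beforeLast + k
      ... | middle = ≤-trans (surplus-middle (okFirst v) (okMiddle v) (okLast v) (middle-ok v e)) (m≤m+n _ _)
      ... | deleted = ≤-trans (surplus-any (okFirst v) (okMiddle v) (okLast v))
          (+-mono-≤ (indicator-mono true (X v) λ _ → deleted⇒X v e) (indicator-mono true (X v) λ _ → deleted⇒X v e))

      sum-+ : ∀ {f g : Fin n → ℕ} {x y} → sum f ≤ x → sum g ≤ y → sum (λ v → f v + g v) ≤ x + y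
      sum-+ {f} {g} p q = ≤-trans (≤-reflexive (∑-distrib-+ f g)) (+-mono-≤ p q)

      fuel : prefixSum (surplus ∘ O) n ≤ k * 14
      fuel = begin
        prefixSum (surplus ∘ O) n   ≡⟨ prefixSum-all (surplus ∘ O) ⟩
        sum (surplus ∘ O)           ≤⟨ sum-mono surplus≤ ⟩
        sum vagueness               ≤⟨ sum-+ (sum-+ few-vagueFirst few-vagueFirst)
          (sum-+ (sum-+ few-vagueLast few-vagueLast)
            (sum-+ (sum-+ few-vagueMiddle₁ few-vagueMiddle₂) (sum-+ (≤-reflexive X≡k) (≤-reflexive X≡k)))) ⟩
        (k + k + (k + k)) + ((k + k + (k + k)) + ((k + k + (k + k)) + (k + k)))
          ≡⟨ solve 1 (λ k → let 4k = k :+ k :+ (k :+ k) in 4k :+ (4k :+ (4k :+ (k :+ k))) := k :* con 14)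
               refl k ⟩
        k * 14                      ∎
        where
        open ≤-Reasoning
        open +-*-Solver

      covered : ∀ L → (∀ v → L v ≡ target v) → T (cover (suc (ℓ + k)) (suc k) n ≤-refl k L)
      covered L L≡ = cover-complete (suc (ℓ + k)) (suc k) X n ≤-refl k L
        (λ u v u∉ v∉ → fw u v ∘ subst₂ (λ p q → T (backward (arc D u v) p q)) (agree u u∉) (agree v v∉))
        within (≤-trans (≤-reflexive X≡k) (m≤m+n k _))
        λ L′ sub del → balanced⁺ (arc D) (suc (ℓ + k)) (suc k) L′
          (s≤s (≤-trans (count-mono (deletedOr deleted ∘ L′) X λ v t → del v (deletedOr-deleted⁻ (L′ v) t))
            (≤-reflexive X≡k)))
          -- Whatever ends up in part j or deleted was in part j of `pos` or belongs to X, which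
          -- gives ℓ + k.
          λ j j≢ → s≤s (≤-trans (count-covered (inPart j ∘ pos) X (deletedOr j ∘ L′) λ v t →
              [ (λ d → inj₂ (del v d)) , stays L′ sub j j≢ v ] (deletedOr⁻ j (L′ v) t))
            (+-mono-≤ (small j j≢) (≤-reflexive X≡k)))
        where
        agree : ∀ v → ¬ T (X v) → L v ≡ pos v
        agree v v∉ = trans (L≡ v) (target-alive v v∉)
        within : ∀ v → L v ≡ deleted → T (X v)
        within v d with T? (X v)
        ... | yes v∈ = v∈
        ... | no v∉ = deleted⇒X v (trans (sym (agree v v∉)) d)
        stays : ∀ L′ → L′ ⊑ L → ∀ j → j ≢ deleted → ∀ v → L′ v ≡ j → T (inPart j (pos v)) ⊎ T (X v)
        stays L′ sub j j≢ v e with T? (X v) | sub v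
        ... | yes v∈ | _ = inj₂ v∈
        ... | no v∉ | inj₁ e′ = inj₁ (inPart-eq j (trans (sym (agree v v∉)) (trans (sym e′) e)))
        ... | no v∉ | inj₂ d = ⊥-elim (j≢ (trans (sym e) d))

    parting⇒probe : T (probe ℓ k (a + k) (n ∸ a) (b + k) (n ∸ b))
    parting⇒probe = choose-complete (suc (ℓ + k)) (suc k) k O target target-chosen covered
      n ≤-refl (k * 14) undecided unfilled fuel

    parting⇒probeFirst : T (probeFirst ℓ k k n)
    parting⇒probeFirst = subst (λ m → T (probeFirst ℓ k k m)) (m+[n∸m]≡n (count≤n (inPart first ∘ pos)))
      (probeFirst-complete a k (n ∸ a)
        (subst (λ m → T (probeLast ℓ k (a + k) (n ∸ a) k m)) (m+[n∸m]≡n (count≤n (inPart last ∘ pos)))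
          (probeLast-complete (a + k) (n ∸ a) b k (n ∸ b) parting⇒probe)))

-- Existence of a partition into three small parts

module Descent {n : ℕ} (D : Digraph n) {ℓ : ℕ} (n<2ℓ : n < ℓ + ℓ)
               {X : Fin n → Bool} (breaks : Breaks D ℓ X) where
  open Search (arc D)
  open CoverCorrect (arc D)

  record Good (pos : Parting) : Set where
    field
      deleted⇒X  : ∀ v → pos v ≡ deleted → T (X v)
      X⇒deleted  : ∀ v → T (X v) → pos v ≡ deleted
      forward    : Forward pos
      few-first  : count (inPart first ∘ pos) ≤ ℓ
      few-last   : count (inPart last ∘ pos) ≤ ℓ
  open Good

  middleOf : Parting → Fin n → Bool
  middleOf pos = inPart middle ∘ pos

  module _ {pos : Parting} (good : Good pos) {S : Subset n} (sp : Split D (setOf (middleOf pos)) S) where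
    open Split sp

    private
      in-middle : ∀ {v} → T (lookup S v) → pos v ≡ middle
      in-middle {v} t = inPart⁻ middle (pos v) (∈setOf⁻ (middleOf pos) (initial (T⇒∈ t)))

      no-return : ∀ u v → pos u ≡ middle → ¬ T (lookup S u) → T (lookup S v) → ¬ T (arc D u v)
      no-return u v u∈ u∉S v∈S = noReturn u v (∈setOf⁺ (middleOf pos) (subst (T ∘ inPart middle) (sym u∈) tt))
        (u∉S ∘ ∈⇒T) (T⇒∈ v∈S)

      old : ∀ u v {p q} → pos u ≡ p → pos v ≡ q → 0 < rank q → rank q < rank p → ¬ T (arc D u v)
      old = forward-arc (arc D) {pos} (forward good)

      grown : Fin n → Bool
      grown v = inPart first (pos v) ∨ lookup S v

      prepend append : Parting
      prepend v = if lookup S v then first else pos v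
      append  v = if inPart middle (pos v) ∧ not (lookup S v) then last else pos v

      -- Only arcs into S could become backward: from the rest of the middle part the split excludes
      -- them, and from the last part they were backward before.
      prepend-forward : Forward prepend
      prepend-forward u v t with e , 0<q , q<p ← Back⁻ {arc D u v} (prepend u) (prepend v) t
        with lookup S u in su | lookup S v in sv
      ... | true  | _     = <-irrefl refl (≤-trans 0<q (≤-pred q<p))
      ... | false | false = old u v refl refl 0<q q<p e
      ... | false | true with pos u in pu
      ...   | middle = no-return u v pu (λ x → subst T su x) (Equivalence.from T-≡ sv) e
      ...   | last   = old u v pu (in-middle (Equivalence.from T-≡ sv)) (s≤s z≤n) ≤-refl e
      ...   | first  = <-irrefl refl q<p
      ...   | deleted = n≮0 q<p

      prepend-good : count grown ≤ ℓ → Good prepend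
      prepend-good few .deleted⇒X v d with lookup S v
      ... | false = deleted⇒X good v d
      prepend-good few .X⇒deleted v x with lookup S v in sv
      ... | false = X⇒deleted good v x
      ... | true with () ← trans (sym (in-middle (Equivalence.from T-≡ sv))) (X⇒deleted good v x)
      prepend-good few .forward = prepend-forward
      prepend-good few .few-first = ≤-trans (count-mono (inPart first ∘ prepend) grown sub) few
        where
        sub : ∀ v → T (inPart first (prepend v)) → T (grown v)
        sub v t with lookup S v
        ... | true  = T-∨⁺ {inPart first (pos v)} (inj₂ tt)
        ... | false = T-∨⁺ (inj₁ t)
      prepend-good few .few-last =
        ≤-trans (count-mono (inPart last ∘ prepend) (inPart last ∘ pos) sub) (few-last good)
        where
        sub : ∀ v → T (inPart last (prepend v)) → T (inPart last (pos v))
        sub v t with lookup S v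
        ... | false = t

      prepend-smaller : count (middleOf prepend) < count (middleOf pos)
      prepend-smaller = let x , x∈S = inhabited in
        count-mono-< (middleOf prepend) (middleOf pos) sub x
          (subst (T ∘ inPart middle) (sym (in-middle (∈⇒T x∈S))) tt) (moved x (∈⇒T x∈S))
        where
        sub : ∀ v → T (middleOf prepend v) → T (middleOf pos v)
        sub v t with lookup S v
        ... | false = t
        moved : ∀ x → T (lookup S x) → ¬ T (middleOf prepend x)
        moved x x∈S t with lookup S x
        moved x x∈S () | true

      append-forward : Forward append
      append-forward u v t with e , 0<q , q<p ← Back⁻ {arc D u v} (append u) (append v) t
        with pos u in pu | lookup S u in su | pos v in pv | lookup S v in sv
      ... | middle | false | middle | false = <-irrefl refl q<p
      ... | middle | false | middle | true  = no-return u v pu (λ x → subst T su x) (Equivalence.from T-≡ sv) e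
      ... | middle | false | first  | _     = old u v pu pv (s≤s z≤n) ≤-refl e
      ... | middle | false | last   | _     = <-irrefl refl q<p
      ... | middle | true  | middle | false = <-asym q<p ≤-refl
      ... | middle | true  | middle | true  = old u v pu pv 0<q q<p e
      ... | middle | true  | first  | _     = old u v pu pv 0<q q<p e
      ... | middle | true  | last   | _     = old u v pu pv 0<q q<p e
      ... | last   | _     | middle | false = <-irrefl refl q<p
      ... | last   | _     | middle | true  = old u v pu pv 0<q q<p e
      ... | last   | _     | first  | _     = old u v pu pv 0<q q<p e
      ... | last   | _     | last   | _     = old u v pu pv 0<q q<p e
      ... | first  | _     | middle | false = <-asym q<p (s≤s (s≤s z≤n))
      ... | first  | _     | middle | true  = old u v pu pv 0<q q<p e
      ... | first  | _     | first  | _     = old u v pu pv 0<q q<p e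
      ... | first  | _     | last   | _     = old u v pu pv 0<q q<p e
      ... | deleted | _    | middle | false = n≮0 q<p
      ... | deleted | _    | middle | true  = n≮0 q<p
      ... | deleted | _    | first  | _     = n≮0 q<p
      ... | deleted | _    | last   | _     = n≮0 q<p

      append-good : ℓ < count grown → Good append
      append-good many .deleted⇒X v d with pos v in pv | lookup S v
      ... | deleted | _     = deleted⇒X good v pv
      append-good many .deleted⇒X v () | middle | false
      append-good many .X⇒deleted v x rewrite X⇒deleted good v x = refl
      append-good many .forward = append-forward
      append-good many .few-first =
        ≤-trans (count-mono (inPart first ∘ append) (inPart first ∘ pos) sub) (few-first good)
        where
        sub : ∀ v → T (inPart first (append v)) → T (inPart first (pos v))
        sub v t with pos v | lookup S v
        ... | first  | _     = tt
        sub v () | middle | false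
        sub v () | middle | true
      append-good many .few-last = <⇒≤ (+-cancelʳ-< ℓ _ ℓ (begin-strict
        count (inPart last ∘ append) + ℓ            ≤⟨ +-monoʳ-≤ _ (<⇒≤ many) ⟩
        count (inPart last ∘ append) + count grown  ≤⟨ count-disjoint (inPart last ∘ append) grown (const true)
                                                         (λ _ _ → tt) (λ _ _ → tt) apart ⟩
        count {n} (const true)                      ≡⟨ count-all n ⟩
        n                                           <⟨ n<2ℓ ⟩
        ℓ + ℓ                                       ∎))
        where
        open ≤-Reasoning
        apart : ∀ v → T (inPart last (append v)) → ¬ T (grown v)
        apart v t g with pos v in pv | lookup S v in sv
        ... | middle | false = g
        ... | last   | false = g
        ... | last   | true with () ← trans (sym pv) (in-middle (Equivalence.from T-≡ sv))

      append-smaller : count (middleOf append) < count (middleOf pos)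
      append-smaller = let y , y∈ , y∉S = proper in
        count-mono-< (middleOf append) (middleOf pos) sub y (∈setOf⁻ (middleOf pos) y∈)
          (moved y (∈setOf⁻ (middleOf pos) y∈) (y∉S ∘ T⇒∈))
        where
        sub : ∀ v → T (middleOf append v) → T (middleOf pos v)
        sub v t with pos v | lookup S v
        ... | middle | _ = tt
        moved : ∀ y → T (middleOf pos y) → ¬ T (lookup S y) → ¬ T (middleOf append y)
        moved y y∈ y∉S t with pos y | lookup S y
        ... | middle | true  = y∉S tt
        moved y y∈ y∉S () | middle | false

    -- If the initial piece S does not fit into the first part, then more than ℓ > n - ℓ vertices
    -- precede the rest of the middle part, which therefore fits into the last part.
    refine : ∃[ pos′ ] Good pos′ × count (middleOf pos′) < count (middleOf pos)
    refine with count grown ≤? ℓ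
    ... | yes few = prepend , prepend-good few , prepend-smaller
    ... | no many = append , append-good (≰⇒> many) , append-smaller

  -- Every refinement shrinks the middle part, so eventually it is strong. It avoids X, and
  -- therefore `breaks` bounds it by ℓ.
  descend : ∀ m pos → Good pos → count (middleOf pos) ≤ m → ∃[ pos′ ] Good pos′ × count (middleOf pos′) ≤ ℓ
  descend m pos good ≤m with anySubset? (split? D (setOf (middleOf pos)))
  ... | no unsplit = pos , good , ≤-trans (≤-reflexive (sym (∣setOf∣ (middleOf pos))))
    (breaks _ (unsplit⇒strong D unsplit) λ v v∈ v∈X →
      subst (T ∘ inPart middle) (X⇒deleted good v v∈X) (∈setOf⁻ (middleOf pos) v∈))
  descend zero pos good ≤m | yes (S , sp) with _ , _ , smaller ← refine good sp =
    ⊥-elim (n≮0 (≤-trans smaller ≤m))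
  descend (suc m) pos good ≤m | yes (S , sp) with pos′ , good′ , smaller ← refine good sp =
    descend m pos′ good′ (≤-pred (≤-trans smaller ≤m))

  three-parts : ∃[ pos ] Good pos × count (middleOf pos) ≤ ℓ
  three-parts = descend n start start-good (count≤n _)
    where
    start : Parting
    start v = if X v then deleted else middle
    start-none : ∀ j → j ≢ deleted → j ≢ middle → count (inPart j ∘ start) ≤ ℓ
    start-none j ≢d ≢m =
      ≤-trans (count-mono (inPart j ∘ start) (const false) none) (≤-trans (≤-reflexive (zeros n)) z≤n)
      where
      zeros : ∀ n → count {n} (const false) ≡ 0
      zeros zero    = refl
      zeros (suc n) = zeros n
      none : ∀ v → T (inPart j (start v)) → T false
      none v t with X v | inPart⁻ j (start v) t
      ... | true  | e = ≢d (sym e)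
      ... | false | e = ≢m (sym e)
    start-good : Good start
    start-good .deleted⇒X v d with X v
    ... | true = tt
    start-good .deleted⇒X v () | false
    start-good .X⇒deleted v x with X v
    ... | true = refl
    start-good .forward u v t with _ , 0<q , q<p ← Back⁻ {arc D u v} (start u) (start v) t with X u | X v
    ... | true  | _     = n≮0 q<p
    ... | false | false = <-irrefl refl q<p
    ... | false | true  = n≮0 0<q
    start-good .few-first = start-none first (λ ()) (λ ())
    start-good .few-last = start-none last (λ ()) (λ ())

-- Correctness of the decision procedure

decide-correct : ∀ I → Semicomplete (D I) → Search.decide (arc (D I)) (ℓ I) (k I) ≡ true ⇔ DCOC I
decide-correct I semicomplete = mk⇔
  (Equivalence.from (DCOC⇔Solution I) ∘ sound ∘ Equivalence.from T-≡)
  (Equivalence.to T-≡ ∘ complete ∘ Equivalence.to (DCOC⇔Solution I))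
  where
  open Search (arc (D I))
  k≤n : k I ≤ n I
  k≤n = <⇒≤ (≤-trans (s≤s (m≤m+n (k I) (ℓ I))) (k+ℓ<n I))
  sound : T (decide (ℓ I) (k I)) → Solution (D I) (ℓ I) (k I)
  sound t with n I <ᵇ ℓ I + ℓ I in eq
  ... | true  = Probing.probeFirst-sound (D I) (ℓ I) (k I) (k+ℓ<n I)
                  (<ᵇ⇒< _ _ (Equivalence.from T-≡ eq)) (k I) (n I) t
  ... | false = Exhaustive.exhaustive-sound (D I) (ℓ I) (k I) k≤n t
  complete : Solution (D I) (ℓ I) (k I) → T (decide (ℓ I) (k I))
  complete sol with n I <ᵇ ℓ I + ℓ I in eq
  ... | false = ExhaustiveComplete.exhaustive-complete (D I) (ℓ I) (k I) sol
  complete (X , X≡k , breaks) | true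
    with pos , good , few-middle ← Descent.three-parts (D I) (<ᵇ⇒< _ _ (Equivalence.from T-≡ eq)) breaks =
    Probing.parting⇒probeFirst (D I) (ℓ I) (k I) semicomplete X X≡k pos (deleted⇒X good)
      (forward good) λ where
        deleted j≢ → ⊥-elim (j≢ refl)
        first   _  → few-first good
        middle  _  → few-middle
        last    _  → few-last good
    where open Descent.Good

-- Counting calls

expSize : ∀ {m γ} {arity : Fin m → ℕ} → Exp arity γ → ℕ
expsSize : ∀ {m γ a} {arity : Fin m → ℕ} → Exps arity γ a → ℕ
expSize (var _) = 1
expSize nil = 1
expSize (cons e₁ e₂) = suc (expSize e₁ + expSize e₂)
expSize (case e e₁ e₂) = suc (expSize e + (expSize e₁ + expSize e₂))
expSize (call f es) = suc (expsSize es)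
expsSize [] = 0
expsSize (e ∷ es) = expSize e + expsSize es

module Calls (P : Program) where
  open Program P
  open Semantics P

  -- At most c calls are made.  All other work is bounded by the sizes of the bodies, so the
  -- running time is linear in the number of calls.
  data _⊢_⇓_⟨_⟩ {γ} (ρ : Vec Tree γ) : Exp arity γ → Tree → ℕ → Set
  data _⊢_⇓*_⟨_⟩ {γ} (ρ : Vec Tree γ) : ∀ {a} → Exps arity γ a → Vec Tree a → ℕ → Set

  data _⊢_⇓_⟨_⟩ {γ} ρ where
    ↓var  : ∀ {x} → ρ ⊢ var x ⇓ lookup ρ x ⟨ 0 ⟩
    ↓nil  : ρ ⊢ nil ⇓ nil ⟨ 0 ⟩
    ↓cons : ∀ {e₁ e₂ v₁ v₂ c₁ c₂} →
            ρ ⊢ e₁ ⇓ v₁ ⟨ c₁ ⟩ → ρ ⊢ e₂ ⇓ v₂ ⟨ c₂ ⟩ →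
            ρ ⊢ cons e₁ e₂ ⇓ v₁ ∙ v₂ ⟨ c₁ + c₂ ⟩
    ↓case-nil  : ∀ {e e₁ e₂ v c c₁} →
                 ρ ⊢ e ⇓ nil ⟨ c ⟩ → ρ ⊢ e₁ ⇓ v ⟨ c₁ ⟩ →
                 ρ ⊢ case e e₁ e₂ ⇓ v ⟨ c + c₁ ⟩
    ↓case-cons : ∀ {e e₁ e₂ a b v c c₂} →
                 ρ ⊢ e ⇓ a ∙ b ⟨ c ⟩ → (a ∷ b ∷ ρ) ⊢ e₂ ⇓ v ⟨ c₂ ⟩ →
                 ρ ⊢ case e e₁ e₂ ⇓ v ⟨ c + c₂ ⟩
    ↓call : ∀ {f es vs v c c′} →
            ρ ⊢ es ⇓* vs ⟨ c ⟩ → vs ⊢ body f ⇓ v ⟨ c′ ⟩ →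
            ρ ⊢ call f es ⇓ v ⟨ c + suc c′ ⟩
    ↓weaken : ∀ {e v c d} → c ≤ d → ρ ⊢ e ⇓ v ⟨ c ⟩ → ρ ⊢ e ⇓ v ⟨ d ⟩

  data _⊢_⇓*_⟨_⟩ {γ} ρ where
    []  : ρ ⊢ [] ⇓* [] ⟨ 0 ⟩
    _∷_ : ∀ {a} {e : Exp arity γ} {es : Exps arity γ a} {v vs c c′} →
          ρ ⊢ e ⇓ v ⟨ c ⟩ → ρ ⊢ es ⇓* vs ⟨ c′ ⟩ →
          ρ ⊢ (e ∷ es) ⇓* (v ∷ vs) ⟨ c + c′ ⟩

  module _ (B : ℕ) (bodies : ∀ f → suc (expSize (body f)) ≤ B) where

    private
      both : ∀ {t t′ s s′} c c′ → t ≤ s + B * c → t′ ≤ s′ + B * c′ →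
             t + t′ ≤ (s + s′) + B * (c + c′)
      both {t} {t′} {s} {s′} c c′ p q = begin
        t + t′                          ≤⟨ +-mono-≤ p q ⟩
        (s + B * c) + (s′ + B * c′)     ≡⟨ solve 5 (λ s s′ B c c′ →
          (s :+ B :* c) :+ (s′ :+ B :* c′) := (s :+ s′) :+ B :* (c :+ c′)) refl s s′ B c c′ ⟩
        (s + s′) + B * (c + c′)         ∎
        where
        open ≤-Reasoning
        open +-*-Solver

    -- Within one activation each subexpression is evaluated at most once, so an activation takes at
    -- most as many steps as its body is large. B pays for this and for the step of the call itself.
    calls⇒time : ∀ {γ} {ρ : Vec Tree γ} {e v c} → ρ ⊢ e ⇓ v ⟨ c ⟩ →
                 ∃[ t ] ρ ⊢ e ⇓ v [ t ] × t ≤ expSize e + B * c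
    calls⇒time* : ∀ {γ a} {ρ : Vec Tree γ} {es : Exps arity γ a} {vs c} → ρ ⊢ es ⇓* vs ⟨ c ⟩ →
                  ∃[ t ] ρ ⊢ es ⇓* vs [ t ] × t ≤ expsSize es + B * c
    calls⇒time ↓var = _ , ⇓var , s≤s z≤n
    calls⇒time ↓nil = _ , ⇓nil , s≤s z≤n
    calls⇒time (↓cons {c₁ = c₁} {c₂} d₁ d₂) =
      let t₁ , r₁ , p₁ = calls⇒time d₁ ; t₂ , r₂ , p₂ = calls⇒time d₂
      in _ , ⇓cons r₁ r₂ , s≤s (both c₁ c₂ p₁ p₂)
    calls⇒time (↓case-nil {e₁ = e₁} {c = c} {c₁} d₁ d₂) =
      let t₁ , r₁ , p₁ = calls⇒time d₁ ; t₂ , r₂ , p₂ = calls⇒time d₂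
      in _ , ⇓case-nil r₁ r₂ , s≤s (both c c₁ p₁ (≤-trans p₂ (+-monoˡ-≤ _ (m≤m+n (expSize e₁) _))))
    calls⇒time (↓case-cons {e₂ = e₂} {c = c} {c₂} d₁ d₂) =
      let t₁ , r₁ , p₁ = calls⇒time d₁ ; t₂ , r₂ , p₂ = calls⇒time d₂
      in _ , ⇓case-cons r₁ r₂ , s≤s (both c c₂ p₁ (≤-trans p₂ (+-monoˡ-≤ _ (m≤n+m (expSize e₂) _))))
    calls⇒time (↓call {f = f} {es = es} {c = c} {c′} d₁ d₂) =
      let t₁ , r₁ , p₁ = calls⇒time* d₁ ; t₂ , r₂ , p₂ = calls⇒time d₂
          p₂′ : suc t₂ ≤ 0 + B * suc c′
          p₂′ = ≤-trans (s≤s p₂) (≤-trans (+-monoˡ-≤ (B * c′) (bodies f)) (≤-reflexive (sym (*-suc B c′))))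
      in _ , ⇓call r₁ r₂ , ≤-trans (≤-reflexive (sym (+-suc t₁ t₂)))
        (m≤n⇒m≤1+n (≤-trans (both c (suc c′) p₁ p₂′)
          (≤-reflexive (cong (_+ B * (c + suc c′)) (+-identityʳ (expsSize es))))))
    calls⇒time {e = e} (↓weaken c≤d d) =
      let t , r , p = calls⇒time d in t , r , ≤-trans p (+-monoʳ-≤ (expSize e) (*-monoʳ-≤ B c≤d))
    calls⇒time* [] = 0 , ⇓[] , z≤n
    calls⇒time* (_∷_ {c = c} {c′} d ds) =
      let t₁ , r₁ , p₁ = calls⇒time d ; t₂ , r₂ , p₂ = calls⇒time* ds
      in _ , ⇓∷ r₁ r₂ , both c c′ p₁ p₂

  ↓or : ∀ {γ} {ρ : Vec Tree γ} {e₁ e₂ b₁ b₂ c₁ c₂} →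
        ρ ⊢ e₁ ⇓ encBool b₁ ⟨ c₁ ⟩ → ρ ⊢ e₂ ⇓ encBool b₂ ⟨ c₂ ⟩ →
        ρ ⊢ case e₁ e₂ (cons nil nil) ⇓ encBool (b₁ ∨ b₂) ⟨ c₁ + c₂ ⟩
  ↓or {b₁ = false} d₁ d₂ = ↓case-nil d₁ d₂
  ↓or {b₁ = true} {c₁ = c₁} d₁ d₂ = ↓case-cons d₁ (↓weaken z≤n (↓cons ↓nil ↓nil))

  ↓and : ∀ {γ} {ρ : Vec Tree γ} {e₁ e₂ b₁ b₂ c₁ c₂} →
         ρ ⊢ e₁ ⇓ encBool b₁ ⟨ c₁ ⟩ → (nil ∷ nil ∷ ρ) ⊢ e₂ ⇓ encBool b₂ ⟨ c₂ ⟩ →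
         ρ ⊢ case e₁ nil e₂ ⇓ encBool (b₁ ∧ b₂) ⟨ c₁ + c₂ ⟩
  ↓and {b₁ = false} d₁ d₂ = ↓case-nil d₁ (↓weaken z≤n ↓nil)
  ↓and {b₁ = true} d₁ d₂ = ↓case-cons d₁ d₂

  ↓if : ∀ {γ} {ρ : Vec Tree γ} {e e₁ e₂} b {A : Set} {enc : A → Tree} {x y : A} {c c′} →
        ρ ⊢ e ⇓ encBool b ⟨ c ⟩ →
        (nil ∷ nil ∷ ρ) ⊢ e₂ ⇓ enc x ⟨ c′ ⟩ → ρ ⊢ e₁ ⇓ enc y ⟨ c′ ⟩ →
        ρ ⊢ case e e₁ e₂ ⇓ enc (if b then x else y) ⟨ c + c′ ⟩
  ↓if false d d₂ d₁ = ↓case-nil d d₁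
  ↓if true  d d₂ d₁ = ↓case-cons d d₂

-- The program

pattern #add = zero
pattern #less = suc #add
pattern #equal = suc #less
pattern #fewer = suc #equal
pattern #nth = suc #fewer
pattern #put = suc #nth
pattern #column = suc #put
pattern #select = suc #column
pattern #backward = suc #select
pattern #clash = suc #backward
pattern #kill = suc #clash
pattern #balanced = suc #kill
pattern #cover = suc #balanced
pattern #choose = suc #cover
pattern #pick = suc #choose
pattern #allSets = suc #pick
pattern #someSet = suc #allSets
pattern #prependIf = suc #someSet
pattern #option = suc #prependIf
pattern #options = suc #option
pattern #probeLast = suc #options
pattern #probeFirst = suc #probeLast
pattern #fourteen = suc #probeFirst
pattern #len = suc #fourteen
pattern #solve = suc #len

arities : Vec ℕ 25
arities = 2 ∷ 2 ∷ 2 ∷ 2 ∷ 2 ∷ 3 ∷ 2 ∷ 2 ∷ 3 ∷ 3 ∷ 3 ∷ 3 ∷ 6 ∷ 9 ∷ 10 ∷ 6 ∷ 6 ∷ 3 ∷ 6 ∷ 7 ∷ 8 ∷ 6 ∷ 1 ∷ 1 ∷ 4 ∷ []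

pattern x₀ = var zero
pattern x₁ = var (suc zero)
pattern x₂ = var (suc (suc zero))
pattern x₃ = var (suc (suc (suc zero)))
pattern x₄ = var (suc (suc (suc (suc zero))))
pattern x₅ = var (suc (suc (suc (suc (suc zero)))))
pattern x₆ = var (suc (suc (suc (suc (suc (suc zero))))))
pattern x₇ = var (suc (suc (suc (suc (suc (suc (suc zero)))))))
pattern x₈ = var (suc (suc (suc (suc (suc (suc (suc (suc zero))))))))
pattern x₉ = var (suc (suc (suc (suc (suc (suc (suc (suc (suc zero)))))))))
pattern x₁₀ = var (suc (suc (suc (suc (suc (suc (suc (suc (suc (suc zero))))))))))
pattern x₁₁ = var (suc (suc (suc (suc (suc (suc (suc (suc (suc (suc (suc zero)))))))))))
pattern x₁₂ = var (suc (suc (suc (suc (suc (suc (suc (suc (suc (suc (suc (suc zero))))))))))))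
pattern x₁₃ = var (suc (suc (suc (suc (suc (suc (suc (suc (suc (suc (suc (suc (suc zero)))))))))))))
pattern x₁₄ = var (suc (suc (suc (suc (suc (suc (suc (suc (suc (suc (suc (suc (suc (suc zero))))))))))))))
pattern x₁₅ = var (suc (suc (suc (suc (suc (suc (suc (suc (suc (suc (suc (suc (suc (suc (suc zero)))))))))))))))

private
  E : ℕ → Set
  E = Exp (lookup arities)

suc′ : ∀ {γ} → E γ → E γ
suc′ e = cons nil e

1′ 2′ 3′ : ∀ {γ} → E γ
1′ = suc′ nil
2′ = suc′ 1′
3′ = suc′ 2′

code : (f : Fin 25) → E (lookup arities f)
code #add = case x₀ x₁ (suc′ (call #add (x₁ ∷ x₃ ∷ [])))
code #less = case x₁ nil (case x₂ 1′ (call #less (x₁ ∷ x₃ ∷ [])))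
code #equal = case x₀ (case x₁ 1′ nil) (case x₃ nil (call #equal (x₃ ∷ x₁ ∷ [])))
code #fewer =
  case x₁ nil (case x₂ 1′ (case x₀ (call #fewer (x₁ ∷ x₅ ∷ [])) (call #fewer (x₃ ∷ x₅ ∷ []))))
code #nth = case x₀ nil (case x₃ x₀ (call #nth (x₃ ∷ x₁ ∷ [])))
code #put = case x₀ nil (case x₃ (cons x₄ x₁) (cons x₂ (call #put (x₃ ∷ x₁ ∷ x₆ ∷ []))))
code #column = case x₀ nil (cons (call #nth (x₀ ∷ x₃ ∷ [])) (call #column (x₁ ∷ x₃ ∷ [])))
code #select =
  case x₀ nil (cons (case x₀ 1′ (call #equal (x₂ ∷ x₅ ∷ []))) (call #select (x₁ ∷ x₃ ∷ [])))
code #backward = case x₀ nil (case x₄ nil (call #less (x₆ ∷ x₅ ∷ [])))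
code #clash =
  case x₀ nil (case x₄ nil
    (case (call #backward (x₂ ∷ x₅ ∷ x₀ ∷ [])) (call #clash (x₃ ∷ x₅ ∷ x₁ ∷ [])) 1′))
code #kill =
  case x₀ nil (case x₄ nil
    (cons (case (call #backward (x₂ ∷ x₅ ∷ x₀ ∷ [])) x₀ nil) (call #kill (x₃ ∷ x₅ ∷ x₁ ∷ []))))
code #balanced =
  case (call #fewer (call #select (x₀ ∷ nil ∷ []) ∷ x₂ ∷ [])) nil
  (case (call #fewer (call #select (x₂ ∷ 1′ ∷ []) ∷ x₃ ∷ [])) nil
  (case (call #fewer (call #select (x₄ ∷ 2′ ∷ []) ∷ x₅ ∷ [])) nil
  (call #fewer (call #select (x₆ ∷ 3′ ∷ []) ∷ x₇ ∷ []))))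
code #cover =
  case x₀ (call #balanced (x₁ ∷ x₄ ∷ x₅ ∷ []))
    (case (call #clash (call #nth (x₅ ∷ x₁ ∷ []) ∷ call #nth (x₃ ∷ x₁ ∷ []) ∷ x₃ ∷ []))
      (call #cover (x₁ ∷ x₃ ∷ x₄ ∷ x₅ ∷ x₆ ∷ x₇ ∷ []))
      (case x₆ nil
        (case (call #cover (x₅ ∷ call #put (x₇ ∷ x₅ ∷ nil ∷ []) ∷ x₁ ∷ x₉ ∷ x₁₀ ∷ x₁₁ ∷ []))
          (call #cover (x₅ ∷ call #kill (call #nth (x₉ ∷ x₅ ∷ []) ∷ call #nth (x₇ ∷ x₅ ∷ []) ∷ x₇ ∷ [])
            ∷ x₁ ∷ x₉ ∷ x₁₀ ∷ x₁₁ ∷ []))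
          1′)))
code #choose =
  case x₀ (call #cover (x₄ ∷ x₁ ∷ x₅ ∷ x₆ ∷ x₇ ∷ x₈ ∷ []))
    (call #pick (call #nth (x₅ ∷ x₁ ∷ []) ∷ x₁ ∷ x₃ ∷ x₄ ∷ x₅ ∷ x₆ ∷ x₇ ∷ x₈ ∷ x₉ ∷ x₁₀ ∷ []))
code #pick =
  case x₀ (call #choose (x₁ ∷ x₂ ∷ x₃ ∷ x₄ ∷ x₅ ∷ x₆ ∷ x₇ ∷ x₈ ∷ x₉ ∷ []))
    (case x₁
      (call #choose (x₃ ∷ call #put (x₄ ∷ x₃ ∷ x₀ ∷ []) ∷ x₅ ∷ x₆ ∷ x₇ ∷ x₈ ∷ x₉ ∷ x₁₀ ∷ x₁₁ ∷ []))
      (case x₇ nil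
        (case (call #choose (x₇ ∷ call #put (x₈ ∷ x₇ ∷ x₄ ∷ []) ∷ x₁ ∷ x₁₀ ∷ x₁₁ ∷ x₁₂ ∷ x₁₃ ∷ x₁₄ ∷ x₁₅ ∷ []))
          (call #pick (x₅ ∷ x₇ ∷ x₈ ∷ x₁ ∷ x₁₀ ∷ x₁₁ ∷ x₁₂ ∷ x₁₃ ∷ x₁₄ ∷ x₁₅ ∷ []))
          1′)))
code #allSets =
  case x₀
    (case (call #fewer (x₁ ∷ suc′ x₄ ∷ []))
      -- The variable `x₃` is n. It serves as the index, the list of undecided parts, the budget,
      -- the number of vertices and the bound M, and its successor as K.
      (call #choose (x₃ ∷ x₃ ∷ x₃ ∷ x₁ ∷ x₃ ∷ nil ∷ x₅ ∷ x₃ ∷ suc′ x₃ ∷ []))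
      1′)
    (case (call #nth (x₄ ∷ x₁ ∷ []))
      (case (call #allSets (x₁ ∷ x₃ ∷ x₄ ∷ x₅ ∷ x₆ ∷ x₇ ∷ [])) nil
        (call #allSets (x₃ ∷ call #put (x₅ ∷ x₃ ∷ cons 1′ (cons 2′ nil) ∷ []) ∷ x₆ ∷ x₇ ∷ x₈ ∷ x₉ ∷ [])))
      (call #allSets (x₃ ∷ x₅ ∷ x₆ ∷ x₇ ∷ x₈ ∷ x₉ ∷ [])))
code #someSet =
  case x₀
    (case (call #fewer (x₁ ∷ suc′ x₄ ∷ [])) nil
      (call #allSets (x₄ ∷ x₄ ∷ x₃ ∷ x₄ ∷ x₅ ∷ x₇ ∷ [])))
    (case (call #someSet (x₁ ∷ x₃ ∷ x₄ ∷ x₅ ∷ x₆ ∷ x₇ ∷ []))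
      (call #someSet (x₁ ∷ call #put (x₃ ∷ x₁ ∷ 1′ ∷ []) ∷ x₄ ∷ x₅ ∷ x₆ ∷ x₇ ∷ []))
      1′)
code #prependIf = case x₀ x₂ (cons x₃ x₄)
code #option =
  call #prependIf (call #fewer (x₁ ∷ x₂ ∷ []) ∷ 1′ ∷
    call #prependIf (case (call #fewer (x₀ ∷ x₃ ∷ [])) nil (call #fewer (x₃ ∷ x₇ ∷ [])) ∷ 2′ ∷
      call #prependIf (call #fewer (x₀ ∷ x₄ ∷ []) ∷ 3′ ∷ nil ∷ []) ∷ []) ∷ [])
code #options =
  case x₀ x₁
    (call #options (x₁ ∷
      cons (call #option (call #nth (x₄ ∷ x₁ ∷ []) ∷ call #column (x₄ ∷ x₁ ∷ []) ∷ x₅ ∷ x₆ ∷ x₇ ∷ x₈ ∷ [])) x₃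
      ∷ x₄ ∷ x₅ ∷ x₆ ∷ x₇ ∷ x₈ ∷ []))
code #probeLast =
  case (call #choose (x₄ ∷ x₄ ∷ call #fourteen (x₅ ∷ []) ∷
      call #options (x₄ ∷ nil ∷ x₇ ∷ x₃ ∷ x₂ ∷ x₁ ∷ x₀ ∷ []) ∷
      x₄ ∷ x₅ ∷ x₇ ∷ suc′ (call #add (x₆ ∷ x₅ ∷ [])) ∷ suc′ x₅ ∷ []))
    (case x₀ nil (call #probeLast (x₁ ∷ suc′ x₃ ∷ x₄ ∷ x₅ ∷ x₆ ∷ x₇ ∷ x₈ ∷ x₉ ∷ [])))
    1′
code #probeFirst =
  case (call #probeLast (x₂ ∷ x₃ ∷ x₀ ∷ x₁ ∷ x₂ ∷ x₃ ∷ x₄ ∷ x₅ ∷ []))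
    (case x₀ nil (call #probeFirst (x₁ ∷ suc′ x₃ ∷ x₄ ∷ x₅ ∷ x₆ ∷ x₇ ∷ [])))
    1′
code #fourteen =
  case x₀ nil (suc′ (suc′ (suc′ (suc′ (suc′ (suc′ (suc′
    (suc′ (suc′ (suc′ (suc′ (suc′ (suc′ (suc′ (call #fourteen (x₁ ∷ []))))))))))))))))
code #len = case x₀ nil (suc′ (call #len (x₁ ∷ [])))
code #solve =
  case (call #less (x₃ ∷ call #add (x₀ ∷ x₀ ∷ []) ∷ []))
    (call #someSet (x₃ ∷ x₃ ∷ x₃ ∷ x₀ ∷ x₁ ∷ x₂ ∷ []))
    (call #probeFirst (x₅ ∷ x₃ ∷ x₅ ∷ x₃ ∷ x₂ ∷ x₄ ∷ []))

solver : Program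
solver = record
  { arity = lookup arities
  ; body  = code
  -- The number of vertices is not encoded separately; it is recovered as the number of rows.
  ; main  = case x₀ nil (case x₁ nil (call #solve (x₂ ∷ x₀ ∷ x₁ ∷ call #len (x₁ ∷ []) ∷ [])))
  }

-- Decided by evaluating the sizes of all bodies; 100 is a round upper bound.
small-bodies : ∀ f → suc (expSize (code f)) ≤ 100
small-bodies = from-yes (all? λ f → suc (expSize (code f)) ≤? 100)

-- Powers of two

pattern #double = zero
pattern #power  = suc zero
pattern #sixteen = suc (suc zero)

powersOfTwo : Program
powersOfTwo = record
  { arity = λ (_ : Fin 3) → 1
  ; body  = λ where
      #double  → case x₀ nil (s (s (call #double (x₁ ∷ []))))
      #power   → case x₀ (s nil) (call #double (call #power (x₁ ∷ []) ∷ []))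
      #sixteen → case x₀ nil (s (s (s (s (s (s (s (s (s (s (s (s (s (s (s (s (call #sixteen (x₁ ∷ []))))))))))))))))))
  ; main  = call #power (call #sixteen (x₀ ∷ []) ∷ [])
  }
  where
  s : ∀ {γ} → Exp (λ (_ : Fin 3) → 1) γ → Exp (λ (_ : Fin 3) → 1) γ
  s = cons nil

-- The factor 16 stands on the right so that `suc i * 16` unfolds to the 16 successors that
-- `#sixteen` emits.
2^[i*16]-computable : Computable (λ i → 2 ^ (i * 16))
2^[i*16]-computable = powersOfTwo , λ i →
  let _ , d = sixteen-runs i ; _ , p = power-runs (i * 16)
  in _ , ⇓call (⇓∷ (⇓call (⇓∷ ⇓var ⇓[]) d) ⇓[]) p
  where
  open Program powersOfTwo
  open Semantics powersOfTwo
  double-runs : ∀ x → ∃[ t ] (encNat x ∷ []) ⊢ body #double ⇓ encNat (x * 2) [ t ]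
  double-runs zero    = _ , ⇓case-nil ⇓var ⇓nil
  double-runs (suc x) = let _ , d = double-runs x in
    _ , ⇓case-cons ⇓var (⇓cons ⇓nil (⇓cons ⇓nil (⇓call (⇓∷ ⇓var ⇓[]) d)))
  power-runs : ∀ e → ∃[ t ] (encNat e ∷ []) ⊢ body #power ⇓ encNat (2 ^ e) [ t ]
  power-runs zero    = _ , ⇓case-nil ⇓var (⇓cons ⇓nil ⇓nil)
  power-runs (suc e) = let _ , d = power-runs e ; t , d′ = double-runs (2 ^ e) in
    _ , ⇓case-cons ⇓var (⇓call (⇓∷ (⇓call (⇓∷ ⇓var ⇓[]) d) ⇓[])
      (subst (λ x → (encNat (2 ^ e) ∷ []) ⊢ body #double ⇓ encNat x [ t ]) (*-comm (2 ^ e) 2) d′))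
  sixteen-runs : ∀ i → ∃[ t ] (encNat i ∷ []) ⊢ body #sixteen ⇓ encNat (i * 16) [ t ]
  sixteen-runs zero    = _ , ⇓case-nil ⇓var ⇓nil
  sixteen-runs (suc i) = let _ , d = sixteen-runs i in
    _ , ⇓case-cons ⇓var (s (s (s (s (s (s (s (s (s (s (s (s (s (s (s (s (⇓call (⇓∷ ⇓var ⇓[]) d)))))))))))))))))
    where
    s : ∀ {γ} {ρ : Vec Tree γ} {e v t} → ρ ⊢ e ⇓ v [ t ] → ρ ⊢ cons nil e ⇓ nil ∙ v [ suc (suc t) ]
    s = ⇓cons ⇓nil

-- Evaluation

open Semantics solver
open Calls solver

encFun : {A : Set} {n : ℕ} → (A → Tree) → (Fin n → A) → Tree
encFun enc f = encList (tabulate (enc ∘ f))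

encPart : Part → Tree
encPart = encNat ∘ rank

encOptions : List Part → Tree
encOptions = encList ∘ map encPart

-- A unary number doubles as a list of nils.  The program passes n for an initial list of
-- undecided parts, of empty options, or of falses.
encNat≡encFun : ∀ {A : Set} {enc : A → Tree} {x} n → enc x ≡ nil → encNat n ≡ encFun {n = n} enc (const x)
encNat≡encFun zero    eq = refl
encNat≡encFun {enc = enc} {x} (suc n) eq =
  cong₂ _∙_ (sym eq) (encNat≡encFun {enc = enc} {x} n eq)

add-runs : ∀ x y → (encNat x ∷ encNat y ∷ []) ⊢ code #add ⇓ encNat (x + y) ⟨ x ⟩
add-runs zero    y = ↓case-nil ↓var ↓var
add-runs (suc x) y =
  ↓case-cons ↓var (↓cons ↓nil (↓call (↓var ∷ ↓var ∷ []) (add-runs x y)))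

less-runs : ∀ x y → (encNat x ∷ encNat y ∷ []) ⊢ code #less ⇓ encBool (x <ᵇ y) ⟨ y ⟩
less-runs x       zero    = ↓case-nil ↓var ↓nil
less-runs zero    (suc y) = ↓weaken z≤n (↓case-cons ↓var (↓case-nil ↓var (↓cons ↓nil ↓nil)))
less-runs (suc x) (suc y) =
  ↓case-cons ↓var (↓case-cons ↓var (↓call (↓var ∷ ↓var ∷ []) (less-runs x y)))

equal-runs : ∀ x y → (encNat x ∷ encNat y ∷ []) ⊢ code #equal ⇓ encBool (x ≡ᵇ y) ⟨ y ⟩
equal-runs zero    zero    = ↓case-nil ↓var (↓case-nil ↓var (↓cons ↓nil ↓nil))
equal-runs zero    (suc y) = ↓weaken z≤n (↓case-nil ↓var (↓case-cons ↓var ↓nil))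
equal-runs (suc x) zero    = ↓case-cons ↓var (↓case-nil ↓var ↓nil)
equal-runs (suc x) (suc y) =
  ↓case-cons ↓var (↓case-cons ↓var (↓call (↓var ∷ ↓var ∷ []) (equal-runs x y)))

isNode : Tree → Bool
isNode nil     = false
isNode (_ ∙ _) = true

-- The program tests only the root constructor, so one routine counts both the value `true` and
-- nonempty option lists. It stops as soon as the threshold is used up.
fewer-runs : ∀ {n} {A : Set} (enc : A → Tree) (p : A → Bool) → (∀ x → isNode (enc x) ≡ p x) →
             (f : Fin n → A) → ∀ m →
             (encFun enc f ∷ encNat m ∷ []) ⊢ code #fewer ⇓ encBool (count (p ∘ f) <ᵇ m) ⟨ n ⟩
fewer-runs enc p eq f zero = ↓weaken z≤n (↓case-nil ↓var ↓nil)
fewer-runs {zero} enc p eq f (suc m) = ↓case-cons ↓var (↓case-nil ↓var (↓cons ↓nil ↓nil))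
fewer-runs {suc n} enc p eq f (suc m) with enc (f zero) | p (f zero) | eq (f zero)
... | nil   | false | _ =
  ↓case-cons ↓var (↓case-cons ↓var (↓case-nil ↓var
    (↓call (↓var ∷ ↓var ∷ []) (fewer-runs enc p eq (f ∘ suc) (suc m)))))
... | _ ∙ _ | true | _ =
  ↓case-cons ↓var (↓case-cons ↓var (↓case-cons ↓var
    (↓call (↓var ∷ ↓var ∷ []) (fewer-runs enc p eq (f ∘ suc) m))))

isNode-encBool : ∀ b → isNode (encBool b) ≡ b
isNode-encBool false = refl
isNode-encBool true  = refl

nth-runs : ∀ {n i} {A : Set} (enc : A → Tree) (f : Fin n → A) u → toℕ u ≡ i →
           (encFun enc f ∷ encNat i ∷ []) ⊢ code #nth ⇓ enc (f u) ⟨ n ⟩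
nth-runs enc f zero    refl = ↓weaken z≤n (↓case-cons ↓var (↓case-nil ↓var ↓var))
nth-runs enc f (suc u) refl =
  ↓case-cons ↓var (↓case-cons ↓var (↓call (↓var ∷ ↓var ∷ []) (nth-runs enc (f ∘ suc) u refl)))

put-runs : ∀ {n i} {A : Set} (enc : A → Tree) (f : Fin n → A) u → toℕ u ≡ i → ∀ x →
           (encFun enc f ∷ encNat i ∷ enc x ∷ []) ⊢ code #put ⇓ encFun enc (updateAt f u (const x)) ⟨ n ⟩
put-runs enc f zero    refl x = ↓weaken z≤n (↓case-cons ↓var (↓case-nil ↓var (↓cons ↓var ↓var)))
put-runs enc f (suc u) refl x =
  ↓case-cons ↓var (↓case-cons ↓var
    (↓cons ↓var (↓call (↓var ∷ ↓var ∷ ↓var ∷ []) (put-runs enc (f ∘ suc) u refl x))))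

column-runs : ∀ {m n i} {A : Set} (enc : A → Tree) (f : Fin m → Fin n → A) v → toℕ v ≡ i →
              (encFun (encFun enc) f ∷ encNat i ∷ []) ⊢ code #column
                ⇓ encFun enc (λ u → f u v) ⟨ m * (2 + n) ⟩
column-runs {zero}      enc f v eq = ↓case-nil ↓var ↓nil
column-runs {suc m} {n} enc f v eq = ↓case-cons ↓var
  (↓weaken (≤-reflexive (cong suc (+-suc n _))) (↓cons
    (↓call (↓var ∷ ↓var ∷ []) (nth-runs enc (f zero) v eq))
    (↓call (↓var ∷ ↓var ∷ []) (column-runs enc (f ∘ suc) v eq))))

rank≤3 : ∀ p → rank p ≤ 3
rank≤3 deleted = z≤n
rank≤3 first   = s≤s z≤n
rank≤3 middle  = s≤s (s≤s z≤n)
rank≤3 last    = s≤s (s≤s (s≤s z≤n))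

select-runs : ∀ {n} (L : Fin n → Part) j →
              (encFun encPart L ∷ encPart j ∷ []) ⊢ code #select
                ⇓ encFun encBool (deletedOr j ∘ L) ⟨ n * 5 ⟩
select-runs {zero}  L j = ↓case-nil ↓var ↓nil
select-runs {suc n} L j = ↓case-cons ↓var
  (↓weaken (≤-reflexive (+-suc 4 _))
    (↓cons (entry (rank (L zero))) (↓call (↓var ∷ ↓var ∷ []) (select-runs (L ∘ suc) j))))
  where
  entry : ∀ x {t l} →
    (encNat x ∷ t ∷ l ∷ encPart j ∷ []) ⊢ case x₀ 1′ (call #equal (x₂ ∷ x₅ ∷ []))
      ⇓ encBool ((0 ≡ᵇ x) ∨ (x ≡ᵇ rank j)) ⟨ 4 ⟩
  entry zero    = ↓weaken z≤n (↓case-nil ↓var (↓cons ↓nil ↓nil))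
  entry (suc x) = ↓case-cons ↓var (↓weaken (s≤s (rank≤3 j))
    (↓call (↓var ∷ ↓var ∷ []) (equal-runs (suc x) (rank j))))

backward-runs : ∀ e p q →
  (encBool e ∷ encPart p ∷ encPart q ∷ []) ⊢ code #backward ⇓ encBool (backward e p q) ⟨ 4 ⟩
backward-runs false p q = ↓weaken z≤n (↓case-nil ↓var ↓nil)
backward-runs true  p q = ↓case-cons ↓var (positive (rank q))
  where
  positive : ∀ y →
    (nil ∷ nil ∷ encBool true ∷ encPart p ∷ encNat y ∷ []) ⊢ case x₄ nil (call #less (x₆ ∷ x₅ ∷ []))
      ⇓ encBool ((0 <ᵇ y) ∧ (y <ᵇ rank p)) ⟨ 4 ⟩
  positive zero    = ↓weaken z≤n (↓case-nil ↓var ↓nil)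
  positive (suc y) = ↓case-cons ↓var
    (↓weaken (s≤s (rank≤3 p)) (↓call (↓var ∷ ↓var ∷ []) (less-runs (suc y) (rank p))))

clash-runs : ∀ {n} (r : Fin n → Bool) p (L : Fin n → Part) →
  (encFun encBool r ∷ encPart p ∷ encFun encPart L ∷ []) ⊢ code #clash
    ⇓ encBool (any λ v → backward (r v) p (L v)) ⟨ n * 6 ⟩
clash-runs {zero}  r p L = ↓case-nil ↓var ↓nil
clash-runs {suc n} r p L = ↓case-cons ↓var (↓case-cons ↓var
  (↓or (↓call (↓var ∷ ↓var ∷ ↓var ∷ []) (backward-runs (r zero) p (L zero)))
       (↓call (↓var ∷ ↓var ∷ ↓var ∷ []) (clash-runs (r ∘ suc) p (L ∘ suc)))))

kill-runs : ∀ {n} (r : Fin n → Bool) p (L : Fin n → Part) →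
  (encFun encBool r ∷ encPart p ∷ encFun encPart L ∷ []) ⊢ code #kill
    ⇓ encFun encPart (λ v → if backward (r v) p (L v) then deleted else L v) ⟨ n * 6 ⟩
kill-runs {zero}  r p L = ↓case-nil ↓var ↓nil
kill-runs {suc n} r p L = ↓case-cons ↓var (↓case-cons ↓var (↓cons
  (↓if b {enc = encPart} (↓call (↓var ∷ ↓var ∷ ↓var ∷ []) (backward-runs (r zero) p (L zero))) ↓nil ↓var)
  (↓call (↓var ∷ ↓var ∷ ↓var ∷ []) (kill-runs (r ∘ suc) p (L ∘ suc)))))
  where b = backward (r zero) p (L zero)

-- Cost

-- stack h b i = i * h + b, unfolding one level of the recursion at a time.
stack : ℕ → ℕ → ℕ → ℕ
stack h b zero    = b
stack h b (suc i) = h + stack h b i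

m≤2^n*m : ∀ n m → m ≤ 2 ^ n * m
m≤2^n*m n m = ≤-trans (≤-reflexive (sym (*-identityˡ m))) (*-monoˡ-≤ m (m^n>0 2 n))

-- Costs are kept in the form 2 ^ f * x, where f is the budget and x the work along a single path of
-- the search tree. A local cost c is then simply a further level of that path.
one-branch : ∀ f {c h} x → c ≤ h → c + 2 ^ f * x ≤ 2 ^ f * (h + x)
one-branch f {c} {h} x c≤h = begin
  c + 2 ^ f * x          ≤⟨ +-monoˡ-≤ _ (≤-trans c≤h (m≤2^n*m f h)) ⟩
  2 ^ f * h + 2 ^ f * x  ≡⟨ *-distribˡ-+ (2 ^ f) h x ⟨
  2 ^ f * (h + x)        ∎
  where open ≤-Reasoning

-- The unit of budget spent on branching supplies the factor 2 for the two subtrees.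
two-branches : ∀ f {c h} x y → c ≤ h → x ≤ y → c + (2 ^ f * x + 2 ^ f * y) ≤ 2 ^ suc f * (h + y)
two-branches f {c} {h} x y c≤h x≤y = begin
  c + (2 ^ f * x + 2 ^ f * y)  ≤⟨ +-monoʳ-≤ c (+-monoˡ-≤ _ (*-monoʳ-≤ (2 ^ f) x≤y)) ⟩
  c + (2 ^ f * y + 2 ^ f * y)  ≡⟨ cong (λ z → c + (2 ^ f * y + z)) (+-identityʳ _) ⟨
  c + 2 * (2 ^ f * y)          ≡⟨ cong (c +_) (*-assoc 2 (2 ^ f) y) ⟨
  c + 2 ^ suc f * y            ≤⟨ one-branch (suc f) y c≤h ⟩
  2 ^ suc f * (h + y)          ∎
  where open ≤-Reasoning

-- Calls made by the covering search

module CoverRuns {n : ℕ} (E : Fin n → Fin n → Bool) where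

  open Search E
  open +-*-Solver

  rows : Tree
  rows = encFun (encFun encBool) E

  -- At each vertex the search for a backward arc takes 3 + 8n calls, and branching adds 6 + 9n for
  -- the two new partings and the recursive calls. The test `balanced` consists of four counts of 2
  -- + 6n calls each.
  coverLevel balanceCost : ℕ
  coverLevel  = 9 + 17 * n
  balanceCost = 8 + 24 * n

  part-runs : ∀ L j m {γ} {ρ : Vec Tree γ} {e₁ e₂ e₃} →
    ρ ⊢ e₁ ⇓ encFun encPart L ⟨ 0 ⟩ → ρ ⊢ e₂ ⇓ encPart j ⟨ 0 ⟩ → ρ ⊢ e₃ ⇓ encNat m ⟨ 0 ⟩ →
    ρ ⊢ call #fewer (call #select (e₁ ∷ e₂ ∷ []) ∷ e₃ ∷ [])
      ⇓ encBool (count (deletedOr j ∘ L) <ᵇ m) ⟨ suc (n * 5) + 0 + suc n ⟩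
  part-runs L j m d₁ d₂ d₃ = ↓call
    (↓call (d₁ ∷ d₂ ∷ []) (select-runs L j) ∷ d₃ ∷ [])
    (fewer-runs encBool _ isNode-encBool (deletedOr j ∘ L) m)

  balanced-runs : ∀ M K L →
    (encFun encPart L ∷ encNat M ∷ encNat K ∷ []) ⊢ code #balanced ⇓ encBool (balanced M K L) ⟨ balanceCost ⟩
  balanced-runs M K L = ↓weaken
    (≤-reflexive (solve 1 (λ n →
       let c = (con 1 :+ n :* con 5) :+ con 0 :+ (con 1 :+ n)
       in c :+ (c :+ (c :+ c)) := con 8 :+ con 24 :* n) refl n))
    (↓and (part-runs L deleted K ↓var ↓nil ↓var)
    (↓and (part-runs L first   M ↓var (↓cons ↓nil ↓nil) ↓var)
    (↓and (part-runs L middle  M ↓var (↓cons ↓nil (↓cons ↓nil ↓nil)) ↓var)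
          (part-runs L last    M ↓var (↓cons ↓nil (↓cons ↓nil (↓cons ↓nil ↓nil))) ↓var))))

  coverCost : ℕ → ℕ
  coverCost = stack coverLevel (suc balanceCost)

  module _ (M K : ℕ) where

    coverEnv : ℕ → Parting → ℕ → Vec Tree 6
    coverEnv i L f = encNat i ∷ encFun encPart L ∷ encNat f ∷ rows ∷ encNat M ∷ encNat K ∷ []

    scanCost : ℕ
    scanCost = 3 + 8 * n

    scan-cost : suc n + (suc n + 0) + suc (n * 6) ≡ scanCost
    scan-cost = solve 1 (λ n → (con 1 :+ n) :+ ((con 1 :+ n) :+ con 0) :+ (con 1 :+ n :* con 6)
                               := con 3 :+ con 8 :* n) refl n

    clashAt-runs : ∀ {γ i} {ρ : Vec Tree γ} {e₁ e₂ e₃} u L → toℕ u ≡ i →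
      ρ ⊢ e₁ ⇓ rows ⟨ 0 ⟩ → ρ ⊢ e₂ ⇓ encNat i ⟨ 0 ⟩ → ρ ⊢ e₃ ⇓ encFun encPart L ⟨ 0 ⟩ →
      ρ ⊢ call #clash (call #nth (e₁ ∷ e₂ ∷ []) ∷ call #nth (e₃ ∷ e₂ ∷ []) ∷ e₃ ∷ [])
        ⇓ encBool (clash u L) ⟨ scanCost ⟩
    clashAt-runs u L eq d₁ d₂ d₃ = ↓weaken
      (≤-reflexive scan-cost)
      (↓call (↓call (d₁ ∷ d₂ ∷ []) (nth-runs (encFun encBool) E u eq) ∷
              ↓call (d₃ ∷ d₂ ∷ []) (nth-runs encPart L u eq) ∷ d₃ ∷ [])
             (clash-runs (E u) (L u) L))

    killAt-runs : ∀ {γ i} {ρ : Vec Tree γ} {e₁ e₂ e₃} u L → toℕ u ≡ i →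
      ρ ⊢ e₁ ⇓ rows ⟨ 0 ⟩ → ρ ⊢ e₂ ⇓ encNat i ⟨ 0 ⟩ → ρ ⊢ e₃ ⇓ encFun encPart L ⟨ 0 ⟩ →
      ρ ⊢ call #kill (call #nth (e₁ ∷ e₂ ∷ []) ∷ call #nth (e₃ ∷ e₂ ∷ []) ∷ e₃ ∷ [])
        ⇓ encFun encPart (kill u L) ⟨ scanCost ⟩
    killAt-runs u L eq d₁ d₂ d₃ = ↓weaken
      (≤-reflexive scan-cost)
      (↓call (↓call (d₁ ∷ d₂ ∷ []) (nth-runs (encFun encBool) E u eq) ∷
              ↓call (d₃ ∷ d₂ ∷ []) (nth-runs encPart L u eq) ∷ d₃ ∷ [])
             (kill-runs (E u) (L u) L))

    scan≤level : scanCost + 1 ≤ coverLevel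
    scan≤level = ≤-trans (m≤m+n _ (5 + 9 * n)) (≤-reflexive
      (solve 1 (λ n → (con 3 :+ con 8 :* n :+ con 1) :+ (con 5 :+ con 9 :* n) := con 9 :+ con 17 :* n) refl n))

    one-cost : ∀ f i → scanCost + (0 + suc (2 ^ f * coverCost i)) ≤ 2 ^ f * coverCost (suc i)
    one-cost f i = ≤-trans
      (≤-reflexive (sym (+-assoc scanCost 1 _)))
      (one-branch f (coverCost i) scan≤level)

    branchCost : ℕ → ℕ
    branchCost x = 6 + 9 * n + (x + x)

    two-cost : ∀ f i → scanCost + branchCost (2 ^ f * coverCost i) ≤ 2 ^ suc f * coverCost (suc i)
    two-cost f i = ≤-trans
      (≤-reflexive (solve 2 (λ n x →
         (con 3 :+ con 8 :* n) :+ (con 6 :+ con 9 :* n :+ (x :+ x))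
         := (con 9 :+ con 17 :* n) :+ (x :+ x)) refl n (2 ^ f * coverCost i)))
      (two-branches f (coverCost i) (coverCost i) ≤-refl ≤-refl)

    deletion-cost : ∀ x → suc n + 0 + suc x + (scanCost + 0 + suc x) ≤ branchCost x
    deletion-cost = λ x → ≤-reflexive (solve 2 (λ n x →
       (con 1 :+ n) :+ con 0 :+ (con 1 :+ x) :+ ((con 3 :+ con 8 :* n) :+ con 0 :+ (con 1 :+ x))
       := con 6 :+ con 9 :* n :+ (x :+ x)) refl n x)

    -- Without a clash no budget is spent, and the single recursive call may cost as much as two
    -- with the smaller budget.
    no-clash-cost : ∀ f x → suc (2 ^ suc f * x) ≤ branchCost (2 ^ f * x)
    no-clash-cost f x = s≤s (≤-trans
      (≤-reflexive (trans (*-assoc 2 (2 ^ f) x) (cong (2 ^ f * x +_) (+-identityʳ _))))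
      (m≤n+m _ (5 + 9 * n)))

    cover-runs : ∀ i i≤n f L →
      coverEnv i L f ⊢ code #cover ⇓ encBool (cover M K i i≤n f L) ⟨ 2 ^ f * coverCost i ⟩
    cover-runs zero i≤n f L =
      ↓weaken (m≤2^n*m f (coverCost 0))
        (↓case-nil ↓var (↓call (↓var ∷ ↓var ∷ ↓var ∷ []) (balanced-runs M K L)))
    cover-runs (suc i) i<n zero L = ↓case-cons ↓var (↓weaken (one-cost 0 i)
      (↓if (clash u L) {enc = encBool} (clashAt-runs u L (toℕ-fromℕ< i<n) ↓var ↓var ↓var)
        (↓weaken z≤n (↓case-nil ↓var ↓nil))
        (↓call (↓var ∷ ↓var ∷ ↓var ∷ ↓var ∷ ↓var ∷ ↓var ∷ []) (cover-runs i _ zero L))))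
      where u = fromℕ< i<n
    cover-runs (suc i) i<n (suc f) L = ↓case-cons ↓var (↓weaken (two-cost f i)
      (↓if (clash u L) {enc = encBool} (clashAt-runs u L (toℕ-fromℕ< i<n) ↓var ↓var ↓var)
        (↓weaken (deletion-cost (2 ^ f * coverCost i)) (↓case-cons ↓var (↓or
          (↓call (↓var ∷ ↓call (↓var ∷ ↓var ∷ ↓nil ∷ []) (put-runs encPart L u (toℕ-fromℕ< i<n) deleted)
                  ∷ ↓var ∷ ↓var ∷ ↓var ∷ ↓var ∷ [])
            (cover-runs i _ f (assign L u deleted)))
          (↓call (↓var ∷ killAt-runs u L (toℕ-fromℕ< i<n) ↓var ↓var ↓var
                  ∷ ↓var ∷ ↓var ∷ ↓var ∷ ↓var ∷ [])
            (cover-runs i _ f (kill u L))))))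
        (↓weaken (no-clash-cost f (coverCost i))
          (↓call (↓var ∷ ↓var ∷ ↓var ∷ ↓var ∷ ↓var ∷ ↓var ∷ []) (cover-runs i _ (suc f) L)))))
      where u = fromℕ< i<n

stack-≥ : ∀ h b i → b ≤ stack h b i
stack-≥ h b zero    = ≤-refl
stack-≥ h b (suc i) = ≤-trans (stack-≥ h b i) (m≤n+m _ h)

stack-mono : ∀ h b {i j} → i ≤ j → stack h b i ≤ stack h b j
stack-mono h b {j = j} z≤n = stack-≥ h b j
stack-mono h b (s≤s i≤j) = +-monoʳ-≤ h (stack-mono h b i≤j)

-- Calls made when placing the vertices

module ChooseRuns {n : ℕ} (E : Fin n → Fin n → Bool) where

  open Search E
  open CoverRuns E
  open +-*-Solver using (con; _:+_; _:*_; _:=_) renaming (solve to solve-+*)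

  pickStep : ℕ
  pickStep = 3 + n

  -- Five levels per vertex: one for `choose` and `suc (length o)`, at most 4, for `pick`. At the
  -- bottom lies one covering search.
  chooseCost : ℕ → ℕ → ℕ
  chooseCost f i = stack pickStep (suc (2 ^ f * coverCost n)) (i * 5)

  module _ (M K f : ℕ) (O : Fin n → List Part) (short : ∀ v → length (O v) ≤ 3) where

    chooseEnv : ℕ → Parting → ℕ → Vec Tree 9
    chooseEnv i L g =
      encNat i ∷ encFun encPart L ∷ encNat g ∷ encFun encOptions O ∷ encNat n ∷
      encNat f ∷ rows ∷ encNat M ∷ encNat K ∷ []

    pickCost : List Part → ℕ → ℕ
    pickCost o i = stack pickStep (chooseCost f i) (suc (length o))

    put-cost : ∀ x → suc n + 0 + suc x ≡ 2 + n + x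
    put-cost = solve-+* 2 (λ n x → con 1 :+ n :+ con 0 :+ (con 1 :+ x) := con 2 :+ n :+ x) refl n

    choose-runs : ∀ i i≤n g L →
      chooseEnv i L g ⊢ code #choose ⇓ encBool (choose M K f O i i≤n g L) ⟨ 2 ^ g * chooseCost f i ⟩
    pick-runs : ∀ o i i<n g L →
      (encOptions o ∷ chooseEnv i L g) ⊢ code #pick
        ⇓ encBool (pick M K f O o i i<n g L) ⟨ 2 ^ g * pickCost o i ⟩
    choose-runs zero i≤n g L = ↓weaken (m≤2^n*m g _)
      (↓case-nil ↓var (↓call (↓var ∷ ↓var ∷ ↓var ∷ ↓var ∷ ↓var ∷ ↓var ∷ []) (cover-runs M K n ≤-refl f L)))
    choose-runs (suc i) i<n g L = ↓case-cons ↓var (↓weaken cost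
      (↓call (↓call (↓var ∷ ↓var ∷ []) (nth-runs encOptions O u (toℕ-fromℕ< i<n)) ∷
          ↓var ∷ ↓var ∷ ↓var ∷ ↓var ∷ ↓var ∷ ↓var ∷ ↓var ∷ ↓var ∷ ↓var ∷ [])
        (pick-runs (O u) i i<n g L)))
      where
      u = fromℕ< i<n
      cost : suc n + 0 + suc (2 ^ g * pickCost (O u) i) ≤ 2 ^ g * chooseCost f (suc i)
      cost = ≤-trans (≤-reflexive (put-cost _))
        (≤-trans (one-branch g (pickCost (O u) i) (n≤1+n _))
          (*-monoʳ-≤ (2 ^ g) (+-monoʳ-≤ pickStep (stack-mono pickStep _ (s≤s (short u))))))
    pick-runs [] i i<n g L = ↓case-nil ↓var (↓weaken (one-branch g _ (s≤s z≤n))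
      (↓call (↓var ∷ ↓var ∷ ↓var ∷ ↓var ∷ ↓var ∷ ↓var ∷ ↓var ∷ ↓var ∷ ↓var ∷ [])
        (choose-runs i _ g L)))
    pick-runs (x ∷ []) i i<n g L = ↓case-cons ↓var (↓case-nil ↓var (↓weaken cost
      (↓call (↓var ∷ ↓call (↓var ∷ ↓var ∷ ↓var ∷ []) (put-runs encPart L (fromℕ< i<n) (toℕ-fromℕ< i<n) x) ∷
          ↓var ∷ ↓var ∷ ↓var ∷ ↓var ∷ ↓var ∷ ↓var ∷ ↓var ∷ [])
        (choose-runs i _ g (assign L (fromℕ< i<n) x)))))
      where
      cost : suc n + 0 + suc (2 ^ g * chooseCost f i) ≤ 2 ^ g * pickCost (x ∷ []) i
      cost = ≤-trans (≤-reflexive (put-cost _))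
        (≤-trans (one-branch g (chooseCost f i) (n≤1+n _)) (*-monoʳ-≤ (2 ^ g) (m≤n+m _ pickStep)))
    pick-runs (x ∷ y ∷ ys) i i<n zero L =
      ↓weaken z≤n (↓case-cons ↓var (↓case-cons ↓var (↓case-nil ↓var ↓nil)))
    pick-runs (x ∷ y ∷ ys) i i<n (suc g) L =
      ↓case-cons ↓var (↓case-cons ↓var (↓case-cons ↓var (↓weaken cost
        (↓or
          (↓call (↓var ∷ ↓call (↓var ∷ ↓var ∷ ↓var ∷ []) (put-runs encPart L (fromℕ< i<n) (toℕ-fromℕ< i<n) x) ∷
              ↓var ∷ ↓var ∷ ↓var ∷ ↓var ∷ ↓var ∷ ↓var ∷ ↓var ∷ [])
            (choose-runs i _ g (assign L (fromℕ< i<n) x)))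
          (↓call (↓var ∷ ↓var ∷ ↓var ∷ ↓var ∷ ↓var ∷ ↓var ∷ ↓var ∷ ↓var ∷ ↓var ∷ ↓var ∷ [])
            (pick-runs (y ∷ ys) i i<n g L))))))
      where
      cost : suc n + 0 + suc (2 ^ g * chooseCost f i) + suc (2 ^ g * pickCost (y ∷ ys) i)
             ≤ 2 ^ suc g * pickCost (x ∷ y ∷ ys) i
      cost = ≤-trans
        (≤-reflexive (solve-+* 3 (λ n x y →
          con 1 :+ n :+ con 0 :+ (con 1 :+ x) :+ (con 1 :+ y) := con 3 :+ n :+ (x :+ y)) refl n _ _))
        (two-branches g (chooseCost f i) (pickCost (y ∷ ys) i) ≤-refl
          (stack-≥ pickStep (chooseCost f i) (suc (length (y ∷ ys)))))

-- Calls made by the exhaustive search and by computing the options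

↓value : ∀ {γ} {ρ : Vec Tree γ} {e v w c} → v ≡ w → ρ ⊢ e ⇓ v ⟨ c ⟩ → ρ ⊢ e ⇓ w ⟨ c ⟩
↓value refl d = d

assign-all : ∀ {n} {A : Set} (P : A → Set) {f : Fin n → A} → (∀ v → P (f v)) →
             ∀ u {x} → P x → ∀ v → P (updateAt f u (const x) v)
assign-all P pf zero    px zero    = px
assign-all P pf zero    px (suc v) = pf (suc v)
assign-all P pf (suc u) px zero    = pf zero
assign-all P pf (suc u) px (suc v) = assign-all P (pf ∘ suc) u px v

drop-tabulate : ∀ {n i} {A : Set} (f : Fin n → A) u → toℕ u ≡ i →
                drop i (tabulate f) ≡ f u ∷ drop (suc i) (tabulate f)
drop-tabulate f zero    refl = refl
drop-tabulate f (suc u) refl = drop-tabulate (f ∘ suc) u refl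

drop-all : ∀ {n} {A : Set} (f : Fin n → A) → drop n (tabulate f) ≡ []
drop-all {zero}  f = refl
drop-all {suc n} f = drop-all (f ∘ suc)

prependIf-runs : ∀ b x xs →
  (encBool b ∷ encPart x ∷ encOptions xs ∷ []) ⊢ code #prependIf ⇓ encOptions (prependIf b x xs) ⟨ 0 ⟩
prependIf-runs false x xs = ↓case-nil ↓var ↓var
prependIf-runs true  x xs = ↓case-cons ↓var (↓cons ↓var ↓var)

isNode-encOptions : ∀ o → isNode (encOptions o) ≡ isNonempty o
isNode-encOptions []      = refl
isNode-encOptions (_ ∷ _) = refl

fourteen-runs : ∀ k → (encNat k ∷ []) ⊢ code #fourteen ⇓ encNat (k * 14) ⟨ k ⟩
fourteen-runs zero = ↓case-nil ↓var ↓nil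
fourteen-runs (suc k) = ↓case-cons ↓var
  (s (s (s (s (s (s (s (s (s (s (s (s (s (s (↓call (↓var ∷ []) (fourteen-runs k))))))))))))))))
  where
  s : ∀ {γ} {ρ : Vec Tree γ} {e v c} → ρ ⊢ e ⇓ v ⟨ c ⟩ → ρ ⊢ suc′ e ⇓ nil ∙ v ⟨ c ⟩
  s = ↓cons ↓nil

len-runs : ∀ {n} {A : Set} (enc : A → Tree) (f : Fin n → A) →
           (encFun enc f ∷ []) ⊢ code #len ⇓ encNat n ⟨ n ⟩
len-runs {zero}  enc f = ↓case-nil ↓var ↓nil
len-runs {suc n} enc f = ↓case-cons ↓var (↓cons ↓nil (↓call (↓var ∷ []) (len-runs enc (f ∘ suc))))

module ListingRuns {n : ℕ} (E : Fin n → Fin n → Bool) where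

  open Search E
  open CoverRuns E
  open ChooseRuns E
  open +-*-Solver using (con; _:+_; _:*_; _:=_) renaming (solve to solve-+*)

  -- Three factors 2 ^ n are nested: for X in `someCost`, for W in `allCost` and for the splitting
  -- of W in `allBase`.
  setStep allBase allCost someBase someCost : ℕ
  setStep  = 4 + 2 * n
  allBase  = 2 + n + 2 ^ n * chooseCost 0 n
  allCost  = 2 ^ n * stack setStep allBase n
  someBase = 2 + n + allCost
  someCost = 2 ^ n * stack setStep someBase n

  leaf-cost : ∀ x → suc n + suc x ≡ 2 + n + x + 0
  leaf-cost = solve-+* 2 (λ n x → con 1 :+ n :+ (con 1 :+ x) := con 2 :+ n :+ x :+ con 0) refl n

  module _ (ℓ : ℕ) where

    allSets-runs : ∀ X i i≤n O → (∀ v → length (O v) ≤ 3) →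
      (encNat i ∷ encFun encOptions O ∷ encFun encBool X ∷ encNat n ∷ encNat ℓ ∷ rows ∷ []) ⊢ code #allSets
        ⇓ encBool (allSets ℓ X i i≤n O) ⟨ 2 ^ i * stack setStep allBase i ⟩
    allSets-runs X zero i≤n O short = ↓case-nil ↓var
      (↓weaken (≤-reflexive (leaf-cost _)) (↓or
        (↓call (↓var ∷ ↓cons ↓nil ↓var ∷ []) (fewer-runs encOptions isNonempty isNode-encOptions O (suc ℓ)))
        (↓call (↓var ∷ ↓value (encNat≡encFun {enc = encPart} n refl) ↓var ∷ ↓var ∷ ↓var ∷ ↓var ∷ ↓nil
            ∷ ↓var ∷ ↓var ∷ ↓cons ↓nil ↓var ∷ [])
          (choose-runs n (suc n) 0 O short n ≤-refl n undecided))))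
    allSets-runs X (suc i) i<n O short = ↓case-cons ↓var (↓weaken cost
      (↓if (X u) {enc = encBool} (↓call (↓var ∷ ↓var ∷ []) (nth-runs encBool X u (toℕ-fromℕ< i<n)))
        (↓weaken (m≤m+n _ _)
          (↓call (↓var ∷ ↓var ∷ ↓var ∷ ↓var ∷ ↓var ∷ ↓var ∷ []) (allSets-runs X i _ O short)))
        (↓and
          (↓call (↓var ∷ ↓var ∷ ↓var ∷ ↓var ∷ ↓var ∷ ↓var ∷ []) (allSets-runs X i _ O short))
          (↓call (↓var ∷
              ↓call (↓var ∷ ↓var ∷ ↓cons (↓cons ↓nil ↓nil) (↓cons (↓cons ↓nil (↓cons ↓nil ↓nil)) ↓nil) ∷ [])
                (put-runs encOptions O u (toℕ-fromℕ< i<n) o)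
              ∷ ↓var ∷ ↓var ∷ ↓var ∷ ↓var ∷ [])
            (allSets-runs X i _ (assign O u o)
              (assign-all (λ o → length o ≤ 3) short u (s≤s (s≤s z≤n))))))))
      where
      u = fromℕ< i<n
      o : List Part
      o = first ∷ middle ∷ []
      x = stack setStep allBase i
      cost : suc n + (suc (2 ^ i * x) + (suc n + 0 + suc (2 ^ i * x))) ≤ 2 ^ suc i * (setStep + x)
      cost = ≤-trans (≤-reflexive (solve-+* 2 (λ n x →
          con 1 :+ n :+ (con 1 :+ x :+ (con 1 :+ n :+ con 0 :+ (con 1 :+ x)))
          := con 4 :+ con 2 :* n :+ (x :+ x)) refl n (2 ^ i * x)))
        (two-branches i x x ≤-refl ≤-refl)

    someSet-runs : ∀ k i i≤n X →
      (encNat i ∷ encFun encBool X ∷ encNat n ∷ encNat ℓ ∷ encNat k ∷ rows ∷ []) ⊢ code #someSet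
        ⇓ encBool (someSet ℓ k i i≤n X) ⟨ 2 ^ i * stack setStep someBase i ⟩
    someSet-runs k zero i≤n X = ↓case-nil ↓var
      (↓weaken (≤-reflexive (leaf-cost _)) (↓and
        (↓call (↓var ∷ ↓cons ↓nil ↓var ∷ []) (fewer-runs encBool _ isNode-encBool X (suc k)))
        (↓call (↓var ∷ ↓value (encNat≡encFun {enc = encOptions} n refl) ↓var ∷ ↓var ∷ ↓var ∷ ↓var ∷ ↓var ∷ [])
          (allSets-runs X n ≤-refl (λ _ → []) (λ _ → z≤n)))))
    someSet-runs k (suc i) i<n X = ↓case-cons ↓var (↓weaken cost (↓or
      (↓call (↓var ∷ ↓var ∷ ↓var ∷ ↓var ∷ ↓var ∷ ↓var ∷ []) (someSet-runs k i _ X))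
      (↓call (↓var ∷
          ↓call (↓var ∷ ↓var ∷ ↓cons ↓nil ↓nil ∷ []) (put-runs encBool X u (toℕ-fromℕ< i<n) true)
          ∷ ↓var ∷ ↓var ∷ ↓var ∷ ↓var ∷ [])
        (someSet-runs k i _ (assign X u true)))))
      where
      u = fromℕ< i<n
      x = stack setStep someBase i
      cost : suc (2 ^ i * x) + (suc n + 0 + suc (2 ^ i * x)) ≤ 2 ^ suc i * (setStep + x)
      cost = ≤-trans (≤-reflexive (solve-+* 2 (λ n x →
          con 1 :+ x :+ (con 1 :+ n :+ con 0 :+ (con 1 :+ x))
          := con 3 :+ n :+ (x :+ x)) refl n (2 ^ i * x)))
        (two-branches i x x (s≤s (s≤s (s≤s (m≤n⇒m≤1+n (m≤m+n n _))))) ≤-refl)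

  optionsStep : ℕ
  optionsStep = 11 + 7 * n + n * n

  module _ (ak na bk nb : ℕ) where

    opt : Fin n → List Part
    opt = options ak na bk nb

    option-runs : ∀ v →
      (encFun encBool (E v) ∷ encFun encBool (λ w → E w v) ∷
        encNat ak ∷ encNat na ∷ encNat bk ∷ encNat nb ∷ []) ⊢ code #option
        ⇓ encOptions (opt v) ⟨ 7 + 4 * n ⟩
    option-runs v = ↓weaken
      (≤-reflexive (solve-+* 1 (λ n →
        (con 1 :+ n :+
          (((con 1 :+ n :+ (con 1 :+ n)) :+ (((con 1 :+ n :+ con 0) :+ con 1) :+ con 0)) :+ con 1 :+ con 0))
          :+ con 1 := con 7 :+ con 4 :* n) refl n))
      (↓call (few (λ w → E w v) ak ↓var ↓var ∷ ↓cons ↓nil ↓nil ∷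
        ↓call (↓and (few (E v) na ↓var ↓var) (few (λ w → E w v) nb ↓var ↓var) ∷ ↓cons ↓nil (↓cons ↓nil ↓nil) ∷
          ↓call (few (E v) bk ↓var ↓var ∷ ↓cons ↓nil (↓cons ↓nil (↓cons ↓nil ↓nil)) ∷ ↓nil ∷ [])
            (prependIf-runs _ last []) ∷ [])
          (prependIf-runs _ middle _) ∷ [])
        (prependIf-runs _ first _))
      where
      few : ∀ (p : Fin n → Bool) m {γ} {ρ : Vec Tree γ} {e₁ e₂} →
        ρ ⊢ e₁ ⇓ encFun encBool p ⟨ 0 ⟩ → ρ ⊢ e₂ ⇓ encNat m ⟨ 0 ⟩ →
        ρ ⊢ call #fewer (e₁ ∷ e₂ ∷ []) ⇓ encBool (count p <ᵇ m) ⟨ suc n ⟩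
      few p m d₁ d₂ = ↓call (d₁ ∷ d₂ ∷ []) (fewer-runs encBool _ isNode-encBool p m)

    -- The index runs downwards so that consing builds the list in the right order; the accumulator
    -- holds the entries from i on.
    options-runs : ∀ i → i ≤ n →
      (encNat i ∷ encList (drop i (tabulate (encOptions ∘ opt))) ∷ rows ∷
        encNat ak ∷ encNat na ∷ encNat bk ∷ encNat nb ∷ []) ⊢ code #options
        ⇓ encFun encOptions opt ⟨ i * optionsStep ⟩
    options-runs zero    i≤n = ↓case-nil ↓var ↓var
    options-runs (suc i) i<n = ↓case-cons ↓var (↓weaken cost
      (↓call (↓var ∷
          ↓value (sym (cong encList (drop-tabulate (encOptions ∘ opt) u (toℕ-fromℕ< i<n))))
            (↓cons (↓call
              (↓call (↓var ∷ ↓var ∷ []) (nth-runs (encFun encBool) E u (toℕ-fromℕ< i<n)) ∷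
               ↓call (↓var ∷ ↓var ∷ []) (column-runs encBool E u (toℕ-fromℕ< i<n)) ∷
               ↓var ∷ ↓var ∷ ↓var ∷ ↓var ∷ [])
              (option-runs u)) ↓var)
          ∷ ↓var ∷ ↓var ∷ ↓var ∷ ↓var ∷ ↓var ∷ [])
        (options-runs i (<⇒≤ i<n))))
      where
      u = fromℕ< i<n
      cost : suc n + (suc (n * (2 + n)) + 0) + suc (7 + 4 * n) + 0 + 0 + suc (i * optionsStep)
             ≤ optionsStep + i * optionsStep
      cost = ≤-reflexive (solve-+* 2 (λ n x →
        con 1 :+ n :+ (con 1 :+ n :* (con 2 :+ n) :+ con 0) :+ (con 8 :+ con 4 :* n)
          :+ con 0 :+ con 0 :+ (con 1 :+ x)
        := con 11 :+ con 7 :* n :+ n :* n :+ x) refl n (i * optionsStep))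

    options-short : ∀ v → length (opt v) ≤ 3
    options-short v = short (indegree v <ᵇ ak) ((outdegree v <ᵇ na) ∧ (indegree v <ᵇ nb)) (outdegree v <ᵇ bk)
      where
      short : ∀ a b c → length (prependIf a first (prependIf b middle (prependIf c last []))) ≤ 3
      short false false false = z≤n
      short false false true  = s≤s z≤n
      short false true  false = s≤s z≤n
      short false true  true  = s≤s (s≤s z≤n)
      short true  false false = s≤s z≤n
      short true  false true  = s≤s (s≤s z≤n)
      short true  true  false = s≤s (s≤s z≤n)
      short true  true  true  = s≤s (s≤s (s≤s z≤n))

-- Calls made by the whole algorithm

module DecideRuns {n : ℕ} (E : Fin n → Fin n → Bool) (ℓ k : ℕ) where

  open Search E
  open CoverRuns E
  open ChooseRuns E
  open ListingRuns E

  probeCost lastCost : ℕ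
  probeCost = suc k + (suc (n * optionsStep) + (suc ℓ + 0)) + suc (2 ^ (k * 14) * chooseCost k n)
  lastCost  = suc n * suc probeCost

  probe-runs : ∀ ak na bk nb →
    (encNat nb ∷ encNat bk ∷ encNat na ∷ encNat ak ∷ encNat n ∷ encNat k ∷ encNat ℓ ∷ rows ∷ []) ⊢
      call #choose (x₄ ∷ x₄ ∷ call #fourteen (x₅ ∷ []) ∷
        call #options (x₄ ∷ nil ∷ x₇ ∷ x₃ ∷ x₂ ∷ x₁ ∷ x₀ ∷ []) ∷
        x₄ ∷ x₅ ∷ x₇ ∷ suc′ (call #add (x₆ ∷ x₅ ∷ [])) ∷ suc′ x₅ ∷ [])
      ⇓ encBool (probe ℓ k ak na bk nb) ⟨ probeCost ⟩
  probe-runs ak na bk nb = ↓call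
    (↓var ∷ ↓value (encNat≡encFun {enc = encPart} n refl) ↓var ∷ ↓call (↓var ∷ []) (fourteen-runs k) ∷
      ↓call (↓var ∷ ↓value (sym (cong encList (drop-all (encOptions ∘ options ak na bk nb)))) ↓nil
          ∷ ↓var ∷ ↓var ∷ ↓var ∷ ↓var ∷ ↓var ∷ [])
        (options-runs ak na bk nb n ≤-refl) ∷
      ↓var ∷ ↓var ∷ ↓var ∷ ↓cons ↓nil (↓call (↓var ∷ ↓var ∷ []) (add-runs ℓ k)) ∷ ↓cons ↓nil ↓var ∷ [])
    (choose-runs (suc (ℓ + k)) (suc k) k (options ak na bk nb) (options-short ak na bk nb)
      n ≤-refl (k * 14) undecided)

  probeLast-runs : ∀ ak na bk nb →
    (encNat nb ∷ encNat bk ∷ encNat na ∷ encNat ak ∷ encNat n ∷ encNat k ∷ encNat ℓ ∷ rows ∷ []) ⊢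
      code #probeLast ⇓ encBool (probeLast ℓ k ak na bk nb) ⟨ suc nb * suc probeCost ⟩
  probeLast-runs ak na bk zero = ↓weaken (m≤n⇒m≤1+n ≤-refl)
    (↓or (probe-runs ak na bk zero) (↓case-nil ↓var ↓nil))
  probeLast-runs ak na bk (suc nb) = ↓weaken (≤-reflexive (+-suc probeCost _))
    (↓or (probe-runs ak na bk (suc nb)) (↓case-cons ↓var
      (↓call (↓var ∷ ↓cons ↓nil ↓var ∷ ↓var ∷ ↓var ∷ ↓var ∷ ↓var ∷ ↓var ∷ ↓var ∷ [])
        (probeLast-runs ak na (suc bk) nb))))

  probeFirst-runs : ∀ ak na →
    (encNat na ∷ encNat ak ∷ encNat n ∷ encNat k ∷ encNat ℓ ∷ rows ∷ []) ⊢
      code #probeFirst ⇓ encBool (probeFirst ℓ k ak na) ⟨ suc na * (2 + lastCost) ⟩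
  probeFirst-runs ak zero = ↓weaken (m≤n⇒m≤1+n ≤-refl)
    (↓or (↓call (↓var ∷ ↓var ∷ ↓var ∷ ↓var ∷ ↓var ∷ ↓var ∷ ↓var ∷ ↓var ∷ []) (probeLast-runs ak zero k n))
      (↓case-nil ↓var ↓nil))
  probeFirst-runs ak (suc na) = ↓weaken (s≤s (≤-reflexive (+-suc lastCost _)))
    (↓or (↓call (↓var ∷ ↓var ∷ ↓var ∷ ↓var ∷ ↓var ∷ ↓var ∷ ↓var ∷ ↓var ∷ []) (probeLast-runs ak (suc na) k n))
      (↓case-cons ↓var
        (↓call (↓var ∷ ↓cons ↓nil ↓var ∷ ↓var ∷ ↓var ∷ ↓var ∷ ↓var ∷ []) (probeFirst-runs (suc ak) na))))

  searchCost decideCost : ℕ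
  searchCost = if n <ᵇ ℓ + ℓ then suc n * (2 + lastCost) else someCost
  decideCost = suc ℓ + 0 + suc (ℓ + ℓ) + suc searchCost

  decide-runs :
    (encNat ℓ ∷ encNat k ∷ rows ∷ encNat n ∷ []) ⊢ code #solve ⇓ encBool (decide ℓ k) ⟨ decideCost ⟩
  decide-runs with n <ᵇ ℓ + ℓ | less-runs n (ℓ + ℓ)
  ... | true  | less = ↓case-cons (↓call (↓var ∷ ↓call (↓var ∷ ↓var ∷ []) (add-runs ℓ ℓ) ∷ []) less)
    (↓call (↓var ∷ ↓var ∷ ↓var ∷ ↓var ∷ ↓var ∷ ↓var ∷ []) (probeFirst-runs k n))
  ... | false | less = ↓case-nil (↓call (↓var ∷ ↓call (↓var ∷ ↓var ∷ []) (add-runs ℓ ℓ) ∷ []) less)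
    (↓call (↓var ∷ ↓value (encNat≡encFun {enc = encBool} n refl) ↓var ∷ ↓var ∷ ↓var ∷ ↓var ∷ ↓var ∷ [])
      (someSet-runs ℓ k n ≤-refl (λ _ → false)))

module _ (I : Instance) where

  open Search (arc (D I))
  open DecideRuns (arc (D I)) (ℓ I) (k I)

  main-runs : (encInstance I ∷ []) ⊢ Program.main solver ⇓ encBool (decide (ℓ I) (k I))
                ⟨ suc (n I) + 0 + suc decideCost ⟩
  main-runs = ↓case-cons ↓var (↓case-cons ↓var
    (↓call (↓var ∷ ↓var ∷ ↓var ∷ ↓call (↓var ∷ []) (len-runs (encFun encBool) (arc (D I))) ∷ []) decide-runs))

-- Bounding the cost

module Growth (s : ℕ) (100≤s : 100 ≤ s) where

  -- The polynomial degrees j are tracked generously: _⊕_ pays a factor s for each sum.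
  record _≼_,_ (x e j : ℕ) : Set where
    constructor [_]
    field bound : x ≤ 2 ^ e * s ^ j
  open _≼_,_

  instance
    s-nonZero : NonZero s
    s-nonZero = >-nonZero (≤-trans (s≤s z≤n) 100≤s)

  raise : ∀ {x e e′ j j′} → e ≤ e′ → j ≤ j′ → x ≼ e , j → x ≼ e′ , j′
  raise e≤e′ j≤j′ [ p ] = [ ≤-trans p (*-mono-≤ (^-monoʳ-≤ 2 e≤e′) (^-monoʳ-≤ s j≤j′)) ]

  raise₀ : ∀ {x e j} → x ≼ 0 , j → x ≼ e , j
  raise₀ = raise z≤n ≤-refl

  small : ∀ {x} → x ≤ s → x ≼ 0 , 1
  small x≤s = [ ≤-trans x≤s (≤-reflexive (sym (trans (*-identityˡ _) (*-identityʳ s)))) ]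

  -- For a numeral c the implicit argument computes to the unit type and is filled in silently.
  const′ : ∀ c {_ : T (c ≤ᵇ 100)} → c ≼ 0 , 1
  const′ c {t} = small (≤-trans (≤ᵇ⇒≤ c 100 t) 100≤s)

  power : ∀ e → (2 ^ e) ≼ e , 0
  power e = [ ≤-reflexive (sym (*-identityʳ _)) ]

  infixl 6 _⊕_
  infixl 7 _⊗_

  _⊕_ : ∀ {x y e i j} → x ≼ e , i → y ≼ e , j → (x + y) ≼ e , suc (i ⊔ j)
  _⊕_ {x} {y} {e} {i} {j} p q = [ begin
    x + y                                      ≤⟨ +-mono-≤ (bound (raise ≤-refl (m≤m⊔n i j) p))
                                                           (bound (raise ≤-refl (m≤n⊔m i j) q)) ⟩
    z + z                                      ≡⟨ cong (z +_) (+-identityʳ z) ⟨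
    2 * z                                      ≤⟨ *-monoˡ-≤ z (≤-trans (≤ᵇ⇒≤ 2 100 _) 100≤s) ⟩
    s * (2 ^ e * s ^ (i ⊔ j))                  ≡⟨ *-assoc s (2 ^ e) _ ⟨
    s * 2 ^ e * s ^ (i ⊔ j)                    ≡⟨ cong (_* s ^ (i ⊔ j)) (*-comm s (2 ^ e)) ⟩
    2 ^ e * s * s ^ (i ⊔ j)                    ≡⟨ *-assoc (2 ^ e) s _ ⟩
    2 ^ e * s ^ suc (i ⊔ j)                    ∎ ]
    where
    open ≤-Reasoning
    z = 2 ^ e * s ^ (i ⊔ j)

  _⊗_ : ∀ {x y e e′ i j} → x ≼ e , i → y ≼ e′ , j → (x * y) ≼ (e + e′) , (i + j)
  _⊗_ {x} {y} {e} {e′} {i} {j} [ p ] [ q ] = [ begin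
    x * y                                    ≤⟨ *-mono-≤ p q ⟩
    2 ^ e * s ^ i * (2 ^ e′ * s ^ j)         ≡⟨ [m*n]*[o*p]≡[m*o]*[n*p] (2 ^ e) (s ^ i) (2 ^ e′) (s ^ j) ⟩
    2 ^ e * 2 ^ e′ * (s ^ i * s ^ j)         ≡⟨ cong₂ _*_ (^-distribˡ-+-* 2 e e′) (^-distribˡ-+-* s i j) ⟨
    2 ^ (e + e′) * s ^ (i + j)               ∎ ]
    where open ≤-Reasoning

  times-2^ : ∀ e {x e′ e″ j} → e + e′ ≤ e″ → x ≼ e′ , j → (2 ^ e * x) ≼ e″ , j
  times-2^ e le p = raise le ≤-refl (power e ⊗ p)

  stack-≼ : ∀ h b x {e i} → (x * h + b) ≼ e , i → stack h b x ≼ e , i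
  stack-≼ h b x p = subst (_≼ _ , _) (sym (stack≡ x)) p
    where
    stack≡ : ∀ x → stack h b x ≡ x * h + b
    stack≡ zero    = refl
    stack≡ (suc x) = trans (cong (h +_) (stack≡ x)) (sym (+-assoc h (x * h) b))

module _ (I : Instance) (s : ℕ) (100≤s : 100 ≤ s) (n≤s : n I ≤ s) where

  private
    N = n I

  open Growth s 100≤s
  open Growth._≼_,_
  open CoverRuns (arc (D I))
  open ChooseRuns (arc (D I))
  open ListingRuns (arc (D I))
  open DecideRuns (arc (D I)) (ℓ I) (k I)

  private
    n≼ : N ≼ 0 , 1
    n≼ = small n≤s

    ℓ<n : ℓ I < N
    ℓ<n = ≤-trans (s≤s (m≤n+m (ℓ I) (k I))) (k+ℓ<n I)

    k<n∸ℓ : k I < N ∸ ℓ I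
    k<n∸ℓ = m+n≤o⇒m≤o∸n (suc (k I)) (k+ℓ<n I)

    ℓ≼ : ℓ I ≼ 0 , 1
    ℓ≼ = small (≤-trans (<⇒≤ ℓ<n) n≤s)

    k≼ : k I ≼ 0 , 1
    k≼ = small (≤-trans (≤-trans (m≤m+n (k I) (ℓ I)) (<⇒≤ (k+ℓ<n I))) n≤s)

    sucᵇ : ∀ {x e j} → x ≼ e , j → suc x ≼ e , suc (1 ⊔ j)
    sucᵇ p = raise₀ (const′ 1) ⊕ p

    -- This degree and the later ones, up to 21, are what `_⊕_` and `_⊗_` yield along the shape of
    -- the cost expressions.
    coverCost≼ : coverCost N ≼ 0 , 5
    coverCost≼ = stack-≼ coverLevel (suc balanceCost) N
      (n≼ ⊗ (const′ 9 ⊕ const′ 17 ⊗ n≼) ⊕ sucᵇ (const′ 8 ⊕ const′ 24 ⊗ n≼))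

    chooseCost≼ : ∀ f → chooseCost f N ≼ f , 7
    chooseCost≼ f = stack-≼ pickStep (suc (2 ^ f * coverCost N)) (N * 5)
      (raise₀ ((n≼ ⊗ const′ 5) ⊗ (const′ 3 ⊕ n≼))
        ⊕ sucᵇ (times-2^ f (≤-reflexive (+-identityʳ f)) coverCost≼))

    setStep≼ : setStep ≼ 0 , 3
    setStep≼ = const′ 4 ⊕ const′ 2 ⊗ n≼

    someCost≼ : someCost ≼ N + (N + N) , 11
    someCost≼ = times-2^ N ≤-refl (stack-≼ setStep someBase N
      (raise₀ (n≼ ⊗ setStep≼) ⊕ (raise₀ (const′ 2 ⊕ n≼) ⊕ allCost≼)))
      where
      allCost≼ : allCost ≼ N + N , 9
      allCost≼ = times-2^ N ≤-refl (stack-≼ setStep allBase N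
        (raise₀ (n≼ ⊗ setStep≼) ⊕ (raise₀ (const′ 2 ⊕ n≼)
          ⊕ times-2^ N (≤-reflexive (+-identityʳ N)) (chooseCost≼ 0))))

    firstCost≼ : (suc N * (2 + lastCost)) ≼ k I * 14 + k I , 15
    firstCost≼ = sucᵇ n≼ ⊗ (raise₀ (const′ 2) ⊕ sucᵇ n≼ ⊗ sucᵇ (raise₀
      (sucᵇ k≼ ⊕ (sucᵇ (n≼ ⊗ (const′ 11 ⊕ const′ 7 ⊗ n≼ ⊕ n≼ ⊗ n≼)) ⊕ (sucᵇ ℓ≼ ⊕ const′ 0)))
      ⊕ sucᵇ (times-2^ (k I * 14) ≤-refl (chooseCost≼ (k I)))))

    -- The exponent is 14k for placing the vertices plus k for covering the backward arcs, and k <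
    -- p.
    k-exponent : k I * 14 + k I ≤ 16 * (N ∸ ℓ I)
    k-exponent = begin
      k I * 14 + k I       ≡⟨ solve-+* 1 (λ k → k :* con 14 :+ k := con 15 :* k) refl (k I) ⟩
      15 * k I             ≤⟨ *-mono-≤ (≤ᵇ⇒≤ 15 16 _) (<⇒≤ k<n∸ℓ) ⟩
      16 * (N ∸ ℓ I)       ∎
      where
      open ≤-Reasoning
      open +-*-Solver using (con; _:+_; _:*_; _:=_) renaming (solve to solve-+*)

    -- From ℓ ≤ p follows n = p + ℓ ≤ 2p, so the three nested enumerations contribute 3n ≤ 6p.
    n-exponent : ℓ I + ℓ I ≤ N → N + (N + N) ≤ 16 * (N ∸ ℓ I)
    n-exponent 2ℓ≤n = begin
      N + (N + N)                ≤⟨ +-mono-≤ n≤2p (+-mono-≤ n≤2p n≤2p) ⟩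
      (p + p) + ((p + p) + (p + p)) ≡⟨ solve-+* 1 (λ p → (p :+ p) :+ ((p :+ p) :+ (p :+ p)) := con 6 :* p) refl p ⟩
      6 * p                      ≤⟨ *-monoˡ-≤ p (≤ᵇ⇒≤ 6 16 _) ⟩
      16 * p                     ∎
      where
      open ≤-Reasoning
      open +-*-Solver using (con; _:+_; _:*_; _:=_) renaming (solve to solve-+*)
      p = N ∸ ℓ I
      n≤2p : N ≤ p + p
      n≤2p = begin
        N          ≡⟨ m∸n+n≡m (<⇒≤ ℓ<n) ⟨
        p + ℓ I    ≤⟨ +-monoʳ-≤ p (m+n≤o⇒m≤o∸n (ℓ I) 2ℓ≤n) ⟩
        p + p      ∎

    searchCost≼ : searchCost ≼ 16 * (N ∸ ℓ I) , 15
    -- Abstracting `<⇒<ᵇ` as well turns it, in the false case, into a refutation of n < 2ℓ.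
    searchCost≼ with N <ᵇ ℓ I + ℓ I | <⇒<ᵇ {N} {ℓ I + ℓ I}
    ... | true  | _ = raise k-exponent ≤-refl firstCost≼
    ... | false | 2ℓ≤n = raise (n-exponent (≮⇒≥ 2ℓ≤n)) (≤ᵇ⇒≤ 11 15 _) someCost≼

  timeBound : expSize (Program.main solver) + 100 * (suc N + 0 + suc decideCost)
              ≤ 2 ^ (16 * (N ∸ ℓ I)) * s ^ 21
  timeBound = bound (raise₀ (const′ (expSize (Program.main solver))) ⊕
    const′ 100 ⊗ (raise₀ (sucᵇ n≼ ⊕ const′ 0) ⊕ sucᵇ
      (raise₀ (sucᵇ ℓ≼ ⊕ const′ 0 ⊕ sucᵇ (ℓ≼ ⊕ ℓ≼)) ⊕ sucᵇ searchCost≼)))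

solver-runs-in : ∀ I → ∃[ t ] Runs solver (encInstance I) (encBool (Search.decide (arc (D I)) (ℓ I) (k I))) t ×
  t ≤ 2 ^ (16 * (n I ∸ ℓ I)) * (100 + n I) ^ 21
solver-runs-in I =
  let t , r , p = calls⇒time 100 small-bodies (main-runs I)
  in t , r , ≤-trans p (timeBound I (100 + n I) (m≤m+n 100 (n I)) (m≤n+m (n I) 100))

-- Conclusion

size-positive : ∀ t → 1 ≤ size t
size-positive nil     = s≤s z≤n
size-positive (_ ∙ _) = s≤s z≤n

n≤size : ∀ I → n I ≤ size (encInstance I)
n≤size I = ≤-trans (rows-size (λ u → encList (tabulate λ v → encBool (arc (D I) u v))))
  (m≤n⇒m≤1+n (≤-trans (m≤n⇒m≤1+n (m≤n+m _ (size (encNat (k I))))) (m≤n+m _ (size (encNat (ℓ I))))))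
  where
  rows-size : ∀ {n} (f : Fin n → Tree) → n ≤ size (encList (tabulate f))
  rows-size {zero}  f = z≤n
  rows-size {suc n} f = s≤s (≤-trans (rows-size (f ∘ suc)) (m≤n+m _ (size (f zero))))

2≤n : ∀ I → 2 ≤ n I
2≤n I = ≤-trans (s≤s (≤-trans (1≤ℓ I) (m≤n+m (ℓ I) (k I)))) (k+ℓ<n I)

100+m≤101*m : ∀ {m} → 1 ≤ m → ∀ {n} → n ≤ m → 100 + n ≤ 101 * m
100+m≤101*m {m} 1≤m n≤m = ≤-trans (+-mono-≤ (*-monoʳ-≤ 100 1≤m) n≤m)
  (≤-reflexive (+-comm (100 * m) m))

^-distribʳ-* : ∀ o m n → (m * n) ^ o ≡ m ^ o * n ^ o
^-distribʳ-* zero    m n = refl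
^-distribʳ-* (suc o) m n =
  trans (cong (m * n *_) (^-distribʳ-* o m n)) ([m*n]*[o*p]≡[m*o]*[n*p] m n (m ^ o) (n ^ o))

-- Fixed-parameter tractability asks for a bare power of n, so the constant 100 has to be absorbed.
-- This is possible because n ≥ 2 and 2 ^ 7 = 128.
100+n≤n^8 : ∀ {n} → 2 ≤ n → 100 + n ≤ n ^ 8
100+n≤n^8 {n} 2≤n = begin
  100 + n         ≤⟨ +-mono-≤ (≤-trans (≤ᵇ⇒≤ 100 128 _) (^-monoˡ-≤ 7 2≤n)) (m≤m^n 6) ⟩
  n ^ 7 + n ^ 7   ≡⟨ cong (n ^ 7 +_) (+-identityʳ (n ^ 7)) ⟨
  2 * n ^ 7       ≤⟨ *-monoˡ-≤ (n ^ 7) 2≤n ⟩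
  n ^ 8           ∎
  where
  open ≤-Reasoning
  instance
    n≢0 : NonZero n
    n≢0 = >-nonZero (≤-trans (s≤s z≤n) 2≤n)
  m≤m^n : ∀ e → n ≤ n ^ suc e
  m≤m^n e = ≤-trans (≤-reflexive (sym (*-identityʳ n))) (*-monoʳ-≤ n (m^n>0 n e))

module _ (P : Program) (d : ℕ)
         (solves : SolvesInTime P (λ I → 2 ^ (16 * (n I ∸ ℓ I)) * (100 + n I) ^ d)) where

  relax : ∀ {τ} → (∀ I → 2 ^ (16 * (n I ∸ ℓ I)) * (100 + n I) ^ d ≤ τ I) → SolvesInTime P τ
  relax bound I semicomplete =
    let b , t , runs , t≤ , correct = solves I semicomplete
    in b , t , runs , ≤-trans t≤ (bound I) , correct

  in-O* : SolvableInO* (λ I → 2 ^ (16 * (n I ∸ ℓ I)))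
  in-O* = P , 101 ^ d , d , relax λ I → *-monoʳ-≤ (2 ^ (16 * (n I ∸ ℓ I)))
    (≤-trans (^-monoˡ-≤ d (100+m≤101*m (size-positive (encInstance I)) (n≤size I)))
      (≤-reflexive (^-distribʳ-* d 101 (size (encInstance I)))))

  fixedParameterTractable : FixedParameterTractable (λ I → n I ∸ ℓ I)
  fixedParameterTractable = (λ i → 2 ^ (i * 16)) , 2^[i*16]-computable , P , 8 * d , relax λ I →
    *-mono-≤ (≤-reflexive (cong (2 ^_) (*-comm 16 (n I ∸ ℓ I))))
      (≤-trans (^-monoˡ-≤ d (100+n≤n^8 (2≤n I))) (≤-reflexive (^-*-assoc (n I) 8 d)))

solver-solves : SolvesInTime solver (λ I → 2 ^ (16 * (n I ∸ ℓ I)) * (100 + n I) ^ 21)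
solver-solves I semicomplete =
  let t , runs , t≤ = solver-runs-in I
  in _ , t , runs , t≤ , decide-correct I semicomplete

mainTheorem6 : SolvableInO* (λ I → 2 ^ (16 * (n I ∸ ℓ I)))
    × FixedParameterTractable (λ I → n I ∸ ℓ I)
mainTheorem6 = in-O* solver 21 solver-solves , fixedParameterTractable solver 21 solver-solves
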